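{- Let $r\leq 1$ be an integer coprime with $3$. Let $p\geq 7$ be a prime such that $p\equiv r\pmod 3$ and $p\geq 3-2r$. Then $$\sum_{k=0}^{p-1}(6k+r)\frac{(\frac{r}3)_k^6}{(1)_k^6}\equiv(-1)^{r+1}p\cdot\frac{\Gamma_p(\frac{r}{3})^6}{\Gamma_p(\frac{2r}3)^3}\sum_{k=0}^{1-r}\frac{(r-1)_k(\frac{r}3)_k^3}{(1)_k(\frac{2r}{3})_k^3}\pmod{p^5}.$$
   Context: $(a)_0=1$ and $(a)_k=a(a+1)\cdots(a+k-1)$ for $k\ge 1$ is the Pochhammer symbol. $\mathbb{Z}_p$ is the ring of $p$-adic integers; a congruence $x\equiv y\pmod{p^n}$ means $x-y\in p^n\mathbb{Z}_p$. $\Gamma_p$ is Morita's $p$-adic Gamma function ($p$ an odd prime): $\Gamma_p(0)=1$; for integers $n\ge1$, $\Gamma_p(n)=(-1)^n\prod_{1\le k<n,\ p\nmid k}k$; and for $x\in\mathbb{Z}_p$, $\Gamma_p(x)=\lim_{n\to x}\Gamma_p(n)$, where the limit is over integers $n\geq 1$ with $|n-x|_p\to0$. -}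

module Defs where

open import Algebra.Bundles using (CommutativeRing)
import Algebra.Properties.CommutativeMonoid.Sum as Sum
import Algebra.Properties.Semiring.Exp as Exp
open import Data.Integer.Base as ℤ using (ℤ; +_; -[1+_]; 0ℤ; 1ℤ; -1ℤ; ∣_∣)
open import Data.Integer.DivMod using (_%ℕ_; _/ℕ_; n%ℕd<d; a≡a%ℕn+[a/ℕn]*n)
open import Data.Integer.Divisibility.Signed as ℤ∣ using (_∣_; divides; ∣ᵤ⇒∣; ∣⇒∣ᵤ)
import Data.Integer.Properties as ℤ
open import Data.Integer.Tactic.RingSolver using (solve-∀)
open import Data.List.Base using (List; []; _∷_; filter; length; upTo)
open import Data.List.Membership.Propositional using (_∈_)
open import Data.List.Membership.Propositional.Properties using (∈-filter⁺; ∈-filter⁻; ∈-upTo⁺; ∈-upTo⁻)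
open import Data.List.Properties using (filter-accept; filter-reject; filter-all; filter-++; length-filter; upTo-∷ʳ)
open import Data.List.Relation.Unary.All as All using (All)
open import Data.List.Relation.Unary.AllPairs using (_∷_)
open import Data.List.Relation.Unary.Any using (here; there)
open import Data.List.Relation.Unary.Unique.Propositional using (Unique)
import Data.List.Relation.Unary.Unique.Propositional.Properties as Unique
open import Data.Nat.Base as ℕ using (ℕ; zero; suc; s≤s; NonZero)
open import Data.Nat.Coprimality using (Coprime; coprime-Bézout)
open import Data.Nat.Divisibility as ℕ∣ using (_∣?_)
open import Data.Nat.GCD using (module Bézout)
open import Data.Nat.ListAction using (product)
open import Data.Nat.ListAction.Properties using (product-++)
open import Data.Nat.Primality using (Prime; prime⇒irreducible; prime⇒nonZero; prime⇒nonTrivial; prime[2])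
import Data.Nat.Properties as ℕ
open import Data.Nat.DivMod using (_%_; m≡m%n+[m/n]*n; m%n<n)
open import Data.Product.Base using (∃; _×_; _,_; proj₁; proj₂)
open import Data.Sum.Base using (_⊎_; inj₁; inj₂; [_,_]′)
open import Function.Base using (_∘_)
open import Level using (0ℓ)
open import Relation.Binary.PropositionalEquality.Core using (_≡_; _≢_; refl; sym; trans; cong; cong₂; subst; subst₂)
open import Relation.Nullary.Decidable.Core using (Dec; yes; no; ¬?)
open import Relation.Nullary.Negation.Core using (¬_; contradiction)

infix 4 _≡_[mod_]

record _≡_[mod_] (a b : ℤ) (m : ℕ) : Set where
  constructor mk
  field
    divisible : + m ∣ a ℤ.- b

open _≡_[mod_] public

module Congruence {m : ℕ} where

  private
    via : ∀ {a b c} → + m ∣ c → c ≡ a ℤ.- b → a ≡ b [mod m ]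
    via d refl = mk d

  abstract

    ≡⇒≈ : ∀ {a b} → a ≡ b → a ≡ b [mod m ]
    ≡⇒≈ {a} refl = via (divides 0ℤ refl) (sym (ℤ.+-inverseʳ a))

    ≈-refl : ∀ {a} → a ≡ a [mod m ]
    ≈-refl = ≡⇒≈ refl

    ≈-sym : ∀ {a b} → a ≡ b [mod m ] → b ≡ a [mod m ]
    ≈-sym {a} {b} (mk d) = via (ℤ∣.∣m⇒∣-m d) (eq a b)
      where
      eq : ∀ a b → ℤ.- (a ℤ.+ ℤ.- b) ≡ b ℤ.+ ℤ.- a
      eq = solve-∀

    ≈-trans : ∀ {a b c} → a ≡ b [mod m ] → b ≡ c [mod m ] → a ≡ c [mod m ]
    ≈-trans {a} {b} {c} (mk d) (mk e) = via (ℤ∣.∣m∣n⇒∣m+n d e) (eq a b c)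
      where
      eq : ∀ a b c → (a ℤ.+ ℤ.- b) ℤ.+ (b ℤ.+ ℤ.- c) ≡ a ℤ.+ ℤ.- c
      eq = solve-∀

    +-≈ : ∀ {a b c d} → a ≡ b [mod m ] → c ≡ d [mod m ] → a ℤ.+ c ≡ b ℤ.+ d [mod m ]
    +-≈ {a} {b} {c} {d} (mk p) (mk q) = via (ℤ∣.∣m∣n⇒∣m+n p q) (eq a b c d)
      where
      eq : ∀ a b c d → (a ℤ.+ ℤ.- b) ℤ.+ (c ℤ.+ ℤ.- d) ≡ (a ℤ.+ c) ℤ.+ ℤ.- (b ℤ.+ d)
      eq = solve-∀

    -‿≈ : ∀ {a b} → a ≡ b [mod m ] → ℤ.- a ≡ ℤ.- b [mod m ]
    -‿≈ {a} {b} (mk p) = via (ℤ∣.∣m⇒∣-m p) (eq a b)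
      where
      eq : ∀ a b → ℤ.- (a ℤ.+ ℤ.- b) ≡ (ℤ.- a) ℤ.+ ℤ.- (ℤ.- b)
      eq = solve-∀

    *-≈ : ∀ {a b c d} → a ≡ b [mod m ] → c ≡ d [mod m ] → a ℤ.* c ≡ b ℤ.* d [mod m ]
    *-≈ {a} {b} {c} {d} (mk p) (mk q) =
      via (ℤ∣.∣m∣n⇒∣m+n (ℤ∣.∣n⇒∣m*n c p) (ℤ∣.∣n⇒∣m*n b q)) (eq a b c d)
      where
      eq : ∀ a b c d → c ℤ.* (a ℤ.+ ℤ.- b) ℤ.+ b ℤ.* (c ℤ.+ ℤ.- d) ≡ (a ℤ.* c) ℤ.+ ℤ.- (b ℤ.* d)
      eq = solve-∀

    *-≈ˡ : ∀ c {a b} → a ≡ b [mod m ] → c ℤ.* a ≡ c ℤ.* b [mod m ]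
    *-≈ˡ c = *-≈ (≈-refl {c})

    *-≈ʳ : ∀ c {a b} → a ≡ b [mod m ] → a ℤ.* c ≡ b ℤ.* c [mod m ]
    *-≈ʳ c p = *-≈ p (≈-refl {c})

    cancelʳ : ∀ {a b} c {u} → c ℤ.* u ≡ 1ℤ [mod m ] → a ℤ.* c ≡ b ℤ.* c [mod m ] → a ≡ b [mod m ]
    cancelʳ {a} {b} c {u} cu≈1 e =
      ≈-trans (≈-sym (undo a)) (≈-trans (*-≈ʳ u e) (undo b))
      where
      undo : ∀ x → x ℤ.* c ℤ.* u ≡ x [mod m ]
      undo x = ≈-trans (≡⇒≈ (ℤ.*-assoc x c u))
                 (≈-trans (*-≈ˡ x cu≈1) (≡⇒≈ (ℤ.*-identityʳ x)))

    ∣⇒≈0 : ∀ {a} → + m ∣ a → a ≡ 0ℤ [mod m ]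
    ∣⇒≈0 {a} d = via d (sym (ℤ.+-identityʳ a))

    ≈0⇒∣ : ∀ {a} → a ≡ 0ℤ [mod m ] → + m ∣ a
    ≈0⇒∣ {a} (mk d) = subst (+ m ∣_) (ℤ.+-identityʳ a) d

    ∣-resp : ∀ {a b} → a ≡ b [mod m ] → + m ∣ b → + m ∣ a
    ∣-resp e d = ≈0⇒∣ (≈-trans e (∣⇒≈0 d))

    residue-unique : ∀ {a b} → a ℕ.< m → b ℕ.< m → + a ≡ + b [mod m ] → a ≡ b
    residue-unique {a} {b} a<m b<m e = [ go b<m e , sym ∘ go a<m (≈-sym e) ]′ (ℕ.≤-total a b)
      where
      go : ∀ {a b} → b ℕ.< m → + a ≡ + b [mod m ] → a ℕ.≤ b → a ≡ b
      go {a} {b} b<m e a≤b = ℕ.≤-antisym a≤b (ℕ.m∸n≡0⇒m≤n (small (b ℕ.∸ a) b∸a<m m∣b∸a))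
        where
        b∸a<m : b ℕ.∸ a ℕ.< m
        b∸a<m = ℕ.≤-<-trans (ℕ.m∸n≤m b a) b<m
        m∣b∸a : m ℕ∣.∣ b ℕ.∸ a
        m∣b∸a = ∣⇒∣ᵤ (subst (+ m ∣_) (trans (ℤ.m-n≡m⊖n b a) (ℤ.⊖-≥ a≤b)) (divisible (≈-sym e)))
        small : ∀ c → c ℕ.< m → m ℕ∣.∣ c → c ≡ 0
        small zero    _   _   = refl
        small (suc c) c<m m∣c = contradiction m∣c (ℕ∣.>⇒∤ c<m)

    %ℕ-≈ : .{{_ : NonZero m}} → ∀ a → + (a %ℕ m) ≡ a [mod m ]
    %ℕ-≈ a = ≈-sym (mk (divides (a /ℕ m) (trans (cong (ℤ._- + (a %ℕ m)) (a≡a%ℕn+[a/ℕn]*n a m))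
               (eq (+ (a %ℕ m)) (a /ℕ m ℤ.* + m)))))
      where
      eq : ∀ x y → (x ℤ.+ y) ℤ.+ ℤ.- x ≡ y
      eq = solve-∀

open Congruence

mod-1 : ∀ {a b} → a ≡ b [mod 1 ]
mod-1 {a} {b} = mk (divides (a ℤ.- b) (sym (ℤ.*-identityʳ (a ℤ.- b))))

≈-weaken : ∀ {m n a b} → m ℕ∣.∣ n → a ≡ b [mod n ] → a ≡ b [mod m ]
≈-weaken m∣n (mk d) = mk (ℤ∣.∣-trans (∣ᵤ⇒∣ m∣n) d)

≥7⇒≢2 : ∀ {p} → 7 ℕ.≤ p → p ≢ 2
≥7⇒≢2 (s≤s (s≤s ())) refl

-- (-1)ⁿ for an integer exponent: -1 is its own inverse, so only ∣n∣ matters.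
[-1]^_ : ℤ → ℤ
[-1]^ n = -1ℤ ℤ.^ ∣ n ∣

module PAdic (p : ℕ) (p-prime : Prime p) where

  private instance
    p-nonZero : NonZero p
    p-nonZero = prime⇒nonZero p-prime

  p^n-nonZero : ∀ n → NonZero (p ℕ.^ n)
  p^n-nonZero n = ℕ.m^n≢0 p n

  residue : ℕ → ℤ → ℕ
  residue k a = _%ℕ_ a (p ℕ.^ k) {{p^n-nonZero k}}

  residue≈ : ∀ k a → + residue k a ≡ a [mod p ℕ.^ k ]
  residue≈ k a = %ℕ-≈ {{p^n-nonZero k}} a

  residue< : ∀ k a → residue k a ℕ.< p ℕ.^ k
  residue< k a = n%ℕd<d a (p ℕ.^ k) {{p^n-nonZero k}}

  p^n∣p^[m+n] : ∀ m n → p ℕ.^ n ℕ∣.∣ p ℕ.^ (m ℕ.+ n)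
  p^n∣p^[m+n] m n = ℕ∣.divides (p ℕ.^ m) (ℕ.^-distribˡ-+-* p m n)

  p^n∣p^[1+n] : ∀ n → p ℕ.^ n ℕ∣.∣ p ℕ.^ suc n
  p^n∣p^[1+n] = p^n∣p^[m+n] 1

  p∣p^[1+n] : ∀ n → p ℕ∣.∣ p ℕ.^ suc n
  p∣p^[1+n] n = ℕ∣.m∣m*n (p ℕ.^ n)

  private
    natUnit : ∀ {a} → Coprime a p → ∃ λ u → + a ℤ.* u ≡ 1ℤ [mod p ]
    natUnit {a} c with coprime-Bézout c
    ... | Bézout.+- x y eq = + x , mk (divides (+ y) (trans (cong (ℤ._- 1ℤ) ax) (lem (+ y ℤ.* + p))))
      where
      ax : + a ℤ.* + x ≡ 1ℤ ℤ.+ + y ℤ.* + p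
      ax = trans (ℤ.*-comm (+ a) (+ x)) (trans (sym (ℤ.pos-* x a)) (trans (cong +_ (sym eq))
             (trans (ℤ.pos-+ 1 (y ℕ.* p)) (cong (λ z → 1ℤ ℤ.+ z) (ℤ.pos-* y p)))))
      lem : ∀ z → (1ℤ ℤ.+ z) ℤ.+ ℤ.- 1ℤ ≡ z
      lem = solve-∀
    ... | Bézout.-+ x y eq = ℤ.- + x , mk (divides (ℤ.- + y) (trans (lem (+ a) (+ x)) (trans (cong ℤ.-_ ax) (ℤ.neg-distribˡ-* (+ y) (+ p)))))
      where
      ax : 1ℤ ℤ.+ + x ℤ.* + a ≡ + y ℤ.* + p
      ax = trans (cong (λ z → 1ℤ ℤ.+ z) (sym (ℤ.pos-* x a))) (trans (sym (ℤ.pos-+ 1 (x ℕ.* a)))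
             (trans (cong +_ eq) (ℤ.pos-* y p)))
      lem : ∀ z w → (z ℤ.* ℤ.- w) ℤ.+ ℤ.- 1ℤ ≡ ℤ.- (1ℤ ℤ.+ w ℤ.* z)
      lem = solve-∀

    coprime : ∀ {a} → ¬ (p ℕ∣.∣ a) → Coprime a p
    coprime p∤a (d∣a , d∣p) with prime⇒irreducible p-prime d∣p
    ... | inj₁ d≡1 = d≡1
    ... | inj₂ refl = contradiction d∣a p∤a

    unit-mod-p : ∀ {a} → ¬ (+ p ∣ a) → ∃ λ u → a ℤ.* u ≡ 1ℤ [mod p ]
    unit-mod-p {+ a}      p∤a = natUnit (coprime (p∤a ∘ ∣ᵤ⇒∣))
    unit-mod-p { -[1+ a ]} p∤a with natUnit (coprime {suc a} (p∤a ∘ ∣ᵤ⇒∣))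
    ... | u , e = ℤ.- u , ≈-trans (≡⇒≈ (lem (+ suc a) u)) e
      where
      lem : ∀ z w → ℤ.- z ℤ.* ℤ.- w ≡ z ℤ.* w
      lem = solve-∀

  abstract

    unit : ∀ {a} → ¬ (+ p ∣ a) → ∀ n → ∃ λ u → a ℤ.* u ≡ 1ℤ [mod p ℕ.^ n ]
    unit     p∤a zero    = 0ℤ , mod-1
    unit {a} p∤a (suc n) with unit-mod-p p∤a | unit p∤a n
    ... | v , mk (divides q e) | u , mk (divides r f) =
      u ℤ.+ v ℤ.* (1ℤ ℤ.- a ℤ.* u) ,
      mk (divides (ℤ.- (q ℤ.* r)) (trans (lem a u v)
        (trans (cong₂ (λ x y → ℤ.- (x ℤ.* y)) e f)
          (trans (lem₂ q (+ p) r (+ (p ℕ.^ n))) (cong (ℤ.- (q ℤ.* r) ℤ.*_) (sym (ℤ.pos-* p (p ℕ.^ n))))))))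
      where
      lem : ∀ a u v → (a ℤ.* (u ℤ.+ v ℤ.* (1ℤ ℤ.+ ℤ.- (a ℤ.* u)))) ℤ.+ ℤ.- 1ℤ
              ≡ ℤ.- (((a ℤ.* v) ℤ.+ ℤ.- 1ℤ) ℤ.* ((a ℤ.* u) ℤ.+ ℤ.- 1ℤ))
      lem = solve-∀
      lem₂ : ∀ q p r s → ℤ.- ((q ℤ.* p) ℤ.* (r ℤ.* s)) ≡ ℤ.- (q ℤ.* r) ℤ.* (p ℤ.* s)
      lem₂ = solve-∀

  -- The ring ℤₚ as the inverse limit of the rings ℤ/pⁿ: approx x n is any
  -- integer representing the residue of x modulo pⁿ.

  record ℤₚ : Set where
    field
      approx   : ℕ → ℤ
      coherent : ∀ n → approx (suc n) ≡ approx n [mod p ℕ.^ n ]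

  open ℤₚ public

  infix 4 _≈_

  record _≈_ (x y : ℤₚ) : Set where
    constructor mk
    field
      at : ∀ n → approx x n ≡ approx y n [mod p ℕ.^ n ]

  open _≈_ public

  coherent⁺ : ∀ x m n → approx x (m ℕ.+ n) ≡ approx x n [mod p ℕ.^ n ]
  coherent⁺ x zero    n = ≈-refl
  coherent⁺ x (suc m) n = ≈-trans (≈-weaken (p^n∣p^[m+n] m n) (coherent x (m ℕ.+ n))) (coherent⁺ x m n)

  ι : ℤ → ℤₚ
  ι a = record { approx = λ _ → a ; coherent = λ _ → ≈-refl }

  private
    _⊕_ _⊗_ : ℤₚ → ℤₚ → ℤₚ
    x ⊕ y = record
      { approx   = λ n → approx x n ℤ.+ approx y n
      ; coherent = λ n → +-≈ (coherent x n) (coherent y n) }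
    x ⊗ y = record
      { approx   = λ n → approx x n ℤ.* approx y n
      ; coherent = λ n → *-≈ (coherent x n) (coherent y n) }

    ⊖_ : ℤₚ → ℤₚ
    ⊖ x = record
      { approx   = λ n → ℤ.- approx x n
      ; coherent = λ n → -‿≈ (coherent x n) }

    pointwise : ∀ {x y} → (∀ n → approx x n ≡ approx y n) → x ≈ y
    pointwise e = mk (λ n → ≡⇒≈ (e n))

  ℤₚ-ring : CommutativeRing 0ℓ 0ℓ
  ℤₚ-ring = record
    { Carrier = ℤₚ ; _≈_ = _≈_ ; _+_ = _⊕_ ; _*_ = _⊗_ ; -_ = ⊖_ ; 0# = ι 0ℤ ; 1# = ι 1ℤ
    ; isCommutativeRing = record
      { isRing = record
        { +-isAbelianGroup = record
          { isGroup = record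
            { isMonoid = record
              { isSemigroup = record
                { isMagma = record
                  { isEquivalence = record
                    { refl  = mk (λ _ → ≈-refl)
                    ; sym   = λ e → mk (λ n → ≈-sym (at e n))
                    ; trans = λ e f → mk (λ n → ≈-trans (at e n) (at f n)) }
                  ; ∙-cong = λ e f → mk (λ n → +-≈ (at e n) (at f n)) }
                ; assoc = λ x y z → pointwise λ n → ℤ.+-assoc (approx x n) (approx y n) (approx z n) }
              ; identity = (λ x → pointwise λ n → ℤ.+-identityˡ (approx x n))
                         , (λ x → pointwise λ n → ℤ.+-identityʳ (approx x n)) }
            ; inverse = (λ x → pointwise λ n → ℤ.+-inverseˡ (approx x n))
                      , (λ x → pointwise λ n → ℤ.+-inverseʳ (approx x n))
            ; ⁻¹-cong = λ e → mk (λ n → -‿≈ (at e n)) }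
          ; comm = λ x y → pointwise λ n → ℤ.+-comm (approx x n) (approx y n) }
        ; *-cong = λ e f → mk (λ n → *-≈ (at e n) (at f n))
        ; *-assoc = λ x y z → pointwise λ n → ℤ.*-assoc (approx x n) (approx y n) (approx z n)
        ; *-identity = (λ x → pointwise λ n → ℤ.*-identityˡ (approx x n))
                     , (λ x → pointwise λ n → ℤ.*-identityʳ (approx x n))
        ; distrib = (λ x y z → pointwise λ n → ℤ.*-distribˡ-+ (approx x n) (approx y n) (approx z n))
                  , (λ x y z → pointwise λ n → ℤ.*-distribʳ-+ (approx x n) (approx y n) (approx z n)) }
      ; *-comm = λ x y → pointwise λ n → ℤ.*-comm (approx x n) (approx y n) } }

  open CommutativeRing ℤₚ-ring public
    using (_+_; _*_; -_; _-_; 0#; 1#; semiring; +-commutativeMonoid)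
  open Exp semiring public using (_^_)
  open Sum +-commutativeMonoid public using (sum-syntax; sum⁺-syntax)

  infix 4 _≡_[mod-p^_]

  _≡_[mod-p^_] : ℤₚ → ℤₚ → ℕ → Set
  x ≡ y [mod-p^ n ] = ∃ λ z → x - y ≈ ι (+ (p ℕ.^ n)) * z

  mod-p^⇒approx : ∀ {x y} n → x ≡ y [mod-p^ n ] → approx x n ≡ approx y n [mod p ℕ.^ n ]
  mod-p^⇒approx {x} {y} n (z , e) =
    mk (∣-resp (at e n) (ℤ∣.∣m⇒∣m*n (approx z n) ℤ∣.∣-refl))

  approx⇒mod-p^ : ∀ {x y} n → approx x n ≡ approx y n [mod p ℕ.^ n ] → x ≡ y [mod-p^ n ]
  approx⇒mod-p^ {x} {y} n e = z , mk (λ m → ≈-sym (≈-trans (≡⇒≈ (eq m)) (coherent-x-y m)))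
    where
    x-y = x - y
    div : ∀ m → + (p ℕ.^ n) ∣ approx x-y (m ℕ.+ n)
    div m = ∣-resp (coherent⁺ x-y m n) (divisible e)
    eq : ∀ m → + (p ℕ.^ n) ℤ.* ℤ∣.quotient (div m) ≡ approx x-y (m ℕ.+ n)
    eq m = trans (ℤ.*-comm (+ (p ℕ.^ n)) _) (sym (_∣_.equality (div m)))
    coherent-x-y : ∀ m → approx x-y (m ℕ.+ n) ≡ approx x-y m [mod p ℕ.^ m ]
    coherent-x-y m = subst (λ k → approx x-y k ≡ approx x-y m [mod p ℕ.^ m ]) (ℕ.+-comm n m) (coherent⁺ x-y n m)
    z : ℤₚ
    z = record
      { approx   = λ m → ℤ∣.quotient (div m)
      ; coherent = λ m → mk (ℤ∣.*-cancelˡ-∣ (+ (p ℕ.^ n)) {{p^n-nonZero n}}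
          (subst₂ _∣_ (trans (cong +_ (trans (ℕ.^-distribˡ-+-* p m n) (ℕ.*-comm (p ℕ.^ m) (p ℕ.^ n)))) (ℤ.pos-* (p ℕ.^ n) (p ℕ.^ m)))
            (trans (cong₂ ℤ._-_ (sym (eq (suc m))) (sym (eq m))) (lem (+ (p ℕ.^ n)) (ℤ∣.quotient (div (suc m))) (ℤ∣.quotient (div m))))
            (divisible (coherent x-y (m ℕ.+ n))))) }
      where
      lem : ∀ a b c → (a ℤ.* b) ℤ.+ ℤ.- (a ℤ.* c) ≡ a ℤ.* (b ℤ.+ ℤ.- c)
      lem = solve-∀

  abstract

    inverse-exists : ∀ x → ¬ (+ p ∣ approx x 1) → ∃ λ y → x * y ≈ 1#
    inverse-exists x p∤x = y , mk x*y≈1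
      where
      p∤ : ∀ n → ¬ (+ p ∣ approx x (suc n))
      p∤ n p∣ = p∤x (∣-resp (≈-weaken (ℕ∣.∣-reflexive (sym (ℕ.^-identityʳ p)))
        (subst (λ k → approx x 1 ≡ approx x k [mod p ℕ.^ 1 ]) (ℕ.+-comm n 1) (≈-sym (coherent⁺ x n 1)))) p∣)
      u : ∀ n → ∃ λ u → approx x (suc n) ℤ.* u ≡ 1ℤ [mod p ℕ.^ suc n ]
      u n = unit (p∤ n) (suc n)
      x*y≈1 : ∀ n → approx x n ℤ.* proj₁ (u n) ≡ 1ℤ [mod p ℕ.^ n ]
      x*y≈1 n = ≈-trans (*-≈ʳ _ (≈-sym (coherent x n))) (≈-weaken (p^n∣p^[1+n] n) (proj₂ (u n)))
      y : ℤₚ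
      y = record
        { approx   = λ n → proj₁ (u n)
        ; coherent = λ n →
            let u₀ = proj₁ (u n) ; u₁ = proj₁ (u (suc n)) ; a = approx x n in
            cancelʳ a {u₀} (x*y≈1 n)
              (≈-trans (≡⇒≈ (ℤ.*-comm u₁ a))
                (≈-trans (*-≈ʳ u₁ (≈-sym (coherent x n)))
                  (≈-trans (≈-weaken (p^n∣p^[1+n] n) (x*y≈1 (suc n)))
                    (≈-trans (≈-sym (x*y≈1 n)) (≡⇒≈ (ℤ.*-comm a u₀)))))) }

  -- Inverse on ℤₚˣ, extended by 0 to the non-units pℤₚ.
  infix 9 _⁻¹
  infixl 7 _/_

  private
    invert : ∀ x → Dec (+ p ∣ approx x 1) → ℤₚ
    invert x (yes _)  = 0#
    invert x (no p∤x) = proj₁ (inverse-exists x p∤x)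

    invert-inverse : ∀ x d → ¬ (+ p ∣ approx x 1) → x * invert x d ≈ 1#
    invert-inverse x (yes p∣x) p∤x = contradiction p∣x p∤x
    invert-inverse x (no p∤x)  _   = proj₂ (inverse-exists x p∤x)

  _⁻¹ : ℤₚ → ℤₚ
  x ⁻¹ = invert x (+ p ℤ∣.∣? approx x 1)

  ⁻¹-inverseʳ : ∀ x → ¬ (+ p ∣ approx x 1) → x * x ⁻¹ ≈ 1#
  ⁻¹-inverseʳ x = invert-inverse x (+ p ℤ∣.∣? approx x 1)

  _/_ : ℤₚ → ℤₚ → ℤₚ
  x / y = x * y ⁻¹

  pochhammer : ℤₚ → ℕ → ℤₚ
  pochhammer a zero    = 1#
  pochhammer a (suc k) = pochhammer a k * (a + ι (+ k))

  module MoritaGamma (p≢2 : p ≢ 2) where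

    p∤? : ∀ k → Dec (¬ (p ℕ∣.∣ k))
    p∤? k = ¬? (p ∣? k)

    -- Since p ∣ 0, the index k = 0 is discarded by the filter; for n = 0 the
    -- formula gives the separately prescribed value 1.
    Γℕ : ℕ → ℤ
    Γℕ n = -1ℤ ℤ.^ n ℤ.* + product (filter p∤? (upTo n))

    -- y = lim Γℕ n as n → x, with |n - x|ₚ ≤ p⁻ᴺ written as n ≡ x (mod pᴺ).
    record IsLimitΓ (x y : ℤₚ) : Set where
      constructor mk
      field
        limit : ∀ k → ∃ λ N → ∀ n → 1 ℕ.≤ n →
                ι (+ n) ≡ x [mod-p^ N ] → ι (Γℕ n) ≡ y [mod-p^ k ]

    open IsLimitΓ public

    -- The limit exists for every x: Γℕ n modulo pᵏ depends only on n modulo pᵏ,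
    -- by the generalised Wilson theorem.

    private

      p∤2 : ¬ (p ℕ∣.∣ 2)
      p∤2 p∣2 with prime⇒irreducible prime[2] p∣2
      ... | inj₁ refl = ℕ.nonTrivial⇒≢1 {{prime⇒nonTrivial p-prime}} refl
      ... | inj₂ p≡2 = p≢2 p≡2

      p∤1 : ¬ (p ℕ∣.∣ 1)
      p∤1 p∣1 = ℕ.nonTrivial⇒≢1 {{prime⇒nonTrivial p-prime}} (ℕ∣.∣1⇒≡1 p∣1)

      [-1]^p : -1ℤ ℤ.^ p ≡ -1ℤ
      [-1]^p with p % 2 | m%n<n p 2 | m≡m%n+[m/n]*n p 2
      ... | 0 | _ | e = contradiction 2∣p 2∤p
        where
        2∣p : 2 ℕ∣.∣ p
        2∣p = ℕ∣.divides (p ℕ./ 2) e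
        2∤p : ¬ (2 ℕ∣.∣ p)
        2∤p d with prime⇒irreducible p-prime d
        ... | inj₂ 2≡p = p≢2 (sym 2≡p)
      ... | 1 | _ | e = trans (cong (-1ℤ ℤ.^_) (trans e (cong suc (ℕ.*-comm (p ℕ./ 2) 2))))
              (trans (cong (λ z → -1ℤ ℤ.* z) (trans (sym (ℤ.^-*-assoc -1ℤ 2 (p ℕ./ 2))) (ℤ.^-zeroˡ (p ℕ./ 2)))) refl)
      ... | suc (suc _) | s≤s (s≤s ()) | _

      [-1]^p^ : ∀ k → -1ℤ ℤ.^ (p ℕ.^ k) ≡ -1ℤ
      [-1]^p^ zero    = refl
      [-1]^p^ (suc k) = trans (sym (ℤ.^-*-assoc -1ℤ p (p ℕ.^ k))) (trans (cong (ℤ._^ (p ℕ.^ k)) [-1]^p) ([-1]^p^ k))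

      factor : ℕ → ℤ
      factor n = + product (filter p∤? (n ∷ []))

      factor-unit : ∀ n k → ∃ λ u → factor n ℤ.* u ≡ 1ℤ [mod p ℕ.^ k ]
      factor-unit n k with p ∣? n
      ... | yes p∣n = 1ℤ , ≈-refl
      ... | no  p∤n = unit {+ product (n ∷ [])} (λ d → p∤n (subst (p ℕ∣.∣_) (ℕ.*-identityʳ n) (∣⇒∣ᵤ d))) k

      factor-cong : ∀ m n k → + m ≡ + n [mod p ℕ.^ suc k ] → factor m ≡ factor n [mod p ℕ.^ suc k ]
      factor-cong m n k e with p ∣? m | p ∣? n
      ... | yes _   | yes _   = ≈-refl
      ... | yes p∣m | no  p∤n = contradiction (∣⇒∣ᵤ (∣-resp (≈-sym (≈-weaken (p∣p^[1+n] k) e)) (∣ᵤ⇒∣ p∣m))) p∤n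
      ... | no  p∤m | yes p∣n = contradiction (∣⇒∣ᵤ (∣-resp (≈-weaken (p∣p^[1+n] k) e) (∣ᵤ⇒∣ p∣n))) p∤m
      ... | no  _   | no  _   = subst₂ (λ a b → + a ≡ + b [mod p ℕ.^ suc k ]) (sym (ℕ.*-identityʳ m)) (sym (ℕ.*-identityʳ n)) e

      units : ℕ → ℤ
      units n = + product (filter p∤? (upTo n))

      units-suc : ∀ n → units (suc n) ≡ units n ℤ.* factor n
      units-suc n = trans
        (cong +_ (trans (cong (product ∘ filter p∤?) (sym (upTo-∷ʳ n)))
                 (trans (cong product (filter-++ p∤? (upTo n) (n ∷ [])))
                        (product-++ (filter p∤? (upTo n)) (filter p∤? (n ∷ []))))))
        (ℤ.pos-* (product (filter p∤? (upTo n))) (product (filter p∤? (n ∷ []))))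

      block : ℕ → ℕ → ℤ
      block n zero    = 1ℤ
      block n (suc m) = block n m ℤ.* factor (n ℕ.+ m)

      units-+ : ∀ n m → units (n ℕ.+ m) ≡ units n ℤ.* block n m
      units-+ n zero    = trans (cong units (ℕ.+-identityʳ n)) (sym (ℤ.*-identityʳ (units n)))
      units-+ n (suc m) = trans (cong units (ℕ.+-suc n m)) (trans (units-suc (n ℕ.+ m))
        (trans (cong (ℤ._* factor (n ℕ.+ m)) (units-+ n m)) (ℤ.*-assoc (units n) (block n m) (factor (n ℕ.+ m)))))

      block-shift : ∀ n m → block n (suc m) ≡ factor n ℤ.* block (suc n) m
      block-shift n zero    = trans (ℤ.*-identityˡ _) (trans (cong factor (ℕ.+-identityʳ n)) (sym (ℤ.*-identityʳ (factor n))))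
      block-shift n (suc m) = trans (cong₂ ℤ._*_ (block-shift n m) (cong factor (ℕ.+-suc n m)))
        (ℤ.*-assoc (factor n) (block (suc n) m) (factor (suc n ℕ.+ m)))

      -- Wilson's theorem modulo M = pᵏ⁺¹: every unit other than ±1 cancels
      -- against its inverse.

      module Wilson (k : ℕ) where

        M : ℕ
        M = p ℕ.^ suc k

        instance
          M-nonZero : NonZero M
          M-nonZero = p^n-nonZero (suc k)

        _\\_ : List ℕ → ℕ → List ℕ
        xs \\ x = filter (λ y → ¬? (y ℕ.≟ x)) xs

        product-\\ : ∀ {x xs} → Unique xs → x ∈ xs → product xs ≡ x ℕ.* product (xs \\ x)
        product-\\ {x} {.x ∷ ys} (x∉ys ∷ _) (here refl) = cong (λ zs → x ℕ.* product zs) (sym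
          (trans (filter-reject (λ y → ¬? (y ℕ.≟ x)) (λ f → f refl))
                 (filter-all (λ y → ¬? (y ℕ.≟ x)) (All.map (λ x≢y y≡x → x≢y (sym y≡x)) x∉ys))))
        product-\\ {x} {y ∷ ys} (y∉ys ∷ uniq) (there x∈ys) =
          trans (cong (y ℕ.*_) (product-\\ uniq x∈ys))
            (trans (swap y x (product (ys \\ x)))
              (cong (λ zs → x ℕ.* product zs) (sym (filter-accept (λ y → ¬? (y ℕ.≟ x)) (All.lookup y∉ys x∈ys)))))
          where
          swap : ∀ a b c → a ℕ.* (b ℕ.* c) ≡ b ℕ.* (a ℕ.* c)
          swap a b c = trans (sym (ℕ.*-assoc a b c)) (trans (cong (ℕ._* c) (ℕ.*-comm a b)) (ℕ.*-assoc b a c))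

        \\-unique : ∀ {xs} x → Unique xs → Unique (xs \\ x)
        \\-unique x = Unique.filter⁺ (λ y → ¬? (y ℕ.≟ x))

        ∈-\\⁺ : ∀ {x y xs} → y ∈ xs → y ≢ x → y ∈ xs \\ x
        ∈-\\⁺ {x} = ∈-filter⁺ (λ y → ¬? (y ℕ.≟ x))

        ∈-\\⁻ : ∀ {x y xs} → y ∈ xs \\ x → y ∈ xs × y ≢ x
        ∈-\\⁻ {x} {xs = xs} = ∈-filter⁻ (λ y → ¬? (y ℕ.≟ x)) {xs = xs}

        Inverses : ℕ → ℕ → Set
        Inverses x y = + x ℤ.* + y ≡ 1ℤ [mod M ]

        inverses-sym : ∀ {x y} → Inverses x y → Inverses y x
        inverses-sym {x} {y} = ≈-trans (≡⇒≈ (ℤ.*-comm (+ y) (+ x)))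

        inverse-unique : ∀ {x y z} → x ℕ.< M → y ℕ.< M → Inverses x z → Inverses y z → x ≡ y
        inverse-unique {x} {y} {z} x<M y<M xz yz =
          residue-unique x<M y<M (cancelʳ (+ z) {+ x} (inverses-sym {x} {z} xz) (≈-trans xz (≈-sym yz)))

        record Paired (xs : List ℕ) : Set where
          field
            bound   : ∀ {x} → x ∈ xs → x ℕ.< M
            partner : ∀ {x} → x ∈ xs → ∃ λ y → y ∈ xs × y ≢ x × Inverses x y

        open Paired

        paired⇒product≡1 : ∀ n xs → length xs ℕ.≤ n → Unique xs → Paired xs → + product xs ≡ 1ℤ [mod M ]
        paired⇒product≡1 n       []       _ _ _ = ≈-refl
        paired⇒product≡1 (suc n) (x ∷ xs) (s≤s l) (x∉xs ∷ uniq) P with partner P (here refl)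
        ... | y , here y≡x   , y≢x , _  = contradiction y≡x y≢x
        ... | y , there y∈xs , y≢x , xy =
          ≈-trans (≡⇒≈ (trans (cong (λ z → + (x ℕ.* z)) (product-\\ uniq y∈xs))
                    (trans (cong +_ (sym (ℕ.*-assoc x y rest)))
                      (trans (ℤ.pos-* (x ℕ.* y) rest) (cong (ℤ._* + rest) (ℤ.pos-* x y))))))
            (≈-trans (*-≈ʳ (+ rest) xy)
              (≈-trans (≡⇒≈ (ℤ.*-identityˡ (+ rest)))
                (paired⇒product≡1 n (xs \\ y) (ℕ.≤-trans (length-filter (λ z → ¬? (z ℕ.≟ y)) xs) l) (\\-unique y uniq)
                  record { bound = λ z∈ → bound P (there (proj₁ (∈-\\⁻ {xs = xs} z∈))) ; partner = partner′ })))
          where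
          rest : ℕ
          rest = product (xs \\ y)
          x<M : x ℕ.< M
          x<M = bound P (here refl)
          y<M : y ℕ.< M
          y<M = bound P (there y∈xs)
          partner′ : ∀ {z} → z ∈ xs \\ y → ∃ λ w → w ∈ xs \\ y × w ≢ z × Inverses z w
          partner′ {z} z∈ with ∈-\\⁻ {xs = xs} z∈
          ... | z∈xs , z≢y with partner P (there z∈xs)
          ... | w , here refl   , w≢z , zw =
            contradiction (inverse-unique {z = x} (bound P (there z∈xs)) y<M zw (inverses-sym {x} {y} xy)) z≢y
          ... | w , there w∈xs , w≢z , zw = w , ∈-\\⁺ w∈xs w≢y , w≢z , zw
            where
            w≢y : w ≢ y
            w≢y refl = All.lookup x∉xs z∈xs (inverse-unique {z = y} x<M (bound P (there z∈xs)) xy zw)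

        U V : List ℕ
        U = filter p∤? (upTo M)

        M-1 : ℕ
        M-1 = ℕ.pred M

        M≡ : M ≡ suc M-1
        M≡ = sym (ℕ.suc-pred M)

        -1≈M-1 : -1ℤ ≡ + M-1 [mod M ]
        -1≈M-1 = mk (divides -1ℤ (trans (sym (ℤ.neg-distrib-+ 1ℤ (+ M-1))) (trans (cong (λ m → ℤ.- + m) (sym M≡)) (sym (ℤ.-1*i≡-i (+ M))))))

        V = (U \\ 1) \\ M-1

        p∣M : p ℕ∣.∣ M
        p∣M = p∣p^[1+n] k

        p≤M : p ℕ.≤ M
        p≤M = ℕ∣.∣⇒≤ p∣M

        1<p : 1 ℕ.< p
        1<p = ℕ.nonTrivial⇒n>1 p {{prime⇒nonTrivial p-prime}}

        1<M : 1 ℕ.< M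
        1<M = ℕ.≤-trans 1<p p≤M

        M-1<M : M-1 ℕ.< M
        M-1<M = ℕ.≤-reflexive (sym M≡)

        p∤M-1 : ¬ (p ℕ∣.∣ M-1)
        p∤M-1 d = p∤1 (∣⇒∣ᵤ (∣-resp (≈-weaken p∣M (-1≈M-1)) (∣ᵤ⇒∣ {i = + M-1} d)))

        1≢M-1 : M-1 ≢ 1
        1≢M-1 e = p∤2 (subst (p ℕ∣.∣_) (trans M≡ (cong suc e)) p∣M)

        ∈U⁺ : ∀ {x} → x ℕ.< M → ¬ (p ℕ∣.∣ x) → x ∈ U
        ∈U⁺ x<M p∤x = ∈-filter⁺ p∤? (∈-upTo⁺ x<M) p∤x

        ∈U⁻ : ∀ {x} → x ∈ U → x ℕ.< M × ¬ (p ℕ∣.∣ x)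
        ∈U⁻ x∈U with ∈-filter⁻ p∤? {xs = upTo M} x∈U
        ... | x∈ , p∤x = ∈-upTo⁻ x∈ , p∤x

        U-unique : Unique U
        U-unique = Unique.filter⁺ p∤? (Unique.upTo⁺ M)

        square-roots : ∀ {x} → Inverses x x → (+ x ≡ 1ℤ [mod M ]) ⊎ (+ x ≡ -1ℤ [mod M ])
        square-roots {x} e with + p ℤ∣.∣? (+ x ℤ.- 1ℤ)
        ... | no p∤ = inj₂ (≈-trans (≡⇒≈ (lem (+ x))) (+-≈ x+1≈0 (≈-refl {a = -1ℤ})))
          where
          lem : ∀ x → x ≡ (x ℤ.+ 1ℤ) ℤ.+ ℤ.- 1ℤ
          lem = solve-∀
          fac : ∀ x → (x ℤ.+ 1ℤ) ℤ.* (x ℤ.+ ℤ.- 1ℤ) ≡ x ℤ.* x ℤ.+ ℤ.- 1ℤ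
          fac = solve-∀
          x+1≈0 : + x ℤ.+ 1ℤ ≡ 0ℤ [mod M ]
          x+1≈0 = cancelʳ (+ x ℤ.- 1ℤ) {proj₁ (unit p∤ (suc k))} (proj₂ (unit p∤ (suc k)))
                    (≈-trans (≡⇒≈ (fac (+ x))) (∣⇒≈0 (divisible e)))
        ... | yes p∣x-1 = inj₁ (≈-trans (≡⇒≈ (lem (+ x))) (+-≈ x-1≈0 (≈-refl {a = 1ℤ})))
          where
          lem : ∀ x → x ≡ (x ℤ.+ ℤ.- 1ℤ) ℤ.+ 1ℤ
          lem = solve-∀
          fac : ∀ x → (x ℤ.+ ℤ.- 1ℤ) ℤ.* (x ℤ.+ 1ℤ) ≡ x ℤ.* x ℤ.+ ℤ.- 1ℤ
          fac = solve-∀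
          two : ∀ x → (x ℤ.+ 1ℤ) ℤ.+ ℤ.- (x ℤ.+ ℤ.- 1ℤ) ≡ + 2
          two = solve-∀
          p∤ : ¬ (+ p ∣ + x ℤ.+ 1ℤ)
          p∤ d = p∤2 (∣⇒∣ᵤ (subst (+ p ∣_) (two (+ x)) (ℤ∣.∣m∣n⇒∣m-n d p∣x-1)))
          x-1≈0 : + x ℤ.- 1ℤ ≡ 0ℤ [mod M ]
          x-1≈0 = cancelʳ (+ x ℤ.+ 1ℤ) {proj₁ (unit p∤ (suc k))} (proj₂ (unit p∤ (suc k)))
                    (≈-trans (≡⇒≈ (fac (+ x))) (∣⇒≈0 (divisible e)))

        V-paired : Paired V
        V-paired = record
          { bound   = λ x∈V → proj₁ (∈U⁻ (V⊆U x∈V))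
          ; partner = partner-V }
          where
          V⊆U : ∀ {x} → x ∈ V → x ∈ U
          V⊆U x∈V = proj₁ (∈-\\⁻ {xs = U} (proj₁ (∈-\\⁻ {xs = U \\ 1} x∈V)))
          partner-V : ∀ {x} → x ∈ V → ∃ λ y → y ∈ V × y ≢ x × Inverses x y
          partner-V {x} x∈V with ∈-\\⁻ {xs = U \\ 1} x∈V
          ... | x∈U\1 , x≢M-1 with ∈-\\⁻ {xs = U} x∈U\1
          ... | x∈U , x≢1 with ∈U⁻ x∈U
          ... | x<M , p∤x = y , ∈-\\⁺ (∈-\\⁺ (∈U⁺ y<M p∤y) y≢1) y≢M-1 , y≢x , xy
            where
            u : ∃ λ u → + x ℤ.* u ≡ 1ℤ [mod M ]
            u = unit {+ x} (p∤x ∘ ∣⇒∣ᵤ) (suc k)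
            y : ℕ
            y = proj₁ u %ℕ M
            y<M : y ℕ.< M
            y<M = n%ℕd<d (proj₁ u) M
            xy : Inverses x y
            xy = ≈-trans (*-≈ˡ (+ x) (%ℕ-≈ (proj₁ u))) (proj₂ u)
            p∤y : ¬ (p ℕ∣.∣ y)
            p∤y d = p∤1 (∣⇒∣ᵤ (∣-resp (≈-sym (≈-weaken p∣M xy)) (ℤ∣.∣n⇒∣m*n (+ x) (∣ᵤ⇒∣ {i = + y} d))))
            y≢1 : y ≢ 1
            y≢1 e = x≢1 (residue-unique x<M 1<M
              (≈-trans (≡⇒≈ (trans (sym (ℤ.*-identityʳ (+ x))) (cong (λ z → + x ℤ.* + z) (sym e)))) xy))
            y≢M-1 : y ≢ M-1
            y≢M-1 e = x≢M-1 (residue-unique x<M M-1<M (≈-trans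
              (≈-trans (≡⇒≈ (lem (+ x)))
                (-‿≈ (≈-trans (*-≈ˡ (+ x) -1≈M-1) (≈-trans (≡⇒≈ (cong (λ z → + x ℤ.* + z) (sym e))) xy))))
              -1≈M-1))
              where
              lem : ∀ x → x ≡ ℤ.- (x ℤ.* ℤ.- 1ℤ)
              lem = solve-∀
            y≢x : y ≢ x
            y≢x e = [ (λ x≈1 → x≢1 (residue-unique x<M 1<M x≈1))
                    , (λ x≈-1 → x≢M-1 (residue-unique x<M M-1<M (≈-trans x≈-1 -1≈M-1)))
                    ]′ (square-roots {x} (subst (Inverses x) e xy))

        wilson : units M ≡ -1ℤ [mod M ]
        wilson = ≈-trans (≡⇒≈ (trans (cong +_ split) (ℤ.pos-* M-1 (product V))))
          (≈-trans (*-≈ (≈-sym -1≈M-1) (paired⇒product≡1 (length V) V ℕ.≤-refl (\\-unique M-1 (\\-unique 1 U-unique)) V-paired))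
            (≡⇒≈ refl))
          where
          split : product U ≡ M-1 ℕ.* product V
          split = trans (product-\\ U-unique (∈U⁺ 1<M p∤1)) (trans (ℕ.*-identityˡ _)
            (product-\\ (\\-unique 1 U-unique) (∈-\\⁺ (∈U⁺ M-1<M p∤M-1) 1≢M-1)))

        block≈-1 : ∀ n → block n M ≡ -1ℤ [mod M ]
        block≈-1 zero    = ≈-trans (≡⇒≈ (trans (sym (ℤ.*-identityˡ (block 0 M))) (sym (units-+ 0 M)))) wilson
        block≈-1 (suc n) = cancelʳ (factor n) {proj₁ (factor-unit n (suc k))} (proj₂ (factor-unit n (suc k)))
          (≈-trans (≡⇒≈ (trans (ℤ.*-comm (block (suc n) M) (factor n)) (sym (block-shift n M))))
            (*-≈ (block≈-1 n) (factor-cong (n ℕ.+ M) n k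
              (mk (divides 1ℤ (trans (cong (ℤ._- + n) (ℤ.pos-+ n M)) (lem (+ n) (+ M))))))))
          where
          lem : ∀ a b → (a ℤ.+ b) ℤ.+ ℤ.- a ≡ 1ℤ ℤ.* b
          lem = solve-∀

        Γℕ-period : ∀ n → Γℕ (n ℕ.+ M) ≡ Γℕ n [mod M ]
        Γℕ-period n = ≈-trans
          (≡⇒≈ (trans (cong₂ ℤ._*_ (trans (ℤ.^-distribˡ-+-* -1ℤ n M) (cong (λ z → -1ℤ ℤ.^ n ℤ.* z) ([-1]^p^ (suc k)))) (units-+ n M))
                 (lem (-1ℤ ℤ.^ n) (units n) (block n M))))
          (≈-trans (*-≈ˡ (Γℕ n) (-‿≈ (block≈-1 n))) (≡⇒≈ (ℤ.*-identityʳ (Γℕ n))))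
          where
          lem : ∀ a b c → (a ℤ.* ℤ.- 1ℤ) ℤ.* (b ℤ.* c) ≡ (a ℤ.* b) ℤ.* ℤ.- c
          lem = solve-∀

      Γℕ-period : ∀ k n → Γℕ (n ℕ.+ p ℕ.^ k) ≡ Γℕ n [mod p ℕ.^ k ]
      Γℕ-period zero    n = mod-1
      Γℕ-period (suc k) n = Wilson.Γℕ-period k n

      Γℕ-periods : ∀ k n q → Γℕ (n ℕ.+ q ℕ.* p ℕ.^ k) ≡ Γℕ n [mod p ℕ.^ k ]
      Γℕ-periods k n zero    = ≡⇒≈ (cong Γℕ (ℕ.+-identityʳ n))
      Γℕ-periods k n (suc q) = ≈-trans
        (≡⇒≈ (cong Γℕ (trans (cong (n ℕ.+_) (ℕ.+-comm (p ℕ.^ k) (q ℕ.* p ℕ.^ k))) (sym (ℕ.+-assoc n (q ℕ.* p ℕ.^ k) (p ℕ.^ k))))))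
        (≈-trans (Γℕ-period k (n ℕ.+ q ℕ.* p ℕ.^ k)) (Γℕ-periods k n q))

    abstract

      Γℕ-cong : ∀ k m n → + m ≡ + n [mod p ℕ.^ k ] → Γℕ m ≡ Γℕ n [mod p ℕ.^ k ]
      Γℕ-cong k m n e = ≈-trans (reduce m) (≈-trans (≡⇒≈ (cong Γℕ residues)) (≈-sym (reduce n)))
        where
        M : ℕ
        M = p ℕ.^ k
        M-nonZero : NonZero M
        M-nonZero = p^n-nonZero k
        reduce : ∀ m → Γℕ m ≡ Γℕ (residue k (+ m)) [mod M ]
        reduce m = ≈-trans (≡⇒≈ (cong Γℕ (m≡m%n+[m/n]*n m M {{M-nonZero}})))
          (Γℕ-periods k (residue k (+ m)) (ℕ._/_ m M {{M-nonZero}}))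
        residues : residue k (+ m) ≡ residue k (+ n)
        residues = residue-unique (residue< k (+ m)) (residue< k (+ n))
          (≈-trans (residue≈ k (+ m)) (≈-trans e (≈-sym (residue≈ k (+ n)))))

    limit-exists : ∀ x → ∃ λ y → IsLimitΓ x y
    limit-exists x = y , mk (λ k → k , λ n _ n≈x → approx⇒mod-p^ {ι (Γℕ n)} {y} k
        (Γℕ-cong k n (res k) (≈-trans (mod-p^⇒approx {ι (+ n)} {x} k n≈x) (≈-sym (residue≈ k (approx x k))))))
      where
      res : ℕ → ℕ
      res k = residue k (approx x k)
      y : ℤₚ
      y = record
        { approx   = λ k → Γℕ (res k)
        ; coherent = λ k → Γℕ-cong k (res (suc k)) (res k)
            (≈-trans (≈-weaken (p^n∣p^[1+n] k) (residue≈ (suc k) (approx x (suc k))))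
              (≈-trans (coherent x k) (≈-sym (residue≈ k (approx x k))))) }

    Γₚ : ℤₚ → ℤₚ
    Γₚ x = proj₁ (limit-exists x)

    Γₚ-limit : ∀ x → IsLimitΓ x (Γₚ x)
    Γₚ-limit x = proj₂ (limit-exists x)

    Γₚ-ℕ : ∀ n → Γₚ (ι (+ n)) ≈ ι (Γℕ n)
    Γₚ-ℕ n = mk λ k → Γℕ-cong k (residue k (+ n)) n (residue≈ k (+ n))

{-# OPTIONS --safe #-}

-- Put s = p/3 and n = s - r/3. Modulo p⁵ the terms with k > n vanish, and in the others four of the six factors
-- (r/3)_k / (1)_k may be deformed to (r/3 + t)_k / (1 - t)_k with t⁴ = s⁴: the error is p⁴ times a sum whose terms are
-- antisymmetric in k ↔ n - k modulo p. The deformed sum is a terminating very-well-poised ₇F₆. Whipple's transformation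
-- makes it p times a product times a balanced ₄F₃, and Sears' transformation makes r - 1 one of the parameters of the
-- latter, which cuts it down to 2 - r terms; reversing their order changes the sign of s², hence s² may be replaced
-- by 0 modulo p⁴. The remaining product is evaluated with the functional equation and the reflection formula of Γₚ
-- and with Γₚ(z)⁶ Γₚ(z - 2s) Γₚ(z + 2s) ≡ (Γₚ(z - s) Γₚ(z + s))⁴ (mod p⁴), which propagates from z = 0
-- because z⁶ (z² - 4s²) ≡ (z² - s²)⁴ (mod s⁴).

module Submission where

open import Defs
open import Data.Fin.Base as Fin using (Fin; toℕ)
open import Data.Integer.Base as ℤ using (ℤ; +_; 0ℤ; 1ℤ; -1ℤ; ∣_∣)
open import Data.Integer.Coprimality using (Coprime)
open import Data.Integer.Divisibility.Signed as ℤ∣ using (_∣_; divides; ∣ᵤ⇒∣; ∣⇒∣ᵤ)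
import Data.Integer.Properties as ℤ
open import Algebra.Properties.AbelianGroup ℤ.+-0-abelianGroup using (∙-cancelʳ)
open import Data.Integer.Tactic.RingSolver using (solve-∀)
open import Data.List.Base using ([]; _∷_; filter; upTo)
open import Data.List.Properties using (filter-accept; filter-reject; filter-++; upTo-∷ʳ)
open import Data.Nat.Base as ℕ using (ℕ; zero; suc)
open import Data.Nat.Divisibility as ℕ∣ using (>⇒∤)
open import Data.Nat.ListAction using (product)
open import Data.Nat.ListAction.Properties using (product-++)
open import Data.Nat.Primality using (Prime; prime⇒nonTrivial; prime⇒irreducible)
import Data.Nat.Properties as ℕ
import Data.Nat.Tactic.RingSolver as ℕ-Solver
open import Data.Product.Base using (∃; _,_; proj₁; proj₂)
open import Data.Sum.Base using (_⊎_; inj₁; inj₂)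
open import Function.Base using (_∘_)
open import Relation.Binary.Bundles using (Setoid)
open import Relation.Binary.PropositionalEquality using (_≡_; _≢_; refl; sym; trans; cong; cong₂; subst; module ≡-Reasoning)
import Relation.Binary.Reasoning.Setoid as SetoidReasoning
open import Relation.Nullary.Decidable.Core using (Dec; yes; no)
open import Relation.Nullary.Negation.Core using (¬_; contradiction)

open Congruence

-- Deforming by all four roots of `t⁴ = s⁴` serves three ends. The product of `x + t` over these
-- roots is `x⁴ - s⁴`, an integer that differs from `x⁴` by a multiple of `p⁴`. The root `t = - s`
-- turns `r/3 + t` into `- n`, which makes the sum terminate. The two non-real roots occur only
-- together, through `x² + s²`. The summation formulas are therefore stated over the integers, with
-- denominators cleared and with a quadratic in place of a pair of conjugate parameters. The factor
-- `p` from Whipple's transformation lowers the modulus of what remains to `p⁴`, where `s⁴`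
-- vanishes. There a product of values `x² + s²`, which is not a quotient of Gamma values at
-- integers, can be traded for a fourth power of a rising factorial and two shifted ones. The Gamma
-- identity has exponents 1, -4, 6, -4, 1 at `z - 2s`, `z - s`, `z`, `z + s`, `z + 2s`: it says that
-- a multiplicative fourth central difference with step `s` is trivial modulo `p⁴`.

module Hypergeometric where
  open import Data.Integer.Base using (_+_; _*_; -_)

  -- Signs, rising products and their reflection

  σ : ℕ → ℤ
  σ zero    = 1ℤ
  σ (suc k) = - σ k

  Π : (ℤ → ℤ) → ℤ → ℕ → ℤ
  Π φ x zero    = 1ℤ
  Π φ x (suc k) = Π φ x k * φ (x + + k)

  P : ℤ → ℕ → ℤ
  P = Π (λ z → z)

  Π-front : ∀ φ x k → Π φ x (suc k) ≡ φ x * Π φ (x + 1ℤ) k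
  Π-front φ x zero    = trans (ℤ.*-comm 1ℤ _) (cong (λ y → φ y * 1ℤ) (ℤ.+-identityʳ x))
  Π-front φ x (suc k) = trans (cong₂ _*_ (Π-front φ x k) (cong φ (sym (ℤ.+-assoc x 1ℤ (+ k)))))
    (ℤ.*-assoc (φ x) _ _)

  Π-ext : ∀ {φ ψ x y} k → (∀ t → φ (x + + t) ≡ ψ (y + + t)) → Π φ x k ≡ Π ψ y k
  Π-ext zero    e = refl
  Π-ext (suc k) e = cong₂ _*_ (Π-ext k e) (e k)

  Π-+ : ∀ φ x j k → Π φ x (j ℕ.+ k) ≡ Π φ x j * Π φ (x + + j) k
  Π-+ φ x zero    k = sym (trans (ℤ.*-identityˡ _) (cong (λ y → Π φ y k) (ℤ.+-identityʳ x)))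
  Π-+ φ x (suc j) k = begin
    Π φ x (suc (j ℕ.+ k))                               ≡⟨ Π-front φ x (j ℕ.+ k) ⟩
    φ x * Π φ (x + 1ℤ) (j ℕ.+ k)                        ≡⟨ cong (φ x *_) (Π-+ φ (x + 1ℤ) j k) ⟩
    φ x * (Π φ (x + 1ℤ) j * Π φ (x + 1ℤ + + j) k)       ≡⟨ ℤ.*-assoc (φ x) _ _ ⟨
    φ x * Π φ (x + 1ℤ) j * Π φ (x + 1ℤ + + j) k         ≡⟨ cong₂ (λ y z → y * Π φ z k) (sym (Π-front φ x j)) (ℤ.+-assoc x 1ℤ (+ j)) ⟩
    Π φ x (suc j) * Π φ (x + + suc j) k                 ∎
    where open ≡-Reasoning

  Π-reverse : ∀ {φ ψ x y} k → (∀ t u → suc (t ℕ.+ u) ≡ k → φ (x + + t) ≡ ψ (y + + u)) → Π φ x k ≡ Π ψ y k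
  Π-reverse zero    e = refl
  Π-reverse {φ} {ψ} {x} {y} (suc k) e = trans (Π-front φ x k) (trans
    (cong₂ _*_ (trans (cong φ (sym (ℤ.+-identityʳ x))) (e 0 k refl))
               (Π-reverse k λ t u tu → trans (cong φ (ℤ.+-assoc x 1ℤ (+ t))) (e (suc t) u (cong suc tu))))
    (ℤ.*-comm (ψ (y + + k)) _))

  Π-* : ∀ φ ψ x k → Π (λ z → φ z * ψ z) x k ≡ Π φ x k * Π ψ x k
  Π-* φ ψ x zero    = refl
  Π-* φ ψ x (suc k) = trans (cong (_* (φ (x + + k) * ψ (x + + k))) (Π-* φ ψ x k))
    (swap (Π φ x k) (Π ψ x k) (φ (x + + k)) (ψ (x + + k)))
    where
    swap : ∀ a b c d → a * b * (c * d) ≡ a * c * (b * d)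
    swap = solve-∀

  Π-neg : ∀ φ x k → Π (λ z → - φ z) x k ≡ σ k * Π φ x k
  Π-neg φ x zero    = refl
  Π-neg φ x (suc k) = trans (cong (_* - φ (x + + k)) (Π-neg φ x k)) (swap (σ k) (Π φ x k) (φ (x + + k)))
    where
    swap : ∀ a b c → a * b * - c ≡ - a * (b * c)
    swap = solve-∀

  σ² : ∀ k → σ k * σ k ≡ 1ℤ
  σ² zero    = refl
  σ² (suc k) = trans (neg (σ k)) (σ² k)
    where
    neg : ∀ x → - x * - x ≡ x * x
    neg = solve-∀

  σ-+ : ∀ j k → σ (j ℕ.+ k) ≡ σ j * σ k
  σ-+ zero    k = sym (ℤ.*-identityˡ (σ k))
  σ-+ (suc j) k = trans (cong -_ (σ-+ j k)) (ℤ.neg-distribˡ-* (σ j) (σ k))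

  P-reflect : ∀ x y k → x + y + + k ≡ 1ℤ → P x k ≡ σ k * P y k
  P-reflect x y k e = trans (Π-reverse k λ { t u refl → begin
      x + + t                                                    ≡⟨ eq x y (+ t) (+ u) ⟩
      x + y + (1ℤ + (+ t + + u)) + - 1ℤ + - (y + + u)            ≡⟨ cong (λ z → z + - 1ℤ + - (y + + u)) e ⟩
      1ℤ + - 1ℤ + - (y + + u)                                    ≡⟨ ℤ.+-identityˡ _ ⟩
      - (y + + u)                                                ∎ })
    (Π-neg (λ z → z) y k)
    where
    open ≡-Reasoning
    eq : ∀ x y t u → x + t ≡ x + y + (1ℤ + (t + u)) + - 1ℤ + - (y + u)
    eq = solve-∀

  -- Binomial sums

  -- B f n = Σ_{j+i=n} (n choose j) f j i.
  B : (ℕ → ℕ → ℤ) → ℕ → ℤ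
  B f zero    = f 0 0
  B f (suc n) = B (λ j i → f j (suc i)) n + B (λ j i → f (suc j) i) n

  B-cong : ∀ n {f g} → (∀ j i → j ℕ.+ i ≡ n → f j i ≡ g j i) → B f n ≡ B g n
  B-cong zero    e = e 0 0 refl
  B-cong (suc n) e = cong₂ _+_ (B-cong n λ j i ji → e j (suc i) (trans (ℕ.+-suc j i) (cong suc ji)))
                               (B-cong n λ j i ji → e (suc j) i (cong suc ji))

  B-+ : ∀ n f g → B (λ j i → f j i + g j i) n ≡ B f n + B g n
  B-+ zero    f g = refl
  B-+ (suc n) f g = trans
    (cong₂ _+_ (B-+ n (λ j i → f j (suc i)) (λ j i → g j (suc i))) (B-+ n (λ j i → f (suc j) i) (λ j i → g (suc j) i)))
    (swap (B (λ j i → f j (suc i)) n) (B (λ j i → g j (suc i)) n) (B (λ j i → f (suc j) i) n) (B (λ j i → g (suc j) i) n))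
    where
    swap : ∀ a b c d → (a + b) + (c + d) ≡ (a + c) + (b + d)
    swap = solve-∀

  B-* : ∀ n c f → B (λ j i → c * f j i) n ≡ c * B f n
  B-* zero    c f = refl
  B-* (suc n) c f = trans
    (cong₂ _+_ (B-* n c (λ j i → f j (suc i))) (B-* n c (λ j i → f (suc j) i)))
    (sym (ℤ.*-distribˡ-+ c (B (λ j i → f j (suc i)) n) (B (λ j i → f (suc j) i) n)))

  -- This is `(l + 1) C(n, l + 1) = (n - l) C(n, l)` in summed form. The value `ℕ.pred 0` does no
  -- harm, since its coefficient `+ l` is zero.
  B-telescope : ∀ n (h : ℕ → ℕ → ℤ) → B (λ l i → + l * h (ℕ.pred l) (suc i)) n ≡ B (λ l i → + i * h l i) n
  B-telescope zero    h = refl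
  B-telescope (suc n) h = begin
    B (λ l i → + l * h (ℕ.pred l) (suc (suc i))) n + B (λ l i → + suc l * h l (suc i)) n
      ≡⟨ cong (λ z → z + B (λ l i → + suc l * h l (suc i)) n) (B-telescope n (λ l i → h l (suc i))) ⟩
    B (λ l i → + i * h l (suc i)) n + B (λ l i → + suc l * h l (suc i)) n
      ≡⟨ B-+ n (λ l i → + i * h l (suc i)) (λ l i → + suc l * h l (suc i)) ⟨
    B (λ l i → + i * h l (suc i) + + suc l * h l (suc i)) n
      ≡⟨ B-cong n (λ l i _ → eq (+ i) (+ l) (h l (suc i))) ⟩
    B (λ l i → + suc i * h l (suc i) + + l * h l (suc i)) n
      ≡⟨ B-+ n (λ l i → + suc i * h l (suc i)) (λ l i → + l * h l (suc i)) ⟩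
    B (λ l i → + suc i * h l (suc i)) n + B (λ l i → + l * h l (suc i)) n
      ≡⟨ cong (λ z → B (λ l i → + suc i * h l (suc i)) n + z)
           (trans (B-cong n {λ l i → + l * h l (suc i)} {λ l i → + l * h (suc (ℕ.pred l)) (suc i)} shift)
                  (B-telescope n (λ l i → h (suc l) i))) ⟩
    B (λ l i → + suc i * h l (suc i)) n + B (λ l i → + i * h (suc l) i) n ∎
    where
    open ≡-Reasoning
    eq : ∀ i l x → i * x + (1ℤ + l) * x ≡ (1ℤ + i) * x + l * x
    eq = solve-∀
    shift : ∀ l i → l ℕ.+ i ≡ n → + l * h l (suc i) ≡ + l * h (suc (ℕ.pred l)) (suc i)
    shift zero    i _ = refl
    shift (suc l) i _ = refl

  -- Both sides weight `f j l i` by the trinomial coefficient `n! / (j! l! i!)`. This is the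
  -- interchange of summations in the transformations of Sears and Whipple.
  B-assoc : ∀ n (f : ℕ → ℕ → ℕ → ℤ) →
    B (λ k i → B (λ j l → f j l i) k) n ≡ B (λ j r → B (λ l i → f j l i) r) n
  B-assoc zero    f = refl
  B-assoc (suc n) f = begin
    L f₁ + B (λ k i → B (λ j l → f j (suc l) i) k + B (λ j l → f (suc j) l i) k) n
      ≡⟨ cong (λ z → L f₁ + z) (B-+ n (λ k i → B (λ j l → f₂ j l i) k) (λ k i → B (λ j l → f₃ j l i) k)) ⟩
    L f₁ + (L f₂ + L f₃)
      ≡⟨ cong₂ _+_ (B-assoc n f₁) (cong₂ _+_ (B-assoc n f₂) (B-assoc n f₃)) ⟩
    R f₁ + (R f₂ + R f₃)
      ≡⟨ ℤ.+-assoc (R f₁) (R f₂) (R f₃) ⟨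
    R f₁ + R f₂ + R f₃
      ≡⟨ cong (λ z → z + R f₃) (B-+ n (λ j r → B (f₁ j) r) (λ j r → B (f₂ j) r)) ⟨
    B (λ j r → B (λ l i → f j l (suc i)) r + B (λ l i → f j (suc l) i) r) n + R f₃ ∎
    where
    open ≡-Reasoning
    L R : (ℕ → ℕ → ℕ → ℤ) → ℤ
    L g = B (λ k i → B (λ j l → g j l i) k) n
    R g = B (λ j r → B (λ l i → g j l i) r) n
    f₁ f₂ f₃ : ℕ → ℕ → ℕ → ℤ
    f₁ j l i = f j l (suc i)
    f₂ j l i = f j (suc l) i
    f₃ j l i = f (suc j) l i

  -- The two terms in `h` have equal sums by `B-telescope`, so `h` acts as a certificate in the
  -- style of Wilf and Zeilberger: a summation identity is reduced to a polynomial identity between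
  -- summands.
  B-telescoped : ∀ n {f} (g h : ℕ → ℕ → ℤ) →
    (∀ l i → l ℕ.+ i ≡ n → f l i + + i * h l i ≡ g l i + + l * h (ℕ.pred l) (suc i)) → B f n ≡ B g n
  B-telescoped n {f} g h e = ∙-cancelʳ (B h₁ n) (B f n) (B g n) (begin
    B f n + B h₁ n                    ≡⟨ B-+ n f h₁ ⟨
    B (λ l i → f l i + h₁ l i) n      ≡⟨ B-cong n e ⟩
    B (λ l i → g l i + h₂ l i) n      ≡⟨ B-+ n g h₂ ⟩
    B g n + B h₂ n                    ≡⟨ cong (λ z → B g n + z) (B-telescope n h) ⟩
    B g n + B h₁ n                    ∎)
    where
    open ≡-Reasoning
    h₁ h₂ : ℕ → ℕ → ℤ
    h₁ l i = + i * h l i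
    h₂ l i = + l * h (ℕ.pred l) (suc i)

  -- Summation formulas: Saalschütz and the very-well-poised sum

  -- The Pfaff–Saalschütz sum, with the pair of denominator parameters encoded by the quadratic q.
  saalschütz : ∀ N q a b c → (∀ x → q x ≡ x * x + (1ℤ + a + b + - + N) * x + c) →
    B (λ l i → σ l * P a l * P b l * Π q (+ l) i) N ≡ Π q (- a) N
  saalschütz zero    q a b c e = refl
  saalschütz (suc N) q a b c e = begin
    B (λ l i → f l (suc i)) N + B (λ l i → f (suc l) i) N
      ≡⟨ B-+ N (λ l i → f l (suc i)) (λ l i → f (suc l) i) ⟨
    B (λ l i → f l (suc i) + f (suc l) i) N
      ≡⟨ B-telescoped N (λ l i → q (- a) * g l i) h pointwise ⟩
    B (λ l i → q (- a) * g l i) N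
      ≡⟨ B-* N (q (- a)) g ⟩
    q (- a) * B g N
      ≡⟨ cong (λ z → q (- a) * z) (trans IH (Π-ext N λ t → cong q (swap (- a) (+ t)))) ⟩
    q (- a) * Π q (- a + 1ℤ) N
      ≡⟨ Π-front q (- a) N ⟨
    Π q (- a) (suc N) ∎
    where
    open ≡-Reasoning
    q⁺ : ℤ → ℤ
    q⁺ x = q (x + 1ℤ)
    f g h : ℕ → ℕ → ℤ
    f l i = σ l * P a l * P b l * Π q (+ l) i
    g l i = σ l * P a l * P (b + 1ℤ) l * Π q⁺ (+ l) i
    h l i = σ l * P a (suc l) * P (b + 1ℤ) l * Π q (+ suc l) i
    swap : ∀ x y → x + y + 1ℤ ≡ x + 1ℤ + y
    swap = solve-∀
    -- The shift of `q` by one raises its linear coefficient by 2. Replacing `b` by `b + 1` and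
    -- `suc N` by `N` raises the prescribed coefficient by 2 as well, so the balancing condition
    -- survives the induction.
    e⁺ : ∀ x → q⁺ x ≡ x * x + (1ℤ + a + (b + 1ℤ) + - + N) * x + (1ℤ + (a + b + - + N) + c)
    e⁺ x = trans (e (x + 1ℤ)) (eq x a b (+ N) c)
      where
      eq : ∀ x a b n c → (x + 1ℤ) * (x + 1ℤ) + (1ℤ + a + b + - (1ℤ + n)) * (x + 1ℤ) + c
        ≡ x * x + (1ℤ + a + (b + 1ℤ) + - n) * x + (1ℤ + (a + b + - n) + c)
      eq = solve-∀
    IH : B g N ≡ Π q⁺ (- a) N
    IH = saalschütz N q⁺ a (b + 1ℤ) _ e⁺
    Πq⁺ : ∀ l i → Π q⁺ (+ l) i ≡ Π q (+ suc l) i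
    Πq⁺ l i = Π-ext i λ t → cong q (trans (ℤ.+-comm (+ l + + t) 1ℤ) (sym (ℤ.+-assoc 1ℤ (+ l) (+ t))))
    Πq : ∀ l i → Π q (+ l) (suc i) ≡ (+ l * + l + (1ℤ + a + b + - (1ℤ + + N)) * + l + c) * Π q (+ suc l) i
    Πq l i = trans (Π-front q (+ l) i) (cong₂ (λ y z → y * Π q z i) (e (+ l)) (ℤ.+-comm (+ l) 1ℤ))
    pointwise : ∀ l i → l ℕ.+ i ≡ N →
      f l (suc i) + f (suc l) i + + i * h l i ≡ q (- a) * g l i + + l * h (ℕ.pred l) (suc i)
    pointwise zero i refl = begin
      1ℤ * 1ℤ * 1ℤ * Π q (+ 0) (suc i) + f 1 i + + i * h 0 i
        ≡⟨ cong (λ z → 1ℤ * 1ℤ * 1ℤ * z + f 1 i + + i * h 0 i) (Πq 0 i) ⟩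
      _ ≡⟨ eq (Π q (+ 1) i) (+ i) a b c ⟩
      (- a * - a + (1ℤ + a + b + - (1ℤ + + i)) * - a + c) * (1ℤ * 1ℤ * 1ℤ * Π q (+ 1) i) + 0ℤ
        ≡⟨ cong₂ (λ x y → x * (1ℤ * 1ℤ * 1ℤ * y) + 0ℤ) (e (- a)) (Πq⁺ 0 i) ⟨
      q (- a) * g 0 i + 0ℤ ∎
      where
      eq : ∀ z i a b c →
        1ℤ * 1ℤ * 1ℤ * ((0ℤ * 0ℤ + (1ℤ + a + b + - (1ℤ + i)) * 0ℤ + c) * z)
          + - 1ℤ * (1ℤ * (a + 0ℤ)) * (1ℤ * (b + 0ℤ)) * z + i * (1ℤ * (1ℤ * (a + 0ℤ)) * 1ℤ * z)
        ≡ (- a * - a + (1ℤ + a + b + - (1ℤ + i)) * - a + c) * (1ℤ * 1ℤ * 1ℤ * z) + 0ℤ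
      eq = solve-∀
    pointwise (suc l) i refl = begin
      σ (suc l) * x * P b (suc l) * Π q (+ suc l) (suc i)
        + σ (suc (suc l)) * P a (suc (suc l)) * (P b (suc l) * (b + + suc l)) * z + + i * h (suc l) i
        ≡⟨ cong₂ (λ u v → σ (suc l) * x * u * v + σ (suc (suc l)) * P a (suc (suc l)) * (u * (b + + suc l)) * z + + i * h (suc l) i)
             (Π-front (λ t → t) b l) (Πq (suc l) i) ⟩
      _ ≡⟨ eq (σ l) x (P (b + 1ℤ) l) z (+ l) (+ i) a b c ⟩
      (- a * - a + (1ℤ + a + b + - (1ℤ + + N)) * - a + c) * (σ (suc l) * x * P (b + 1ℤ) (suc l) * z)
        + + suc l * (σ l * x * P (b + 1ℤ) l * ((+ suc l * + suc l + (1ℤ + a + b + - (1ℤ + + N)) * + suc l + c) * z))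
        ≡⟨ cong₂ _+_
             (cong₂ (λ u v → u * (σ (suc l) * x * P (b + 1ℤ) (suc l) * v)) (e (- a)) (Πq⁺ (suc l) i))
             (cong (λ u → + suc l * (σ l * x * P (b + 1ℤ) l * u)) (Πq (suc l) i)) ⟨
      q (- a) * g (suc l) i + + suc l * h l (suc i) ∎
      where
      x z : ℤ
      x = P a (suc l)
      z = Π q (+ suc (suc l)) i
      eq : ∀ s x y z l i a b c →
        - s * x * (b * y) * (((1ℤ + l) * (1ℤ + l) + (1ℤ + a + b + - (1ℤ + (1ℤ + l + i))) * (1ℤ + l) + c) * z)
          + - - s * (x * (a + (1ℤ + l))) * ((b * y) * (b + (1ℤ + l))) * z
          + i * (- s * (x * (a + (1ℤ + l))) * (y * (b + 1ℤ + l)) * z)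
        ≡ (- a * - a + (1ℤ + a + b + - (1ℤ + (1ℤ + l + i))) * - a + c) * (- s * x * (y * (b + 1ℤ + l)) * z)
          + (1ℤ + l) * (s * x * y * (((1ℤ + l) * (1ℤ + l) + (1ℤ + a + b + - (1ℤ + (1ℤ + l + i))) * (1ℤ + l) + c) * z))
      eq = solve-∀

  P-front : ∀ x k → P x (suc k) ≡ x * P (x + 1ℤ) k
  P-front = Π-front (λ z → z)

  -- The very-well-poised ₅F₄ sum. Absorbing a + 2l into the binomial coefficient,
  -- (a + 2l) C(N,l) = (a + N + l) C(N-1,l-1) + (a + l) C(N-1,l), reduces N by one and raises a by one.
  very-well-poised : ∀ N a d e →
    B (λ l i → σ l * (a + + l + + l) * P a l * P d l * P e l
               * P (1ℤ + a + - d + + l) i * P (1ℤ + a + - e + + l) i * P (1ℤ + a + (+ l + + l + + i)) i) N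
    ≡ P a (suc (N ℕ.+ N)) * P (1ℤ + a + - d + - e) N
  very-well-poised zero    a d e = eq a
    where
    eq : ∀ a → 1ℤ * (a + 0ℤ + 0ℤ) * 1ℤ * 1ℤ * 1ℤ * 1ℤ * 1ℤ * 1ℤ ≡ 1ℤ * (a + 0ℤ) * 1ℤ
    eq = solve-∀
  very-well-poised (suc N) a d e = begin
    B (λ l i → f l (suc i)) N + B (λ l i → f (suc l) i) N
      ≡⟨ B-+ N (λ l i → f l (suc i)) (λ l i → f (suc l) i) ⟨
    B (λ l i → f l (suc i) + f (suc l) i) N
      ≡⟨ B-telescoped N (λ l i → c * g l i) h pointwise ⟩
    B (λ l i → c * g l i) N
      ≡⟨ trans (B-* N c g) (cong (λ z → c * z) (very-well-poised N (a + 1ℤ) d e)) ⟩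
    c * (P (a + 1ℤ) (suc (N ℕ.+ N)) * P (1ℤ + (a + 1ℤ) + - d + - e) N)
      ≡⟨ cong (λ z → c * (P (a + 1ℤ) (suc (N ℕ.+ N)) * P z N)) (shift₃ a d e) ⟩
    c * (P (a + 1ℤ) (suc (N ℕ.+ N)) * P (1ℤ + a + - d + - e + 1ℤ) N)
      ≡⟨ regroup (1ℤ + a + - d + - e) a (a + 1ℤ + (1ℤ + + N + + N)) (P (a + 1ℤ) (suc (N ℕ.+ N))) (P (1ℤ + a + - d + - e + 1ℤ) N) (lastfactor a (+ N)) ⟩
    a * (P (a + 1ℤ) (suc (N ℕ.+ N)) * (a + 1ℤ + + suc (N ℕ.+ N))) * ((1ℤ + a + - d + - e) * P (1ℤ + a + - d + - e + 1ℤ) N)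
      ≡⟨ cong₂ _*_ (trans (cong (λ k → P a (suc (suc k))) (ℕ.+-suc N N)) (P-front a (suc (suc (N ℕ.+ N))))) (P-front (1ℤ + a + - d + - e) N) ⟨
    P a (suc (suc N ℕ.+ suc N)) * P (1ℤ + a + - d + - e) (suc N) ∎
    where
    open ≡-Reasoning
    φ f g h : ℕ → ℕ → ℤ
    φ l i = P a l * P d l * P e l * P (1ℤ + a + - d + + l) i * P (1ℤ + a + - e + + l) i * P (1ℤ + a + (+ l + + l + + i)) i
    f l i = σ l * (a + + l + + l) * P a l * P d l * P e l
      * P (1ℤ + a + - d + + l) i * P (1ℤ + a + - e + + l) i * P (1ℤ + a + (+ l + + l + + i)) i
    g l i = σ l * (a + 1ℤ + + l + + l) * P (a + 1ℤ) l * P d l * P e l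
      * P (1ℤ + (a + 1ℤ) + - d + + l) i * P (1ℤ + (a + 1ℤ) + - e + + l) i * P (1ℤ + (a + 1ℤ) + (+ l + + l + + i)) i
    h l i = σ (suc l) * φ (suc l) i
    c : ℤ
    c = (1ℤ + a + - d + - e) * a * (a + (+ suc N + + suc N))
    shift₃ : ∀ a d e → 1ℤ + (a + 1ℤ) + - d + - e ≡ 1ℤ + a + - d + - e + 1ℤ
    shift₃ = solve-∀
    lastfactor : ∀ a n → a + (1ℤ + n + (1ℤ + n)) ≡ a + 1ℤ + (1ℤ + n + n)
    lastfactor = solve-∀
    regroup : ∀ t a z x y {w} → w ≡ z → t * a * w * (x * y) ≡ a * (x * z) * (t * y)
    regroup t a z x y refl = eq t a z x y
      where
      eq : ∀ t a z x y → t * a * z * (x * y) ≡ a * (x * z) * (t * y)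
      eq = solve-∀
    P-upper : ∀ d l i → P (1ℤ + a + - d + + l) (suc i) ≡ (1ℤ + a + - d + + l) * P (1ℤ + (a + 1ℤ) + - d + + l) i
    P-upper d l i = trans (P-front (1ℤ + a + - d + + l) i) (cong (λ z → (1ℤ + a + - d + + l) * P z i) (eq a d (+ l)))
      where
      eq : ∀ a d l → 1ℤ + a + - d + l + 1ℤ ≡ 1ℤ + (a + 1ℤ) + - d + l
      eq = solve-∀
    P-lower : ∀ d l i → P (1ℤ + a + - d + + suc l) i ≡ P (1ℤ + (a + 1ℤ) + - d + + l) i
    P-lower d l i = cong (λ z → P z i) (eq a d (+ l))
      where
      eq : ∀ a d l → 1ℤ + a + - d + (1ℤ + l) ≡ 1ℤ + (a + 1ℤ) + - d + l
      eq = solve-∀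
    W : ℕ → ℕ → ℤ
    W l i = P (1ℤ + (a + 1ℤ) + (+ l + + l + + i)) (suc i)
    W₁ : ∀ l i → P (1ℤ + a + (+ l + + l + + suc i)) (suc i) ≡ W l i
    W₁ l i = cong (λ z → P z (suc i)) (eq a (+ l) (+ i))
      where
      eq : ∀ a l i → 1ℤ + a + (l + l + (1ℤ + i)) ≡ 1ℤ + (a + 1ℤ) + (l + l + i)
      eq = solve-∀
    W₂ : ∀ l i → (1ℤ + (a + 1ℤ) + (+ l + + l + + i)) * P (1ℤ + a + (+ suc l + + suc l + + i)) i ≡ W l i
    W₂ l i = sym (trans (P-front (1ℤ + (a + 1ℤ) + (+ l + + l + + i)) i) (cong (λ z → (1ℤ + (a + 1ℤ) + (+ l + + l + + i)) * P z i) (eq a (+ l) (+ i))))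
      where
      eq : ∀ a l i → 1ℤ + (a + 1ℤ) + (l + l + i) + 1ℤ ≡ 1ℤ + a + (1ℤ + l + (1ℤ + l) + i)
      eq = solve-∀
    telescoping-term : ∀ l i → + l * h (ℕ.pred l) (suc i) ≡ + l * (σ l * φ l (suc i))
    telescoping-term zero    i = refl
    telescoping-term (suc l) i = refl
    pointwise : ∀ l i → l ℕ.+ i ≡ N →
      f l (suc i) + f (suc l) i + + i * h l i ≡ c * g l i + + l * h (ℕ.pred l) (suc i)
    pointwise l i refl = begin
      f l (suc i) + f (suc l) i + + i * h l i
        ≡⟨ eq₁ (σ l) a (P a l) (P d l) (P e l) (+ l) (+ i) d e (P (1ℤ + a + - d + + l) (suc i)) (P (1ℤ + a + - e + + l) (suc i)) (P (1ℤ + a + (+ l + + l + + suc i)) (suc i)) (P (1ℤ + a + - d + + suc l) i) (P (1ℤ + a + - e + + suc l) i) (P (1ℤ + a + (+ suc l + + suc l + + i)) i) ⟩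
      σ l * P d l * P e l * (P a (suc l) * P (1ℤ + a + - d + + l) (suc i) * P (1ℤ + a + - e + + l) (suc i) * P (1ℤ + a + (+ l + + l + + suc i)) (suc i)
        + - (P a (suc l) * (d + + l) * (e + + l) * P (1ℤ + a + - d + + suc l) i * P (1ℤ + a + - e + + suc l) i
             * ((1ℤ + (a + 1ℤ) + (+ l + + l + + i)) * P (1ℤ + a + (+ suc l + + suc l + + i)) i)))
        + + l * (σ l * φ l (suc i))
        ≡⟨ cong (λ z → z + + l * (σ l * φ l (suc i))) (cong (λ z → σ l * P d l * P e l * z)
             (cong₂ (λ u v → u + - v)
               (cong₂ _*_ (cong₂ _*_ (cong₂ _*_ (P-front a l) (P-upper d l i)) (P-upper e l i)) (W₁ l i))
               (cong₂ _*_ (cong₂ _*_ (cong₂ _*_ (cong (λ u → u * (d + + l) * (e + + l)) (P-front a l)) (P-lower d l i)) (P-lower e l i)) (W₂ l i)))) ⟩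
      _ ≡⟨ cong (λ z → z + + l * (σ l * φ l (suc i))) (eq₂ (σ l) a (P (a + 1ℤ) l) (P d l) (P e l)
             (1ℤ + a + - d + + l) (1ℤ + a + - e + + l) (d + + l) (e + + l) (1ℤ + (a + 1ℤ) + (+ l + + l + + i) + + i)
             (P (1ℤ + (a + 1ℤ) + - d + + l) i) (P (1ℤ + (a + 1ℤ) + - e + + l) i) (P (1ℤ + (a + 1ℤ) + (+ l + + l + + i)) i)) ⟩
      ((1ℤ + a + - d + + l) * (1ℤ + a + - e + + l) + - ((d + + l) * (e + + l))) * (a * (1ℤ + (a + 1ℤ) + (+ l + + l + + i) + + i) * g₀)
        + + l * (σ l * φ l (suc i))
        ≡⟨ cong (λ z → z + + l * (σ l * φ l (suc i)))
             (trans (cong₂ (λ x y → x * (a * y * g₀)) (eq₃ a d e (+ l)) (eq₄ a (+ l) (+ i)))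
               (eq₅ (1ℤ + a + - d + - e) a (a + (+ suc N + + suc N)) (a + 1ℤ + + l + + l) (σ l) (P (a + 1ℤ) l) (P d l) (P e l)
                 (P (1ℤ + (a + 1ℤ) + - d + + l) i) (P (1ℤ + (a + 1ℤ) + - e + + l) i) (P (1ℤ + (a + 1ℤ) + (+ l + + l + + i)) i))) ⟩
      c * g l i + + l * (σ l * φ l (suc i))
        ≡⟨ cong (λ z → c * g l i + z) (telescoping-term l i) ⟨
      c * g l i + + l * h (ℕ.pred l) (suc i) ∎
      where
      eq₁ : ∀ s a pa pd pe l i d e x₁ x₂ x₃ y₁ y₂ y₃ →
        s * (a + l + l) * pa * pd * pe * x₁ * x₂ * x₃
          + - s * (a + (1ℤ + l) + (1ℤ + l)) * (pa * (a + l)) * (pd * (d + l)) * (pe * (e + l)) * y₁ * y₂ * y₃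
          + i * (- s * (pa * (a + l) * (pd * (d + l)) * (pe * (e + l)) * y₁ * y₂ * y₃))
        ≡ s * pd * pe * (pa * (a + l) * x₁ * x₂ * x₃
            + - (pa * (a + l) * (d + l) * (e + l) * y₁ * y₂ * ((1ℤ + (a + 1ℤ) + (l + l + i)) * y₃)))
          + l * (s * (pa * pd * pe * x₁ * x₂ * x₃))
      eq₁ s a pa pd pe l i d e x₁ x₂ x₃ y₁ y₂ y₃ = trans
        (cong₂ _+_
          (cong₂ _+_ (upper s (a + l + l) pa pd pe x₁ x₂ x₃)
                     (lower s (a + (1ℤ + l) + (1ℤ + l)) (pa * (a + l)) (pd * (d + l)) (pe * (e + l)) y₁ y₂ y₃))
          (shifted i s (pa * (a + l)) (pd * (d + l)) (pe * (e + l)) y₁ y₂ y₃))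
        (trans (core a l i (s * pa * pd * pe * (x₁ * x₂ * x₃)) (s * (pa * (a + l)) * (pd * (d + l)) * (pe * (e + l)) * (y₁ * y₂ * y₃)))
          (sym (cong₂ _+_
            (factored s pa pd pe (a + l) (d + l) (e + l) (1ℤ + (a + 1ℤ) + (l + l + i)) x₁ x₂ x₃ y₁ y₂ y₃)
            (last l s pa pd pe x₁ x₂ x₃))))
        where
        upper : ∀ s t pa pd pe x₁ x₂ x₃ → s * t * pa * pd * pe * x₁ * x₂ * x₃ ≡ t * (s * pa * pd * pe * (x₁ * x₂ * x₃))
        upper = solve-∀
        lower : ∀ s t pa pd pe y₁ y₂ y₃ → - s * t * pa * pd * pe * y₁ * y₂ * y₃ ≡ - (t * (s * pa * pd * pe * (y₁ * y₂ * y₃)))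
        lower = solve-∀
        shifted : ∀ i s pa pd pe y₁ y₂ y₃ → i * (- s * (pa * pd * pe * y₁ * y₂ * y₃)) ≡ - (i * (s * pa * pd * pe * (y₁ * y₂ * y₃)))
        shifted = solve-∀
        last : ∀ l s pa pd pe x₁ x₂ x₃ → l * (s * (pa * pd * pe * x₁ * x₂ * x₃)) ≡ l * (s * pa * pd * pe * (x₁ * x₂ * x₃))
        last = solve-∀
        core : ∀ a l i x y → (a + l + l) * x + - ((a + (1ℤ + l) + (1ℤ + l)) * y) + - (i * y)
          ≡ (a + l) * x + - ((1ℤ + (a + 1ℤ) + (l + l + i)) * y) + l * x
        core = solve-∀
        factored : ∀ s pa pd pe t d e c x₁ x₂ x₃ y₁ y₂ y₃ →
          s * pd * pe * (pa * t * x₁ * x₂ * x₃ + - (pa * t * d * e * y₁ * y₂ * (c * y₃)))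
          ≡ t * (s * pa * pd * pe * (x₁ * x₂ * x₃)) + - (c * (s * (pa * t) * (pd * d) * (pe * e) * (y₁ * y₂ * y₃)))
        factored = solve-∀
      g₀ : ℤ
      g₀ = σ l * P (a + 1ℤ) l * P d l * P e l
        * P (1ℤ + (a + 1ℤ) + - d + + l) i * P (1ℤ + (a + 1ℤ) + - e + + l) i * P (1ℤ + (a + 1ℤ) + (+ l + + l + + i)) i
      eq₂ : ∀ s a pa pd pe u v d e w x₁ x₂ x₃ →
        s * pd * pe * (a * pa * (u * x₁) * (v * x₂) * (x₃ * w) + - (a * pa * d * e * x₁ * x₂ * (x₃ * w)))
        ≡ (u * v + - (d * e)) * (a * w * (s * pa * pd * pe * x₁ * x₂ * x₃))
      eq₂ = solve-∀
      eq₃ : ∀ a d e l → (1ℤ + a + - d + l) * (1ℤ + a + - e + l) + - ((d + l) * (e + l)) ≡ (1ℤ + a + - d + - e) * (a + 1ℤ + l + l)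
      eq₃ = solve-∀
      eq₄ : ∀ a l i → 1ℤ + (a + 1ℤ) + (l + l + i) + i ≡ a + (1ℤ + (l + i) + (1ℤ + (l + i)))
      eq₄ = solve-∀
      eq₅ : ∀ t a w u s pa pd pe x₁ x₂ x₃ →
        t * u * (a * w * (s * pa * pd * pe * x₁ * x₂ * x₃)) ≡ t * a * w * (s * u * pa * pd * pe * x₁ * x₂ * x₃)
      eq₅ = solve-∀

  -- Saalschütz's formula with conjugate and with linear parameters

  B-factor : ∀ n c f {g} → (∀ j i → j ℕ.+ i ≡ n → g j i ≡ c * f j i) → B g n ≡ c * B f n
  B-factor n c f e = trans (B-cong n e) (B-* n c f)

  abstract
    -- The product of the conjugate factors `x + √-y` and `x - √-y`, kept as one integer because
    -- `- y` need not be a square.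
    sq : ℤ → ℤ → ℤ
    sq y x = x * x + y

    sq-def : ∀ y x → sq y x ≡ x * x + y
    sq-def y x = refl

    sq-neg : ∀ y x z → x ≡ - z → sq y x ≡ sq y z
    sq-neg y _ z refl = eq y z
      where
      eq : ∀ y z → - z * - z + y ≡ z * z + y
      eq = solve-∀

  -- Saalschütz's formula is read from right to left, with first parameters `a + k`, `1 - a` and the
  -- quadratic `x ↦ sq y (x + 1)`: the linear coefficient `1 + (a + k) + (1 - a) - k` is 2 for every
  -- `a` and `k`, as required. The constant term is free, which admits arbitrary `y`.
  quadratic-expansion : ∀ y a k →
    B (λ j l → σ j * P (a + + k) j * P (1ℤ + - a) j * Π (sq y) (+ suc j) l) k ≡ Π (sq y) a k
  quadratic-expansion y a k = begin
    B (λ j l → σ j * P (a + + k) j * P (1ℤ + - a) j * Π (sq y) (+ suc j) l) k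
      ≡⟨ B-cong k (λ j l _ → cong (λ z → σ j * P (a + + k) j * P (1ℤ + - a) j * z)
           (Π-ext l λ t → cong (sq y) (eq₁ (+ j) (+ t)))) ⟩
    B (λ j l → σ j * P (a + + k) j * P (1ℤ + - a) j * Π (λ x → sq y (x + 1ℤ)) (+ j) l) k
      ≡⟨ saalschütz k (λ x → sq y (x + 1ℤ)) (a + + k) (1ℤ + - a) (1ℤ + y) (λ x → trans (sq-def y (x + 1ℤ)) (eq₂ x a (+ k) y)) ⟩
    Π (λ x → sq y (x + 1ℤ)) (- (a + + k)) k
      ≡⟨ Π-reverse k rev ⟩
    Π (sq y) a k ∎
    where
    open ≡-Reasoning
    eq₁ : ∀ j t → 1ℤ + j + t ≡ j + t + 1ℤ
    eq₁ = solve-∀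
    eq₂ : ∀ x a k y → (x + 1ℤ) * (x + 1ℤ) + y ≡ x * x + (1ℤ + (a + k) + (1ℤ + - a) + - k) * x + (1ℤ + y)
    eq₂ = solve-∀
    eq₃ : ∀ a t u → - (a + (1ℤ + (t + u))) + t + 1ℤ ≡ - (a + u)
    eq₃ = solve-∀
    rev : ∀ t u → suc (t ℕ.+ u) ≡ k → sq y (- (a + + k) + + t + 1ℤ) ≡ sq y (a + + u)
    rev t u refl = sq-neg y (- (a + + suc (t ℕ.+ u)) + + t + 1ℤ) (a + + u) (eq₃ a (+ t) (+ u))

  -- The case in which the quadratic splits as `(c + x) (1 + a + b - c - n + x)`. Read backwards,
  -- the second factor runs through negatives of `c - a - b + u`, and the resulting signs combine
  -- with `σ l` to the constant `σ n`.
  saalschütz-linear : ∀ n a b c →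
    B (λ i l → P a i * P b i * (P (c + + i) l * P (c + - a + - b) l)) n ≡ P (c + - a) n * P (c + - b) n
  saalschütz-linear n a b c = begin
    B f n                                  ≡⟨ unsign (B f n) ⟩
    σ n * (σ n * B f n)                    ≡⟨ cong (λ z → σ n * z) (B-factor n (σ n) f pointwise) ⟨
    σ n * B (λ l i → σ l * P a l * P b l * Π q (+ l) i) n
                                           ≡⟨ cong (λ z → σ n * z) (saalschütz n q a b (c * (1ℤ + a + b + - c + - + n)) (λ x → eq₁ a b c (+ n) x)) ⟩
    σ n * Π q (- a) n                      ≡⟨ cong (λ z → σ n * z) (Πq n (- a) (c + - a) (c + - b)
                                                (λ t → refl′ c a (+ t)) (λ { t u refl → eq₂ a b c (+ t) (+ u) })) ⟩
    σ n * (σ n * (P (c + - a) n * P (c + - b) n)) ≡⟨ unsign (P (c + - a) n * P (c + - b) n) ⟨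
    P (c + - a) n * P (c + - b) n          ∎
    where
    open ≡-Reasoning
    q : ℤ → ℤ
    q x = (c + x) * (1ℤ + a + b + - c + - + n + x)
    f : ℕ → ℕ → ℤ
    f i l = P a i * P b i * (P (c + + i) l * P (c + - a + - b) l)
    unsign : ∀ x → x ≡ σ n * (σ n * x)
    unsign x = sym (trans (sym (ℤ.*-assoc (σ n) (σ n) x)) (trans (cong (λ z → z * x) (σ² n)) (ℤ.*-identityˡ x)))
    eq₁ : ∀ a b c n x → (c + x) * (1ℤ + a + b + - c + - n + x)
      ≡ x * x + (1ℤ + a + b + - n) * x + c * (1ℤ + a + b + - c + - n)
    eq₁ = solve-∀
    refl′ : ∀ c a t → c + (- a + t) ≡ c + - a + t
    refl′ = solve-∀
    eq₂ : ∀ a b c t u → 1ℤ + a + b + - c + - (1ℤ + (t + u)) + (- a + t) ≡ - (c + - b + u)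
    eq₂ = solve-∀
    Πq : ∀ l x y z → (∀ t → c + (x + + t) ≡ y + + t) →
      (∀ t u → suc (t ℕ.+ u) ≡ l → 1ℤ + a + b + - c + - + n + (x + + t) ≡ - (z + + u)) →
      Π q x l ≡ σ l * (P y l * P z l)
    Πq l x y z e₁ e₂ = trans (Π-* (λ x → c + x) (λ x → 1ℤ + a + b + - c + - + n + x) x l)
      (trans (cong₂ _*_ (Π-ext l e₁) (trans (Π-reverse l e₂) (Π-neg (λ z → z) z l)))
        (eq (P y l) (σ l) (P z l)))
      where
      eq : ∀ y s z → y * (s * z) ≡ s * (y * z)
      eq = solve-∀
    pointwise : ∀ l i → l ℕ.+ i ≡ n → σ l * P a l * P b l * Π q (+ l) i ≡ σ n * f l i
    pointwise l i refl = trans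
      (cong (λ z → σ l * P a l * P b l * z) (Πq i (+ l) (c + + l) (c + - a + - b)
        (λ t → sym (ℤ.+-assoc c (+ l) (+ t))) (λ { t u refl → eq a b c (+ l) (+ t) (+ u) })))
      (trans (eq₃ (σ l) (P a l) (P b l) (σ i) (P (c + + l) i * P (c + - a + - b) i)) (cong (λ z → z * f l i) (sym (σ-+ l i))))
      where
      eq : ∀ a b c l t u → 1ℤ + a + b + - c + - (l + (1ℤ + (t + u))) + (l + t) ≡ - (c + - a + - b + u)
      eq = solve-∀
      eq₃ : ∀ s p q t x → s * p * q * (t * x) ≡ s * t * (p * q * x)
      eq₃ = solve-∀

  P-+ : ∀ x j k → P x (j ℕ.+ k) ≡ P x j * P (x + + j) k
  P-+ = Π-+ (λ z → z)

  -- The transformations of Sears and Whipple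

  module _ (n : ℕ) (a y : ℤ) where

    private
      -- The value of `α` is dictated by `a + a - α = 1 - a`: Saalschütz's formula with `c = a + a`
      -- then yields the pair `1 - a`, `a` of the ₄F₃, and `β` is the remaining parameter
      -- `c - α - a`.
      s u α β : ℤ
      s = a + + n
      u = a + s
      α = a + a + a + - 1ℤ
      β = a + a + - α + - a

    -- The two sides of Sears' transformation. The second ends at i = m if 3a - 1 = -m.
    4F3 : ℤ
    4F3 = B (λ j r → σ j * P (1ℤ + - a) j * P a j * P u j * P (a + a + + j) r * Π (sq y) (+ suc j) r) n

    4F3′ : ℤ
    4F3′ = B (λ i r → σ i * P α i * P a i * P u i * P (a + a + + i) r * Π (sq y) (a + a + + i) r) n

    private
      module Sears where
        open ≡-Reasoning

        f : ℕ → ℕ → ℕ → ℤ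
        f i l r = σ (i ℕ.+ l) * P α i * P a i * P u (i ℕ.+ l) * P (a + a + + i) (l ℕ.+ r) * P β l * Π (sq y) (+ suc (i ℕ.+ l)) r

        module Outer (j r : ℕ) where
          c : ℤ
          c = σ j * P u j * P (a + a + + j) r * Π (sq y) (+ suc j) r

          g : ℕ → ℕ → ℤ
          g i l = P α i * P a i * (P (a + a + + i) l * P β l)

          pointwise : ∀ i l → i ℕ.+ l ≡ j → f i l r ≡ c * g i l
          pointwise i l refl = trans
            (cong (λ v → σ (i ℕ.+ l) * P α i * P a i * P u (i ℕ.+ l) * v * P β l * Π (sq y) (+ suc (i ℕ.+ l)) r)
              (trans (P-+ (a + a + + i) l r) (cong (λ v → P (a + a + + i) l * P v r) (ℤ.+-assoc (a + a) (+ i) (+ l)))))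
            (eq (σ (i ℕ.+ l)) (P α i) (P a i) (P u (i ℕ.+ l)) (P (a + a + + i) l) (P (a + a + + (i ℕ.+ l)) r) (P β l) (Π (sq y) (+ suc (i ℕ.+ l)) r))
            where
            eq : ∀ s p q v w x y z → s * p * q * v * (w * x) * y * z ≡ s * v * x * z * (p * q * (w * y))
            eq = solve-∀

          expand : σ j * P (1ℤ + - a) j * P a j * P u j * P (a + a + + j) r * Π (sq y) (+ suc j) r ≡ B (λ i l → f i l r) j
          expand = begin
            σ j * P (1ℤ + - a) j * P a j * P u j * P (a + a + + j) r * Π (sq y) (+ suc j) r
              ≡⟨ eq₁ (σ j) (P (1ℤ + - a) j) (P a j) (P u j) (P (a + a + + j) r) (Π (sq y) (+ suc j) r) ⟩
            c * (P (1ℤ + - a) j * P a j)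
              ≡⟨ cong (λ z → c * z) (cong₂ (λ v w → P v j * P w j) (eq₂ a) (eq₃ a)) ⟩
            c * (P (a + a + - α) j * P (a + a + - a) j)
              ≡⟨ cong (λ z → c * z) (saalschütz-linear j α a (a + a)) ⟨
            c * B g j
              ≡⟨ B-factor j c g pointwise ⟨
            B (λ i l → f i l r) j ∎
            where
            eq₁ : ∀ s p q v w z → s * p * q * v * w * z ≡ s * v * w * z * (p * q)
            eq₁ = solve-∀
            eq₂ : ∀ a → 1ℤ + - a ≡ a + a + - (a + a + a + - 1ℤ)
            eq₂ = solve-∀
            eq₃ : ∀ a → a ≡ a + a + - a
            eq₃ = solve-∀

        module Inner (i r : ℕ) (i+r≡n : i ℕ.+ r ≡ n) where
          q : ℤ → ℤ
          q x = sq y (x + + suc i)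

          c : ℤ
          c = σ i * P α i * P a i * P u i * P (a + a + + i) r

          g : ℕ → ℕ → ℤ
          g l t = σ l * P (u + + i) l * P β l * Π q (+ l) t

          pointwise : ∀ l t → l ℕ.+ t ≡ r → f i l t ≡ c * g l t
          pointwise l t refl = trans
            (cong₂ (λ v w → v * P α i * P a i * w * P (a + a + + i) (l ℕ.+ t) * P β l * Π (sq y) (+ suc (i ℕ.+ l)) t)
              (σ-+ i l) (P-+ u i l))
            (trans (cong (λ z → σ i * σ l * P α i * P a i * (P u i * P (u + + i) l) * P (a + a + + i) (l ℕ.+ t) * P β l * z)
              (Π-ext t λ k → cong (sq y) (eq₃ (+ i) (+ l) (+ k))))
              (eq (σ i) (σ l) (P α i) (P a i) (P u i) (P (u + + i) l) (P (a + a + + i) (l ℕ.+ t)) (P β l) (Π q (+ l) t)))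
            where
            eq : ∀ s t p q v w x y z → s * t * p * q * (v * w) * x * y * z ≡ s * p * q * v * x * (t * w * y * z)
            eq = solve-∀
            eq₃ : ∀ i l k → 1ℤ + (i + l) + k ≡ l + k + (1ℤ + i)
            eq₃ = solve-∀

          -- Since `u + β = n + 1` and `n = i + r`, the linear coefficient is `2 (i + 1)`, which is
          -- that of `(x + i + 1)² + y`. So the inner sum is balanced again, for every `y`.
          balanced : ∀ x → q x ≡ x * x + (1ℤ + (u + + i) + β + - + r) * x + (+ suc i * + suc i + y)
          balanced x = trans (sq-def y (x + + suc i)) (trans (eq₁ x a (+ i) (+ r) y)
            (cong (λ z → x * x + (1ℤ + (a + (a + z) + + i) + β + - + r) * x + (+ suc i * + suc i + y)) (cong +_ i+r≡n)))
            where
            eq₁ : ∀ x a i r y → (x + (1ℤ + i)) * (x + (1ℤ + i)) + y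
              ≡ x * x + (1ℤ + (a + (a + (i + r)) + i) + (a + a + - (a + a + a + - 1ℤ) + - a) + - r) * x + ((1ℤ + i) * (1ℤ + i) + y)
            eq₁ = solve-∀

          reversed : ∀ t v → suc (t ℕ.+ v) ≡ r → q (- (u + + i) + + t) ≡ sq y (a + a + + i + + v)
          reversed t v refl = sq-neg y (- (u + + i) + + t + + suc i) (a + a + + i + + v)
            (trans (cong (λ z → - (a + (a + z) + + i) + + t + + suc i) (cong +_ (sym i+r≡n))) (eq₂ a (+ i) (+ t) (+ v)))
            where
            eq₂ : ∀ a i t v → - (a + (a + (i + (1ℤ + (t + v)))) + i) + t + (1ℤ + i) ≡ - (a + a + i + v)
            eq₂ = solve-∀

          evaluate : B (λ l t → f i l t) r ≡ c * Π (sq y) (a + a + + i) r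
          evaluate = begin
            B (λ l t → f i l t) r
              ≡⟨ B-factor r c g pointwise ⟩
            c * B g r
              ≡⟨ cong (λ z → c * z) (saalschütz r q (u + + i) β (+ suc i * + suc i + y) balanced) ⟩
            c * Π q (- (u + + i)) r
              ≡⟨ cong (λ z → c * z) (Π-reverse r reversed) ⟩
            c * Π (sq y) (a + a + + i) r ∎

    -- Saalschütz's formula expands `(1 - a)_j (a)_j`; after the interchange of summations the sum
    -- over `l = j - i` is evaluated by a second use of the same formula.
    sears : 4F3 ≡ 4F3′
    sears = trans (B-cong n (λ j r _ → Sears.Outer.expand j r))
      (trans (B-assoc n Sears.f) (B-cong n Sears.Inner.evaluate))

    private
      module Whipple where
        open ≡-Reasoning

        f : ℕ → ℕ → ℕ → ℤ
        f j l i = σ (j ℕ.+ l) * (a + + (j ℕ.+ l) + + (j ℕ.+ l)) * P a (j ℕ.+ l) * P a (j ℕ.+ l) * P u (j ℕ.+ l)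
          * (σ j * P (a + + (j ℕ.+ l)) j * P (1ℤ + - a) j * Π (sq y) (+ suc j) (l ℕ.+ i))
          * P (+ suc (j ℕ.+ l)) i * P (1ℤ + - s + + (j ℕ.+ l)) i * P (1ℤ + s + + (j ℕ.+ l)) i

        summand : ℕ → ℕ → ℤ
        summand k i = σ k * (a + + k + + k) * P a k * P a k * P u k * Π (sq y) a k
          * P (+ suc k) i * P (1ℤ + - s + + k) i * P (1ℤ + s + + k) i * Π (sq y) (+ suc k) i

        module Outer (k i : ℕ) where
          d c : ℤ
          d = σ k * (a + + k + + k) * P a k * P a k * P u k
          c = d * P (+ suc k) i * P (1ℤ + - s + + k) i * P (1ℤ + s + + k) i * Π (sq y) (+ suc k) i

          g : ℕ → ℕ → ℤ
          g j l = σ j * P (a + + k) j * P (1ℤ + - a) j * Π (sq y) (+ suc j) l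

          pointwise : ∀ j l → j ℕ.+ l ≡ k → f j l i ≡ c * g j l
          pointwise j l refl = trans
            (cong (λ z → d * (σ j * P (a + + k) j * P (1ℤ + - a) j * z)
                * P (+ suc k) i * P (1ℤ + - s + + k) i * P (1ℤ + s + + k) i)
              (Π-+ (sq y) (+ suc j) l i))
            (eq d (σ j * P (a + + k) j * P (1ℤ + - a) j) (Π (sq y) (+ suc j) l) (Π (sq y) (+ suc k) i)
              (P (+ suc k) i) (P (1ℤ + - s + + k) i) (P (1ℤ + s + + k) i))
            where
            eq : ∀ d x v w p q r → d * (x * (v * w)) * p * q * r ≡ d * p * q * r * w * (x * v)
            eq = solve-∀

          expand : summand k i ≡ B (λ j l → f j l i) k
          expand = begin
            summand k i
              ≡⟨ eq₁ d (Π (sq y) a k) (P (+ suc k) i) (P (1ℤ + - s + + k) i) (P (1ℤ + s + + k) i) (Π (sq y) (+ suc k) i) ⟩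
            c * Π (sq y) a k
              ≡⟨ cong (λ z → c * z) (quadratic-expansion y a k) ⟨
            c * B g k
              ≡⟨ B-factor k c g pointwise ⟨
            B (λ j l → f j l i) k ∎
            where
            eq₁ : ∀ x z p q r t → x * z * p * q * r * t ≡ x * p * q * r * t * z
            eq₁ = solve-∀

        module Inner (j r : ℕ) (j+r≡n : j ℕ.+ r ≡ n) where
          a′ d e c X T : ℤ
          -- With `k = j + l` the centre of the very-well-poised sum moves from `a` to `a + 2j`;
          -- then `1 + a′ - e` is `1 + j` and `1 + a′ - d` is `1 - s + j`, matching the denominators
          -- that are left.
          a′ = a + + (j ℕ.+ j)
          d = u + + j
          e = a + + j
          X = P (1ℤ + - a) j * Π (sq y) (+ suc j) r
          c = P a j * P a (j ℕ.+ j) * P u j * X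
          T = s * P (1ℤ + - s) n * P (1ℤ + s) n
            * (σ j * P (1ℤ + - a) j * P a j * P u j * P (a + a + + j) r * Π (sq y) (+ suc j) r)

          g : ℕ → ℕ → ℤ
          g l i = σ l * (a′ + + l + + l) * P a′ l * P d l * P e l
            * P (1ℤ + a′ + - d + + l) i * P (1ℤ + a′ + - e + + l) i * P (1ℤ + a′ + (+ l + + l + + i)) i

          signs : ∀ l → σ (j ℕ.+ l) * σ j ≡ σ l
          signs l = trans (cong (λ z → z * σ j) (σ-+ j l))
            (trans (eq (σ j) (σ l)) (trans (cong (λ z → z * σ l) (σ² j)) (ℤ.*-identityˡ (σ l))))
            where
            eq : ∀ x y → x * y * x ≡ x * x * y
            eq = solve-∀

          twice : ∀ l → P a (j ℕ.+ l) * P (a + + (j ℕ.+ l)) j ≡ P a (j ℕ.+ j) * P a′ l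
          twice l = trans (sym (P-+ a (j ℕ.+ l) j)) (trans (cong (P a) (trans (ℕ.+-assoc j l j)
            (trans (cong (j ℕ.+_) (ℕ.+-comm l j)) (sym (ℕ.+-assoc j j l))))) (P-+ a (j ℕ.+ j) l))

          arg₁ : ∀ l → + suc (j ℕ.+ l) ≡ 1ℤ + a′ + - e + + l
          arg₁ l = eq a (+ j) (+ l)
            where
            eq : ∀ a j l → 1ℤ + (j + l) ≡ 1ℤ + (a + (j + j)) + - (a + j) + l
            eq = solve-∀

          arg₂ : ∀ l → 1ℤ + - s + + (j ℕ.+ l) ≡ 1ℤ + a′ + - d + + l
          arg₂ l = eq a (+ n) (+ j) (+ l)
            where
            eq : ∀ a n j l → 1ℤ + - (a + n) + (j + l) ≡ 1ℤ + (a + (j + j)) + - (a + (a + n) + j) + l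
            eq = solve-∀

          arg₃ : ∀ l i → l ℕ.+ i ≡ r → 1ℤ + s + + (j ℕ.+ l) ≡ 1ℤ + a′ + (+ l + + l + + i)
          arg₃ l i l+i≡r = trans (cong (λ z → 1ℤ + (a + + z) + + (j ℕ.+ l)) (sym (trans (cong (j ℕ.+_) l+i≡r) j+r≡n)))
            (eq a (+ j) (+ l) (+ i))
            where
            eq : ∀ a j l i → 1ℤ + (a + (j + (l + i))) + (j + l) ≡ 1ℤ + (a + (j + j)) + (l + l + i)
            eq = solve-∀

          pointwise : ∀ l i → l ℕ.+ i ≡ r → f j l i ≡ c * g l i
          pointwise l i l+i≡r = begin
            f j l i
              ≡⟨ eq₁ (σ (j ℕ.+ l)) (a + + (j ℕ.+ l) + + (j ℕ.+ l)) (P a (j ℕ.+ l)) (P u (j ℕ.+ l)) (σ j)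
                   (P (a + + (j ℕ.+ l)) j) (P (1ℤ + - a) j) (Π (sq y) (+ suc j) (l ℕ.+ i))
                   (P (+ suc (j ℕ.+ l)) i) (P (1ℤ + - s + + (j ℕ.+ l)) i) (P (1ℤ + s + + (j ℕ.+ l)) i) ⟩
            σ (j ℕ.+ l) * σ j * (a + + (j ℕ.+ l) + + (j ℕ.+ l)) * P a (j ℕ.+ l) * (P a (j ℕ.+ l) * P (a + + (j ℕ.+ l)) j) * P u (j ℕ.+ l)
              * (P (1ℤ + - a) j * Π (sq y) (+ suc j) (l ℕ.+ i))
              * (P (+ suc (j ℕ.+ l)) i * P (1ℤ + - s + + (j ℕ.+ l)) i * P (1ℤ + s + + (j ℕ.+ l)) i)
              ≡⟨ cong₂ _*_
                   (cong₂ _*_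
                     (cong₂ _*_ (cong₂ _*_ (cong₂ _*_ (cong₂ _*_ (signs l) (eq₂ a (+ j) (+ l))) (P-+ a j l)) (twice l)) (P-+ u j l))
                     (cong (λ k → P (1ℤ + - a) j * Π (sq y) (+ suc j) k) l+i≡r))
                   (cong₂ _*_ (cong₂ _*_ (cong (λ z → P z i) (arg₁ l)) (cong (λ z → P z i) (arg₂ l))) (cong (λ z → P z i) (arg₃ l i l+i≡r))) ⟩
            σ l * (a′ + + l + + l) * (P a j * P e l) * (P a (j ℕ.+ j) * P a′ l) * (P u j * P d l)
              * X * (P (1ℤ + a′ + - e + + l) i * P (1ℤ + a′ + - d + + l) i * P (1ℤ + a′ + (+ l + + l + + i)) i)
              ≡⟨ eq₃ (σ l) (a′ + + l + + l) (P a j) (P e l) (P a (j ℕ.+ j)) (P a′ l) (P u j) (P d l) X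
                   (P (1ℤ + a′ + - e + + l) i) (P (1ℤ + a′ + - d + + l) i) (P (1ℤ + a′ + (+ l + + l + + i)) i) ⟩
            c * g l i ∎
            where
            eq₁ : ∀ s w p v t q x z g h k → s * w * p * p * v * (t * q * x * z) * g * h * k ≡ s * t * w * p * (p * q) * v * (x * z) * (g * h * k)
            eq₁ = solve-∀
            eq₂ : ∀ a j l → a + (j + l) + (j + l) ≡ a + (j + j) + l + l
            eq₂ = solve-∀
            eq₃ : ∀ s w pj el pjj al uj dl x g h k →
              s * w * (pj * el) * (pjj * al) * (uj * dl) * x * (g * h * k) ≡ pj * pjj * uj * x * (s * w * al * dl * el * h * g * k)
            eq₃ = solve-∀

          -- The total length `2j + (2r + 1) = 2n + 1` does not depend on `j`, so this product
          -- leaves the outer sum as a constant. Cutting it at `n`, where the running factor is `s`,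
          -- gives the factors in `1 - s`, `s` and `1 + s`.
          full : P a (j ℕ.+ j) * P a′ (suc (r ℕ.+ r)) ≡ σ n * P (1ℤ + - s) n * (s * P (1ℤ + s) n)
          full = begin
            P a (j ℕ.+ j) * P a′ (suc (r ℕ.+ r))        ≡⟨ P-+ a (j ℕ.+ j) (suc (r ℕ.+ r)) ⟨
            P a (j ℕ.+ j ℕ.+ suc (r ℕ.+ r))             ≡⟨ cong (P a) lengths ⟩
            P a (n ℕ.+ suc n)                           ≡⟨ P-+ a n (suc n) ⟩
            P a n * P s (suc n)                         ≡⟨ cong₂ _*_ (P-reflect a (1ℤ + - s) n (eq a (+ n)))
                                                             (trans (P-front s n) (cong (λ z → s * P z n) (ℤ.+-comm s 1ℤ))) ⟩
            σ n * P (1ℤ + - s) n * (s * P (1ℤ + s) n)   ∎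
            where
            eq : ∀ a n → a + (1ℤ + - (a + n)) + n ≡ 1ℤ
            eq = solve-∀
            interchange : ∀ w x y z → (w ℕ.+ x) ℕ.+ (y ℕ.+ z) ≡ (w ℕ.+ y) ℕ.+ (x ℕ.+ z)
            interchange w x y z = trans (ℕ.+-assoc w x (y ℕ.+ z)) (trans (cong (w ℕ.+_)
              (trans (sym (ℕ.+-assoc x y z)) (trans (cong (ℕ._+ z) (ℕ.+-comm x y)) (ℕ.+-assoc y x z)))) (sym (ℕ.+-assoc w y (x ℕ.+ z))))
            lengths : j ℕ.+ j ℕ.+ suc (r ℕ.+ r) ≡ n ℕ.+ suc n
            lengths = trans (ℕ.+-suc (j ℕ.+ j) (r ℕ.+ r)) (trans (cong suc (trans (interchange j j r r) (cong₂ ℕ._+_ j+r≡n j+r≡n))) (sym (ℕ.+-suc n n)))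

          evaluate : B (λ l i → f j l i) r ≡ T
          evaluate = begin
            B (λ l i → f j l i) r
              ≡⟨ B-factor r c g pointwise ⟩
            c * B g r
              ≡⟨ cong (λ z → c * z) (very-well-poised r a′ d e) ⟩
            c * (P a′ (suc (r ℕ.+ r)) * P (1ℤ + a′ + - d + - e) r)
              ≡⟨ eq₁ (P a j) (P a (j ℕ.+ j)) (P u j) X (P a′ (suc (r ℕ.+ r))) (P (1ℤ + a′ + - d + - e) r) ⟩
            P a (j ℕ.+ j) * P a′ (suc (r ℕ.+ r)) * (P a j * P u j * X * P (1ℤ + a′ + - d + - e) r)
              ≡⟨ cong₂ (λ v w → v * (P a j * P u j * X * w)) full
                   (P-reflect (1ℤ + a′ + - d + - e) (a + a + + j) r
                     (trans (cong (λ z → 1ℤ + a′ + - (a + (a + + z) + + j) + - e + (a + a + + j) + + r) (sym j+r≡n)) (eq₂ a (+ j) (+ r)))) ⟩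
            σ n * P (1ℤ + - s) n * (s * P (1ℤ + s) n) * (P a j * P u j * X * (σ r * P (a + a + + j) r))
              ≡⟨ cong (λ z → z * P (1ℤ + - s) n * (s * P (1ℤ + s) n) * (P a j * P u j * X * (σ r * P (a + a + + j) r)))
                   (trans (cong σ (sym j+r≡n)) (σ-+ j r)) ⟩
            σ j * σ r * P (1ℤ + - s) n * (s * P (1ℤ + s) n) * (P a j * P u j * X * (σ r * P (a + a + + j) r))
              ≡⟨ eq₃ (σ j) (σ r) (P (1ℤ + - s) n) s (P (1ℤ + s) n) (P a j) (P u j) (P (1ℤ + - a) j) (Π (sq y) (+ suc j) r) (P (a + a + + j) r) ⟩
            σ r * σ r * T
              ≡⟨ trans (cong (λ z → z * T) (σ² r)) (ℤ.*-identityˡ T) ⟩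
            T ∎
            where
            eq₁ : ∀ p q v x y z → p * q * v * x * (y * z) ≡ q * y * (p * v * x * z)
            eq₁ = solve-∀
            eq₂ : ∀ a j r → 1ℤ + (a + (j + j)) + - (a + (a + (j + r)) + j) + - (a + j) + (a + a + j) + r ≡ 1ℤ
            eq₂ = solve-∀
            eq₃ : ∀ sj sr x s y p v w z t → sj * sr * x * (s * y) * (p * v * (w * z) * (sr * t)) ≡ sr * sr * (s * x * y * (sj * w * p * v * t * z))
            eq₃ = solve-∀

    -- Whipple's transformation of the very-well-poised ₇F₆ with parameters a; a, a + s, a - s = -n, a ± √-y,
    -- cleared of denominators.
    whipple :
      B (λ k i → σ k * (a + + k + + k) * P a k * P a k * P u k * Π (sq y) a k
                 * P (+ suc k) i * P (1ℤ + - s + + k) i * P (1ℤ + s + + k) i * Π (sq y) (+ suc k) i) n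
      ≡ s * P (1ℤ + - s) n * P (1ℤ + s) n * 4F3
    whipple = trans (B-cong n (λ k i _ → Whipple.Outer.expand k i)) (trans (B-assoc n Whipple.f)
      (B-factor n (s * P (1ℤ + - s) n * P (1ℤ + s) n)
        (λ j r → σ j * P (1ℤ + - a) j * P a j * P u j * P (a + a + + j) r * Π (sq y) (+ suc j) r) Whipple.Inner.evaluate))

open Hypergeometric

-- Plain finite sums and binomial coefficients

module ModularArithmetic where
  open import Data.Integer.Base using (_+_; _*_; -_)

  -- S f n = Σ_{k+i=n} f k i.
  S : (ℕ → ℕ → ℤ) → ℕ → ℤ
  S f zero    = f 0 0
  S f (suc n) = f 0 (suc n) + S (λ k i → f (suc k) i) n

  S-cong : ∀ n {f g} → (∀ k i → k ℕ.+ i ≡ n → f k i ≡ g k i) → S f n ≡ S g n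
  S-cong zero    e = e 0 0 refl
  S-cong (suc n) e = cong₂ _+_ (e 0 (suc n) refl) (S-cong n λ k i ki → e (suc k) i (cong suc ki))

  S-+ : ∀ n f g → S (λ k i → f k i + g k i) n ≡ S f n + S g n
  S-+ zero    f g = refl
  S-+ (suc n) f g = trans (cong (λ z → f 0 (suc n) + g 0 (suc n) + z) (S-+ n (λ k i → f (suc k) i) (λ k i → g (suc k) i)))
    (swap (f 0 (suc n)) (g 0 (suc n)) (S (λ k i → f (suc k) i) n) (S (λ k i → g (suc k) i) n))
    where
    swap : ∀ a b c d → (a + b) + (c + d) ≡ (a + c) + (b + d)
    swap = solve-∀

  S-* : ∀ n c f → S (λ k i → c * f k i) n ≡ c * S f n
  S-* zero    c f = refl
  S-* (suc n) c f = trans (cong (λ z → c * f 0 (suc n) + z) (S-* n c (λ k i → f (suc k) i)))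
    (sym (ℤ.*-distribˡ-+ c (f 0 (suc n)) (S (λ k i → f (suc k) i) n)))

  S-last : ∀ n f → S f (suc n) ≡ S (λ k i → f k (suc i)) n + f (suc n) 0
  S-last zero    f = refl
  S-last (suc n) f = trans (cong (λ z → f 0 (suc (suc n)) + z) (S-last n (λ k i → f (suc k) i)))
    (sym (ℤ.+-assoc (f 0 (suc (suc n))) (S (λ k i → f (suc k) (suc i)) n) (f (suc (suc n)) 0)))

  S-flip : ∀ n f → S f n ≡ S (λ k i → f i k) n
  S-flip zero    f = refl
  S-flip (suc n) f = trans (cong (λ z → f 0 (suc n) + z) (S-flip n (λ k i → f (suc k) i)))
    (trans (ℤ.+-comm (f 0 (suc n)) (S (λ k i → f (suc i) k) n)) (sym (S-last n (λ k i → f i k))))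

  S-antisymmetric : ∀ n f → (∀ k i → f i k ≡ - f k i) → S f n ≡ 0ℤ
  S-antisymmetric n f e = ℤ.*-cancelˡ-≡ (+ 2) (S f n) 0ℤ (begin
    + 2 * S f n                                          ≡⟨ double (S f n) ⟩
    S f n + S f n                                        ≡⟨ cong (λ z → S f n + z) (S-flip n f) ⟩
    S f n + S (λ k i → f i k) n                          ≡⟨ S-+ n f (λ k i → f i k) ⟨
    S (λ k i → f k i + f i k) n                          ≡⟨ S-cong n (λ k i _ → trans (cong (λ z → f k i + z) (e k i)) (ℤ.+-inverseʳ (f k i))) ⟩
    S (λ k i → 0ℤ * 0ℤ) n                                ≡⟨ S-* n 0ℤ (λ _ _ → 0ℤ) ⟩
    0ℤ                                                   ∎)
    where
    open ≡-Reasoning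
    double : ∀ x → + 2 * x ≡ x + x
    double = solve-∀

  -- The second index is the distance to the top of the range, hence the shift by `d` when the top
  -- drops from `m + d` to `m`.
  S-truncate : ∀ m d f → (∀ k i → m ℕ.< k → f k i ≡ 0ℤ) → S f (m ℕ.+ d) ≡ S (λ k i → f k (i ℕ.+ d)) m
  S-truncate zero    zero    f e = refl
  S-truncate zero    (suc d) f e = trans (cong (λ z → f 0 (suc d) + z)
    (trans (S-cong d λ k i _ → e (suc k) i (ℕ.s≤s ℕ.z≤n)) (S-* d 0ℤ (λ _ _ → 0ℤ)))) (ℤ.+-identityʳ (f 0 (suc d)))
  S-truncate (suc m) d f e = cong (λ z → f 0 (suc m ℕ.+ d) + z)
    (S-truncate m d (λ k i → f (suc k) i) (λ k i m<k → e (suc k) i (ℕ.s≤s m<k)))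

  -- bin k i is the binomial coefficient (k + i choose k).
  bin : ℕ → ℕ → ℤ
  bin zero    i       = 1ℤ
  bin (suc k) zero    = 1ℤ
  bin (suc k) (suc i) = bin k (suc i) + bin (suc k) i

  bin-sym : ∀ k i → bin k i ≡ bin i k
  bin-sym zero    zero    = refl
  bin-sym zero    (suc i) = refl
  bin-sym (suc k) zero    = refl
  bin-sym (suc k) (suc i) = trans (cong₂ _+_ (bin-sym k (suc i)) (bin-sym (suc k) i)) (ℤ.+-comm (bin (suc i) k) (bin i (suc k)))

  bin-rising : ∀ k i → bin k i * P 1ℤ k ≡ P (+ suc i) k
  bin-rising zero    i       = refl
  bin-rising (suc k) zero    = ℤ.*-identityˡ (P 1ℤ (suc k))
  bin-rising (suc k) (suc i) = begin
    (bin k (suc i) + bin (suc k) i) * (P 1ℤ k * (1ℤ + + k))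
      ≡⟨ eq₁ (bin k (suc i)) (bin (suc k) i) (P 1ℤ k) (+ k) ⟩
    bin k (suc i) * P 1ℤ k * (1ℤ + + k) + bin (suc k) i * P 1ℤ (suc k)
      ≡⟨ cong₂ (λ x y → x * (1ℤ + + k) + y) (bin-rising k (suc i))
           (trans (bin-rising (suc k) i) (trans (Π-front (λ z → z) (+ suc i) k) (cong (λ z → + suc i * P z k) (ℤ.+-comm (+ suc i) 1ℤ)))) ⟩
    P (+ suc (suc i)) k * (1ℤ + + k) + + suc i * P (+ suc (suc i)) k
      ≡⟨ eq₂ (P (+ suc (suc i)) k) (+ k) (+ i) ⟩
    P (+ suc (suc i)) k * (+ suc (suc i) + + k) ∎
    where
    open ≡-Reasoning
    eq₁ : ∀ b c x k → (b + c) * (x * (1ℤ + k)) ≡ b * x * (1ℤ + k) + c * (x * (1ℤ + k))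
    eq₁ = solve-∀
    eq₂ : ∀ x k i → x * (1ℤ + k) + (1ℤ + i) * x ≡ x * (1ℤ + (1ℤ + i) + k)
    eq₂ = solve-∀

  B≡S : ∀ n f → B f n ≡ S (λ k i → bin k i * f k i) n
  B≡S zero    f = sym (ℤ.*-identityˡ (f 0 0))
  B≡S (suc n) f = begin
    B (λ k i → f k (suc i)) n + B (λ k i → f (suc k) i) n
      ≡⟨ cong₂ _+_ (B≡S n (λ k i → f k (suc i))) (B≡S n (λ k i → f (suc k) i)) ⟩
    S u n + S v n
      ≡⟨ cong₂ _+_ (trans (S-last n U) (ℤ.+-identityʳ (S u n))) (ℤ.+-identityˡ (S v n)) ⟨
    S U (suc n) + S V (suc n)
      ≡⟨ S-+ (suc n) U V ⟨
    S (λ k i → U k i + V k i) (suc n)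
      ≡⟨ S-cong (suc n) pascal ⟩
    S (λ k i → bin k i * f k i) (suc n) ∎
    where
    open ≡-Reasoning
    u v U V : ℕ → ℕ → ℤ
    u k i = bin k i * f k (suc i)
    v k i = bin k i * f (suc k) i
    -- Zero padding at the two ends of the range supplies the missing neighbours in Pascal's rule.
    U k zero    = 0ℤ
    U k (suc i) = u k i
    V zero    i = 0ℤ
    V (suc k) i = v k i
    pascal : ∀ k i → k ℕ.+ i ≡ suc n → U k i + V k i ≡ bin k i * f k i
    pascal zero    (suc i) _ = ℤ.+-identityʳ (1ℤ * f 0 (suc i))
    pascal (suc k) zero    _ = trans (ℤ.+-identityˡ (bin k 0 * f (suc k) 0)) (cong (λ z → z * f (suc k) 0) (bin-sym k 0))
    pascal (suc k) (suc i) _ = trans (ℤ.+-comm (bin (suc k) i * f (suc k) (suc i)) (bin k (suc i) * f (suc k) (suc i)))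
      (sym (ℤ.*-distribʳ-+ (f (suc k) (suc i)) (bin k (suc i)) (bin (suc k) i)))

  falling-bin : ∀ n k i → k ℕ.+ i ≡ n → P (- + n) k ≡ σ k * (bin k i * P 1ℤ k)
  falling-bin n k i refl = trans (P-reflect (- + (k ℕ.+ i)) (+ suc i) k (eq (+ k) (+ i))) (cong (λ z → σ k * z) (sym (bin-rising k i)))
    where
    eq : ∀ k i → - (k + i) + (1ℤ + i) + k ≡ 1ℤ
    eq = solve-∀

  P-vanish : ∀ m d → P (- + m) (suc (m ℕ.+ d)) ≡ 0ℤ
  P-vanish m d = trans (cong (P (- + m)) (sym (ℕ.+-suc m d))) (trans (P-+ (- + m) m (suc d))
    (trans (cong (λ z → P (- + m) m * z) (trans (Π-front (λ z → z) (- + m + + m) d)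
      (cong (λ z → z * P (- + m + + m + 1ℤ) d) (ℤ.+-inverseˡ (+ m))))) (ℤ.*-zeroʳ (P (- + m) m))))

  -- Congruences and units modulo powers of p

  module _ {m : ℕ} where

    congruenceSetoid : Setoid _ _
    congruenceSetoid = record
      { Carrier       = ℤ
      ; _≈_           = λ a b → a ≡ b [mod m ]
      ; isEquivalence = record { refl = ≈-refl ; sym = ≈-sym ; trans = ≈-trans } }

    -- The coefficient `c` is a certificate: consequences of a known congruence are reduced to
    -- polynomial identities, in which `c` is the cofactor of `a - b`.
    ≈-linear : ∀ {a b x y} c → a ≡ b [mod m ] → x + - y ≡ c * (a + - b) → x ≡ y [mod m ]
    ≈-linear c (mk d) e = mk (subst (+ m ∣_) (sym e) (ℤ∣.∣n⇒∣m*n c d))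

    ≈-linear₂ : ∀ {a b a′ b′ x y} c c′ → a ≡ b [mod m ] → a′ ≡ b′ [mod m ] →
      x + - y ≡ c * (a + - b) + c′ * (a′ + - b′) → x ≡ y [mod m ]
    ≈-linear₂ c c′ (mk d) (mk d′) e = mk (subst (+ m ∣_) (sym e) (ℤ∣.∣m∣n⇒∣m+n (ℤ∣.∣n⇒∣m*n c d) (ℤ∣.∣n⇒∣m*n c′ d′)))

    S-≈ : ∀ n {f g} → (∀ k i → k ℕ.+ i ≡ n → f k i ≡ g k i [mod m ]) → S f n ≡ S g n [mod m ]
    S-≈ zero    e = e 0 0 refl
    S-≈ (suc n) e = +-≈ (e 0 (suc n) refl) (S-≈ n λ k i ki → e (suc k) i (cong suc ki))

    Π-≈ : ∀ {φ ψ x y} k → (∀ t → φ (x + + t) ≡ ψ (y + + t) [mod m ]) → Π φ x k ≡ Π ψ y k [mod m ]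
    Π-≈ zero    e = ≈-refl
    Π-≈ (suc k) e = *-≈ (Π-≈ k e) (e k)

    P-≈ : ∀ {x y} k → x ≡ y [mod m ] → P x k ≡ P y k [mod m ]
    P-≈ k e = Π-≈ k λ t → +-≈ e (≈-refl {a = + t})

    Πsq-≈ : ∀ {x y} z k → x ≡ y [mod m ] → Π (sq z) x k ≡ Π (sq z) y k [mod m ]
    Πsq-≈ {x} {y} z k e = Π-≈ k λ t → let e′ = +-≈ e (≈-refl {a = + t}) in
      ≈-trans (≡⇒≈ (sq-def z (x + + t))) (≈-trans (+-≈ (*-≈ e′ e′) (≈-refl {a = z})) (≡⇒≈ (sym (sq-def z (y + + t)))))

  module ≈-Reasoning (m : ℕ) = SetoidReasoning (congruenceSetoid {m})

  module PrimePower (p : ℕ) (p-prime : Prime p) where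
    open PAdic p p-prime using (unit; p^n∣p^[m+n])

    weaken : ∀ j {k a b} → a ≡ b [mod p ℕ.^ (j ℕ.+ k) ] → a ≡ b [mod p ℕ.^ k ]
    weaken j {k} = ≈-weaken (p^n∣p^[m+n] j k)

    scale : ∀ k {a b} c → + p ∣ c → a ≡ b [mod p ℕ.^ k ] → c * a ≡ c * b [mod p ℕ.^ suc k ]
    scale k {a} {b} c (divides q c≡qp) (mk (divides r a-b≡rp^k)) = mk (divides (q * r) (begin
      c * a + - (c * b)                    ≡⟨ eq₁ c a b ⟩
      c * (a + - b)                        ≡⟨ cong₂ _*_ c≡qp a-b≡rp^k ⟩
      q * + p * (r * + (p ℕ.^ k))          ≡⟨ eq₂ q (+ p) r (+ (p ℕ.^ k)) ⟩
      q * r * (+ p * + (p ℕ.^ k))          ≡⟨ cong (λ z → q * r * z) (ℤ.pos-* p (p ℕ.^ k)) ⟨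
      q * r * + (p ℕ.^ suc k)              ∎))
      where
      open ≡-Reasoning
      eq₁ : ∀ c a b → c * a + - (c * b) ≡ c * (a + - b)
      eq₁ = solve-∀
      eq₂ : ∀ q p r s → q * p * (r * s) ≡ q * r * (p * s)
      eq₂ = solve-∀

    modp⁻ : ∀ {a b} → a ≡ b [mod p ] → a ≡ b [mod p ℕ.^ 1 ]
    modp⁻ = ≈-weaken (ℕ∣.∣-reflexive (ℕ.^-identityʳ p))

    modp⁺ : ∀ {a b} → a ≡ b [mod p ℕ.^ 1 ] → a ≡ b [mod p ]
    modp⁺ = ≈-weaken (ℕ∣.∣-reflexive (sym (ℕ.^-identityʳ p)))

    ∣⇒≈0₁ : ∀ {c} → + p ∣ c → c ≡ 0ℤ [mod p ℕ.^ 1 ]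
    ∣⇒≈0₁ d = modp⁻ (∣⇒≈0 d)

    -- The modulus `p⁵` is the largest one in use, so the same inverse serves for all smaller
    -- powers.
    record Unit (x : ℤ) : Set where
      constructor unit-by
      field
        inverse   : ℤ
        x*inverse : x * inverse ≡ 1ℤ [mod p ℕ.^ 5 ]

    unit-∤ : ∀ {x} → Unit x → ¬ (+ p ∣ x)
    unit-∤ {x} (unit-by u e) p∣x = ℕ.nonTrivial⇒≢1 {{prime⇒nonTrivial p-prime}}
      (ℕ∣.∣1⇒≡1 (∣⇒∣ᵤ (∣-resp (≈-sym (modp⁺ (weaken 4 {1} e))) (ℤ∣.∣m⇒∣m*n u p∣x))))

    ∤-unit : ∀ {x} → ¬ (+ p ∣ x) → Unit x
    ∤-unit {x} p∤x = unit-by (proj₁ (unit {x} p∤x 5)) (proj₂ (unit {x} p∤x 5))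

    unit-resp : ∀ {x y} → x ≡ y [mod p ℕ.^ 1 ] → Unit x → Unit y
    unit-resp e ux = ∤-unit λ p∣y → unit-∤ ux (∣-resp (modp⁺ e) p∣y)

    unit-1 : Unit 1ℤ
    unit-1 = unit-by 1ℤ ≈-refl

    unit-* : ∀ {x y} → Unit x → Unit y → Unit (x * y)
    unit-* {x} {y} (unit-by u e) (unit-by v f) = unit-by (u * v) (≈-trans (≡⇒≈ (eq x y u v)) (*-≈ e f))
      where
      eq : ∀ x y u v → x * y * (u * v) ≡ x * u * (y * v)
      eq = solve-∀

    unit-^ : ∀ {x} k → Unit x → Unit (x ℤ.^ k)
    unit-^ zero    u = unit-1
    unit-^ (suc k) u = unit-* u (unit-^ k u)

    unit-factorˡ : ∀ x y → Unit (x * y) → Unit x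
    unit-factorˡ x y (unit-by u e) = unit-by (y * u) (≈-trans (≡⇒≈ (sym (ℤ.*-assoc x y u))) e)

    unit-factorʳ : ∀ x y → Unit (x * y) → Unit y
    unit-factorʳ x y (unit-by u e) = unit-by (x * u) (≈-trans (≡⇒≈ (eq x y u)) e)
      where
      eq : ∀ x y u → y * (x * u) ≡ x * y * u
      eq = solve-∀

    unit-neg : ∀ {x} → Unit x → Unit (- x)
    unit-neg {x} (unit-by u e) = unit-by (- u) (≈-trans (≡⇒≈ (eq x u)) e)
      where
      eq : ∀ x u → - x * - u ≡ x * u
      eq = solve-∀

    unit-ℕ : ∀ {k} → k ℕ.< p → k ≢ 0 → Unit (+ k)
    unit-ℕ {zero}  _   k≢0 = contradiction refl k≢0
    unit-ℕ {suc k} k<p _   = ∤-unit λ p∣k → >⇒∤ k<p (∣⇒∣ᵤ p∣k)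

    unit-Π : ∀ φ x k → (∀ t → t ℕ.< k → Unit (φ (x + + t))) → Unit (Π φ x k)
    unit-Π φ x zero    u = unit-1
    unit-Π φ x (suc k) u = unit-* (unit-Π φ x k λ t t<k → u t (ℕ.m<n⇒m<1+n t<k)) (u k ℕ.≤-refl)

    cancel : ∀ j {k a b} c → j ℕ.+ k ≡ 5 → Unit c → a * c ≡ b * c [mod p ℕ.^ k ] → a ≡ b [mod p ℕ.^ k ]
    cancel j {k} c j+k≡5 (unit-by u e) = cancelʳ c {u} (weaken j {k} (subst (λ l → c * u ≡ 1ℤ [mod p ℕ.^ l ]) (sym j+k≡5) e))

    cancel₅ : ∀ {a b} c → Unit c → a * c ≡ b * c [mod p ℕ.^ 5 ] → a ≡ b [mod p ℕ.^ 5 ]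
    cancel₅ c = cancel 0 c refl

    cancel₄ : ∀ {a b} c → Unit c → a * c ≡ b * c [mod p ℕ.^ 4 ] → a ≡ b [mod p ℕ.^ 4 ]
    cancel₄ c = cancel 1 c refl

    inv : ℤ → ℤ
    inv x = invert (+ p ℤ∣.∣? x)
      where
      invert : Dec (+ p ∣ x) → ℤ
      invert (yes _)  = 0ℤ
      invert (no p∤x) = Unit.inverse (∤-unit {x} p∤x)

    inv-inverse : ∀ {x} → Unit x → x * inv x ≡ 1ℤ [mod p ℕ.^ 5 ]
    inv-inverse {x} ux with + p ℤ∣.∣? x
    ... | yes p∣x = contradiction p∣x (unit-∤ ux)
    ... | no  p∤x = Unit.x*inverse (∤-unit {x} p∤x)

  -- The quartic that carries the deformation

  fourth : ℤ → ℤ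
  fourth x = x * x * x * x

  abstract
    -- For `c = fourth s` this is the product of `x + t` over the roots of `t⁴ = s⁴`, and for
    -- `c = 0ℤ` the undeformed fourth power. The set of roots is closed under negation, so the same
    -- polynomial serves the numerators `r/3 + t` and the denominators `1 - t`.
    quartic : ℤ → ℤ → ℤ
    quartic c x = fourth x + - c

    quartic-def : ∀ c x → quartic c x ≡ fourth x + - c
    quartic-def c x = refl

    quartic-neg : ∀ c x z → x ≡ - z → quartic c x ≡ quartic c z
    quartic-neg c _ z refl = eq c z
      where
      eq : ∀ c z → - z * - z * - z * - z + - c ≡ z * z * z * z + - c
      eq = solve-∀

    quartic-factors : ∀ s x → quartic (fourth s) x ≡ (x + - s) * (x + s) * sq (s * s) x
    quartic-factors s x = trans (eq s x) (cong (λ z → (x + - s) * (x + s) * z) (sym (sq-def (s * s) x)))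
      where
      eq : ∀ s x → x * x * x * x + - (s * s * s * s) ≡ (x + - s) * (x + s) * (x * x + s * s)
      eq = solve-∀

  Π-quartic-0 : ∀ x k → Π (quartic 0ℤ) x k ≡ fourth (P x k)
  Π-quartic-0 x zero    = refl
  Π-quartic-0 x (suc k) = trans (cong₂ _*_ (Π-quartic-0 x k) (quartic-def 0ℤ (x + + k))) (eq (P x k) (x + + k))
    where
    eq : ∀ a b → a * a * a * a * (b * b * b * b + 0ℤ) ≡ (a * b) * (a * b) * (a * b) * (a * b)
    eq = solve-∀

  Π-quartic-factors : ∀ s x x₋ x₊ k → x₋ ≡ x + - s → x₊ ≡ x + s →
    Π (quartic (fourth s)) x k ≡ P x₋ k * P x₊ k * Π (sq (s * s)) x k
  Π-quartic-factors s x _ _ k refl refl = begin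
    Π (quartic (fourth s)) x k
      ≡⟨ Π-ext k (λ t → quartic-factors s (x + + t)) ⟩
    Π (λ z → (z + - s) * (z + s) * sq (s * s) z) x k
      ≡⟨ trans (Π-* (λ z → (z + - s) * (z + s)) (sq (s * s)) x k)
           (cong (λ z → z * Π (sq (s * s)) x k) (Π-* (λ z → z + - s) (λ z → z + s) x k)) ⟩
    Π (λ z → z + - s) x k * Π (λ z → z + s) x k * Π (sq (s * s)) x k
      ≡⟨ cong (λ z → z * Π (sq (s * s)) x k) (cong₂ _*_ (Π-ext k λ t → swap x (+ t) (- s)) (Π-ext k λ t → swap x (+ t) s)) ⟩
    P (x + - s) k * P (x + s) k * Π (sq (s * s)) x k ∎
    where
    open ≡-Reasoning
    swap : ∀ x y z → x + y + z ≡ x + z + y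
    swap = solve-∀

  -- Invariance of the sum under the deformation, modulo p⁵

  module Deformation (p : ℕ) (p-prime : Prime p) where
    open PrimePower p p-prime

    -- Against a multiple of `p⁴` a factor counts only modulo `p`. This is why symmetry properties
    -- that hold modulo `p` settle a congruence modulo `p⁵`.
    ≈-*-0 : ∀ {a b e} → a ≡ b [mod p ℕ.^ 1 ] → e ≡ 0ℤ [mod p ℕ.^ 4 ] → a * e ≡ b * e [mod p ℕ.^ 5 ]
    ≈-*-0 {a} {b} {e} (mk (divides q a-b≡qp)) e≈0 with ≈0⇒∣ e≈0
    ... | divides r e≡rp⁴ = mk (divides (q * r) (begin
      a * e + - (b * e)                              ≡⟨ eq₁ a b e ⟩
      (a + - b) * e                                  ≡⟨ cong₂ _*_ a-b≡qp e≡rp⁴ ⟩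
      q * + (p ℕ.^ 1) * (r * + (p ℕ.^ 4))            ≡⟨ eq₂ q (+ (p ℕ.^ 1)) r (+ (p ℕ.^ 4)) ⟩
      q * r * (+ (p ℕ.^ 1) * + (p ℕ.^ 4))            ≡⟨ cong (λ z → q * r * z) (trans (cong (λ z → + z * + (p ℕ.^ 4)) (ℕ.^-identityʳ p)) (sym (ℤ.pos-* p (p ℕ.^ 4)))) ⟩
      q * r * + (p ℕ.^ 5)                            ∎))
      where
      open ≡-Reasoning
      eq₁ : ∀ a b e → a * e + - (b * e) ≡ (a + - b) * e
      eq₁ = solve-∀
      eq₂ : ∀ q x r y → q * x * (r * y) ≡ q * r * (x * y)
      eq₂ = solve-∀

    ≈⇒-≈0 : ∀ {k a b} → a ≡ b [mod k ] → a + - b ≡ 0ℤ [mod k ]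
    ≈⇒-≈0 {k} {a} {b} e = ≈-linear 1ℤ e (eq a b)
      where
      eq : ∀ a b → (a + - b) + - 0ℤ ≡ 1ℤ * (a + - b)
      eq = solve-∀

    fourth-≈ : ∀ {k a b} → a ≡ b [mod k ] → fourth a ≡ fourth b [mod k ]
    fourth-≈ e = *-≈ (*-≈ (*-≈ e e) e) e

    scale-0 : ∀ k {a} c → + p ∣ c → a ≡ 0ℤ [mod p ℕ.^ k ] → c * a ≡ 0ℤ [mod p ℕ.^ suc k ]
    scale-0 k {a} c p∣c e = ≈-trans (scale k c p∣c e) (≡⇒≈ (ℤ.*-zeroʳ c))

    fourth-0 : ∀ {c} → + p ∣ c → fourth c ≡ 0ℤ [mod p ℕ.^ 4 ]
    fourth-0 {c} p∣c = ≈-trans (≡⇒≈ (eq c)) (scale-0 3 c p∣c (scale-0 2 c p∣c (scale-0 1 c p∣c (∣⇒≈0₁ p∣c))))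
      where
      eq : ∀ c → c * c * c * c ≡ c * (c * (c * c))
      eq = solve-∀

    quartic-≈ : ∀ c {k x y} → x ≡ y [mod k ] → quartic c x ≡ quartic c y [mod k ]
    quartic-≈ c {k} {x} {y} e = ≈-trans (≡⇒≈ (quartic-def c x))
      (≈-trans (+-≈ (fourth-≈ e) (≈-refl {a = - c})) (≡⇒≈ (sym (quartic-def c y))))

    Πquartic-≈ : ∀ c j {k x y} → x ≡ y [mod k ] → Π (quartic c) x j ≡ Π (quartic c) y j [mod k ]
    Πquartic-≈ c j e = Π-≈ j λ t → quartic-≈ c (+-≈ e (≈-refl {a = + t}))

    module _ {c : ℤ} (c≈0 : c ≡ 0ℤ [mod p ℕ.^ 4 ]) where

      Πquartic≈₄ : ∀ x k → Π (quartic c) x k ≡ Π (quartic 0ℤ) x k [mod p ℕ.^ 4 ]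
      Πquartic≈₄ x k = Π-≈ k λ t → ≈-trans (≡⇒≈ (quartic-def c (x + + t)))
        (≈-trans (+-≈ (≈-refl {a = fourth (x + + t)}) (-‿≈ c≈0)) (≡⇒≈ (sym (quartic-def 0ℤ (x + + t)))))

      -- The defect of the deformation, being divisible by p⁴, depends modulo p⁵ only on x modulo p.
      defect : ∀ {x y} k → x ≡ y [mod p ℕ.^ 1 ] →
        Π (quartic c) x k + - Π (quartic 0ℤ) x k ≡ Π (quartic c) y k + - Π (quartic 0ℤ) y k [mod p ℕ.^ 5 ]
      defect zero    e = ≈-refl
      defect {x} {y} (suc k) e = ≈-trans (≡⇒≈ (expand x)) (≈-trans
        (+-≈ (≈-trans (*-≈ʳ (fourth (x + + k)) (defect k e))
               (≈-trans (≡⇒≈ (ℤ.*-comm (D y) (fourth (x + + k))))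
                 (≈-*-0 (fourth-≈ (+-≈ e (≈-refl {a = + k}))) (≈⇒-≈0 (Πquartic≈₄ y k)))))
             (-‿≈ (≈-*-0 (Πquartic-≈ c k e) c≈0)))
        (≡⇒≈ (sym (trans (expand y) (cong (λ z → z + - (Π (quartic c) y k * c)) (ℤ.*-comm (D y) (fourth (y + + k))))))))
        where
        D : ℤ → ℤ
        D z = Π (quartic c) z k + - Π (quartic 0ℤ) z k
        expand : ∀ z → Π (quartic c) z (suc k) + - Π (quartic 0ℤ) z (suc k) ≡ D z * fourth (z + + k) + - (Π (quartic c) z k * c)
        expand z = trans (cong₂ (λ f g → Π (quartic c) z k * f + - (Π (quartic 0ℤ) z k * g)) (quartic-def c (z + + k)) (quartic-def 0ℤ (z + + k)))
          (eq (Π (quartic c) z k) (Π (quartic 0ℤ) z k) (fourth (z + + k)) c)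
          where
          eq : ∀ F G f c → F * (f + - c) + - (G * (f + 0ℤ)) ≡ (F + - G) * f + - (F * c)
          eq = solve-∀

    module Sums (n : ℕ) (n<p : n ℕ.< p) (a : ℤ) (p∣s : + p ∣ a + + n) where

      s c y : ℤ
      s = a + + n
      c = fourth s
      y = s * s

      c≈0 : c ≡ 0ℤ [mod p ℕ.^ 4 ]
      c≈0 = fourth-0 p∣s

      a≈-n : a ≡ - + n [mod p ℕ.^ 1 ]
      a≈-n = ≈-linear 1ℤ (∣⇒≈0₁ p∣s) (eq a (+ n))
        where
        eq : ∀ a n → a + - - n ≡ 1ℤ * (a + n + - 0ℤ)
        eq = solve-∀

      unit-! : ∀ k → k ℕ.< p → Unit (P 1ℤ k)
      unit-! k k<p = unit-Π (λ z → z) 1ℤ k λ t t<k → unit-ℕ (ℕ.≤-<-trans t<k k<p) (λ ())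

      unit-deformed : ∀ k → k ℕ.< p → Unit (Π (quartic c) 1ℤ k)
      unit-deformed k k<p = unit-resp (weaken 3 {1} (≈-sym (Πquartic≈₄ c≈0 1ℤ k)))
        (subst Unit (sym (Π-quartic-0 1ℤ k)) (unit-* (unit-* (unit-* u u) u) u))
        where
        u : Unit (P 1ℤ k)
        u = unit-! k k<p

      -- For `k < p`, `V k` and `J k` invert the plain and the deformed factorial modulo `p⁵`. `W`
      -- and `W₀` are the quotients of the four factors with and without deformation; the other two
      -- factors stay in `coefficient`.
      V J W W₀ : ℕ → ℤ
      V k = inv (P 1ℤ k)
      J k = inv (Π (quartic c) 1ℤ k)
      W k = Π (quartic c) a k * J k
      W₀ k = Π (quartic 0ℤ) a k * fourth (V k)

      V-inverse : ∀ k → k ℕ.< p → P 1ℤ k * V k ≡ 1ℤ [mod p ℕ.^ 5 ]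
      V-inverse k k<p = inv-inverse (unit-! k k<p)

      J-inverse : ∀ k → k ℕ.< p → Π (quartic c) 1ℤ k * J k ≡ 1ℤ [mod p ℕ.^ 5 ]
      J-inverse k k<p = inv-inverse (unit-deformed k k<p)

      V⁴-inverse : ∀ k → k ℕ.< p → Π (quartic 0ℤ) 1ℤ k * fourth (V k) ≡ 1ℤ [mod p ℕ.^ 5 ]
      V⁴-inverse k k<p = ≈-trans (≡⇒≈ (trans (cong (λ z → z * fourth (V k)) (Π-quartic-0 1ℤ k)) (eq (P 1ℤ k) (V k))))
        (fourth-≈ (V-inverse k k<p))
        where
        eq : ∀ x v → x * x * x * x * (v * v * v * v) ≡ x * v * (x * v) * (x * v) * (x * v)
        eq = solve-∀

      J≈V⁴ : ∀ k → k ℕ.< p → J k ≡ fourth (V k) [mod p ℕ.^ 4 ]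
      J≈V⁴ k k<p = inverses-≈ (weaken 1 {4} (J-inverse k k<p)) (weaken 1 {4} (V⁴-inverse k k<p)) (Πquartic≈₄ c≈0 1ℤ k)
        where
        inverses-≈ : ∀ {y Y j v} → y * j ≡ 1ℤ [mod p ℕ.^ 4 ] → Y * v ≡ 1ℤ [mod p ℕ.^ 4 ] → y ≡ Y [mod p ℕ.^ 4 ] → j ≡ v [mod p ℕ.^ 4 ]
        inverses-≈ {y} {Y} {j} {v} e₁ e₂ e₃ = ≈-trans (≈-linear (- j) e₂ (eq₁ Y j v)) (≈-trans
          (≈-linear (- (j * v)) e₃ (eq₂ y Y j v)) (≈-linear v e₁ (eq₃ y j v)))
          where
          eq₁ : ∀ Y j v → j + - (j * (Y * v)) ≡ - j * (Y * v + - 1ℤ)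
          eq₁ = solve-∀
          eq₂ : ∀ y Y j v → j * (Y * v) + - (y * j * v) ≡ - (j * v) * (y + - Y)
          eq₂ = solve-∀
          eq₃ : ∀ y j v → y * j * v + - v ≡ v * (y * j + - 1ℤ)
          eq₃ = solve-∀

      -- The quartic is even, so its product over `- n`, ..., `- n + k - 1` is the product over
      -- `i + 1`, ..., `n` and completes the one over `1`, ..., `i`. With `a` replaced by `- n`, the
      -- quotient `W k` thus becomes symmetric in `k` and `i`.
      reflected : ∀ d k i → k ℕ.+ i ≡ n → Π (quartic d) 1ℤ i * Π (quartic d) (- + n) k ≡ Π (quartic d) 1ℤ n
      reflected d k i refl = trans
        (cong (λ z → Π (quartic d) 1ℤ i * z) (Π-reverse k rev))
        (trans (sym (Π-+ (quartic d) 1ℤ i k)) (cong (Π (quartic d) 1ℤ) (ℕ.+-comm i k)))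
        where
        rev : ∀ t u → suc (t ℕ.+ u) ≡ k → quartic d (- + (k ℕ.+ i) + + t) ≡ quartic d (1ℤ + + i + + u)
        rev t u refl = quartic-neg d (- + (suc (t ℕ.+ u) ℕ.+ i) + + t) (1ℤ + + i + + u) (eq (+ t) (+ u) (+ i))
          where
          eq : ∀ t u i → - (1ℤ + (t + u) + i) + t ≡ - (1ℤ + i + u)
          eq = solve-∀

      symmetric : ℕ → ℕ → ℤ
      symmetric k i = Π (quartic c) 1ℤ n * (J i * J k) + - (Π (quartic 0ℤ) 1ℤ n * (fourth (V i) * fourth (V k)))

      -- The difference splits into a defect of the numerator and a defect of the inverse
      -- denominator. Both are multiples of `p⁴`, so `a` may be replaced by `- n` in them, where
      -- `reflected` applies.
      W-defect : ∀ k i → k ℕ.+ i ≡ n → W k + - W₀ k ≡ symmetric k i [mod p ℕ.^ 5 ]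
      W-defect k i k+i≡n = begin
        W k + - W₀ k
          ≈⟨ ≡⇒≈ (eq₁ (Π (quartic c) a k) (J k) (Π (quartic 0ℤ) a k) (fourth (V k))) ⟩
        (Π (quartic c) a k + - Π (quartic 0ℤ) a k) * J k + Π (quartic 0ℤ) a k * (J k + - fourth (V k))
          ≈⟨ +-≈ (*-≈ʳ (J k) (defect c≈0 k a≈-n)) (≈-*-0 (Πquartic-≈ 0ℤ k a≈-n) (≈⇒-≈0 (J≈V⁴ k k<p))) ⟩
        (x + - X) * J k + X * (J k + - fourth (V k))
          ≈⟨ ≡⇒≈ (sym (eq₁ x (J k) X (fourth (V k)))) ⟩
        x * J k + - (X * fourth (V k))
          ≈⟨ +-≈ (swap c (J i) (J k) (J-inverse i i<p)) (-‿≈ (swap 0ℤ (fourth (V i)) (fourth (V k)) (V⁴-inverse i i<p))) ⟩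
        symmetric k i ∎
        where
        open ≈-Reasoning (p ℕ.^ 5)
        x X : ℤ
        x = Π (quartic c) (- + n) k
        X = Π (quartic 0ℤ) (- + n) k
        k<p : k ℕ.< p
        k<p = ℕ.≤-<-trans (ℕ.≤-trans (ℕ.m≤m+n k i) (ℕ.≤-reflexive k+i≡n)) n<p
        i<p : i ℕ.< p
        i<p = ℕ.≤-<-trans (ℕ.≤-trans (ℕ.m≤n+m i k) (ℕ.≤-reflexive k+i≡n)) n<p
        eq₁ : ∀ x j X v → x * j + - (X * v) ≡ (x + - X) * j + X * (j + - v)
        eq₁ = solve-∀
        swap : ∀ d j j′ → Π (quartic d) 1ℤ i * j ≡ 1ℤ [mod p ℕ.^ 5 ] →
          Π (quartic d) (- + n) k * j′ ≡ Π (quartic d) 1ℤ n * (j * j′) [mod p ℕ.^ 5 ]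
        swap d j j′ e = ≈-linear (- (Π (quartic d) (- + n) k * j′)) e (trans
          (cong (λ z → Π (quartic d) (- + n) k * j′ + - (z * (j * j′))) (sym (reflected d k i k+i≡n)))
          (eq₂ (Π (quartic d) (- + n) k) j′ (Π (quartic d) 1ℤ i) j))
          where
          eq₂ : ∀ x j′ y j → x * j′ + - (y * x * (j * j′)) ≡ - (x * j′) * (y * j + - 1ℤ)
          eq₂ = solve-∀

      coefficient antisymmetric : ℕ → ℕ → ℤ
      coefficient k i = (a + + k + + k) * (P a k * P a k) * (V k * V k)
      antisymmetric k i = (+ k + - + i) * (P 1ℤ n * P 1ℤ n) * (V i * V i) * (V k * V k)

      -- Modulo `p` one has `a ≡ - n`. So `a + 2k` becomes `k - i`, the only odd factor, and `(a)_k`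
      -- becomes `n! / i!` up to a sign that squaring removes.
      coefficient-≈ : ∀ k i → k ℕ.+ i ≡ n → coefficient k i ≡ antisymmetric k i [mod p ℕ.^ 1 ]
      coefficient-≈ k i k+i≡n = ≈-trans (*-≈ʳ (V k * V k) (*-≈ linear square))
        (≡⇒≈ (eq₄ (+ k + - + i) (P 1ℤ n * P 1ℤ n) (V i * V i) (V k * V k)))
        where
        i<p : i ℕ.< p
        i<p = ℕ.≤-<-trans (ℕ.≤-trans (ℕ.m≤n+m i k) (ℕ.≤-reflexive k+i≡n)) n<p
        eq₁ : ∀ k i → i ≡ k + i + - k
        eq₁ = solve-∀
        eq₂ : ∀ a k n → a + k + k + - (k + - (n + - k)) ≡ 1ℤ * (a + - - n)
        eq₂ = solve-∀
        eq₃ : ∀ s f v → s * (f * v) * (s * (f * v)) ≡ s * s * (f * f * (v * v))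
        eq₃ = solve-∀
        eq₄ : ∀ x f v w → x * (f * v) * w ≡ x * f * v * w
        eq₄ = solve-∀
        P-tail : P 1ℤ i * P (+ suc i) k ≡ P 1ℤ n
        P-tail = trans (sym (P-+ 1ℤ i k)) (cong (P 1ℤ) (trans (ℕ.+-comm i k) k+i≡n))
        eq₅ : ∀ s x f v → s * x + - (s * (f * x * v)) ≡ - (s * x) * (f * v + - 1ℤ)
        eq₅ = solve-∀
        A≈ : P a k ≡ σ k * (P 1ℤ n * V i) [mod p ℕ.^ 1 ]
        A≈ = ≈-trans (P-≈ k a≈-n) (≈-trans
          (≡⇒≈ (trans (falling-bin n k i k+i≡n) (cong (λ z → σ k * z) (bin-rising k i))))
          (≈-linear (- (σ k * P (+ suc i) k)) (weaken 4 {1} (V-inverse i i<p))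
            (trans (cong (λ z → σ k * P (+ suc i) k + - (σ k * (z * V i))) (sym P-tail))
              (eq₅ (σ k) (P (+ suc i) k) (P 1ℤ i) (V i)))))
        linear : a + + k + + k ≡ + k + - + i [mod p ℕ.^ 1 ]
        linear = ≈-linear 1ℤ a≈-n (trans (cong (λ z → a + + k + + k + - (+ k + - z)) (trans (eq₁ (+ k) (+ i)) (cong (λ z → + z + - + k) k+i≡n)))
          (eq₂ a (+ k) (+ n)))
        square : P a k * P a k ≡ P 1ℤ n * P 1ℤ n * (V i * V i) [mod p ℕ.^ 1 ]
        square = ≈-trans (*-≈ A≈ A≈) (≡⇒≈ (trans (eq₃ (σ k) (P 1ℤ n) (V i))
          (trans (cong (λ z → z * (P 1ℤ n * P 1ℤ n * (V i * V i))) (σ² k)) (ℤ.*-identityˡ (P 1ℤ n * P 1ℤ n * (V i * V i))))))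

      symmetric-≈0 : ∀ k i → k ℕ.+ i ≡ n → symmetric k i ≡ 0ℤ [mod p ℕ.^ 4 ]
      symmetric-≈0 k i k+i≡n = ≈⇒-≈0 (*-≈ (Πquartic≈₄ c≈0 1ℤ n) (*-≈ (J≈V⁴ i i<p) (J≈V⁴ k k<p)))
        where
        k<p : k ℕ.< p
        k<p = ℕ.≤-<-trans (ℕ.≤-trans (ℕ.m≤m+n k i) (ℕ.≤-reflexive k+i≡n)) n<p
        i<p : i ℕ.< p
        i<p = ℕ.≤-<-trans (ℕ.≤-trans (ℕ.m≤n+m i k) (ℕ.≤-reflexive k+i≡n)) n<p

      deformed-sum : S (λ k i → coefficient k i * W k) n ≡ S (λ k i → coefficient k i * W₀ k) n [mod p ℕ.^ 5 ]
      deformed-sum = begin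
        S (λ k i → coefficient k i * W k) n
          ≈⟨ S-≈ n pointwise ⟩
        S (λ k i → coefficient k i * W₀ k + antisymmetric k i * symmetric k i) n
          ≈⟨ ≡⇒≈ (trans (S-+ n (λ k i → coefficient k i * W₀ k) (λ k i → antisymmetric k i * symmetric k i))
               (trans (cong (λ z → S (λ k i → coefficient k i * W₀ k) n + z)
                 (S-antisymmetric n (λ k i → antisymmetric k i * symmetric k i) odd)) (ℤ.+-identityʳ (S (λ k i → coefficient k i * W₀ k) n)))) ⟩
        S (λ k i → coefficient k i * W₀ k) n ∎
        where
        open ≈-Reasoning (p ℕ.^ 5)
        pointwise : ∀ k i → k ℕ.+ i ≡ n →
          coefficient k i * W k ≡ coefficient k i * W₀ k + antisymmetric k i * symmetric k i [mod p ℕ.^ 5 ]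
        pointwise k i k+i≡n = ≈-linear₂ (coefficient k i) 1ℤ (W-defect k i k+i≡n)
          (≈-*-0 (coefficient-≈ k i k+i≡n) (symmetric-≈0 k i k+i≡n))
          (eq (coefficient k i) (W k) (W₀ k) (antisymmetric k i) (symmetric k i))
          where
          eq : ∀ b w w₀ g z → b * w + - (b * w₀ + g * z) ≡ b * (w + - w₀ + - z) + 1ℤ * (b * z + - (g * z))
          eq = solve-∀
        odd : ∀ k i → antisymmetric i k * symmetric i k ≡ - (antisymmetric k i * symmetric k i)
        odd k i = eq (+ k) (+ i) (P 1ℤ n * P 1ℤ n) (V i * V i) (V k * V k) (Π (quartic c) 1ℤ n) (J i) (J k)
          (Π (quartic 0ℤ) 1ℤ n) (fourth (V i)) (fourth (V k))
          where
          eq : ∀ k i f vi vk y ji jk z wi wk →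
            (i + - k) * f * vk * vi * (y * (jk * ji) + - (z * (wk * wi))) ≡ - ((k + - i) * f * vi * vk * (y * (ji * jk) + - (z * (wi * wk))))
          eq = solve-∀

      deformed-whipple :
        S (λ k i → coefficient k i * W k) n * (P 1ℤ n * Π (sq y) 1ℤ n) ≡ s * 4F3 n a y [mod p ℕ.^ 5 ]
      deformed-whipple = cancel₅ (P (1ℤ + - s) n * P (1ℤ + s) n) unit (begin
        S (λ k i → coefficient k i * W k) n * (P 1ℤ n * Π (sq y) 1ℤ n) * (P (1ℤ + - s) n * P (1ℤ + s) n)
          ≈⟨ ≡⇒≈ (eq₁ (S (λ k i → coefficient k i * W k) n) (P 1ℤ n) (Π (sq y) 1ℤ n) (P (1ℤ + - s) n) (P (1ℤ + s) n)) ⟩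
        D * S (λ k i → coefficient k i * W k) n
          ≈⟨ ≡⇒≈ (sym (S-* n D (λ k i → coefficient k i * W k))) ⟩
        S (λ k i → D * (coefficient k i * W k)) n
          ≈⟨ S-≈ n pointwise ⟩
        S (λ k i → bin k i * summand k i) n
          ≈⟨ ≡⇒≈ (trans (sym (B≡S n summand)) (whipple n a y)) ⟩
        s * P (1ℤ + - s) n * P (1ℤ + s) n * 4F3 n a y
          ≈⟨ ≡⇒≈ (eq₂ s (P (1ℤ + - s) n) (P (1ℤ + s) n) (4F3 n a y)) ⟩
        s * 4F3 n a y * (P (1ℤ + - s) n * P (1ℤ + s) n) ∎)
        where
        open ≈-Reasoning (p ℕ.^ 5)
        D : ℤ
        -- The common denominator of the deformed sum. One of its two factorials, `n!`, is here; the
        -- other one disappears into the binomial coefficient.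
        D = P 1ℤ n * (P (1ℤ + - s) n * P (1ℤ + s) n * Π (sq y) 1ℤ n)
        eq₁ : ∀ z f g h k → z * (f * g) * (h * k) ≡ f * (h * k * g) * z
        eq₁ = solve-∀
        eq₂ : ∀ s h k z → s * h * k * z ≡ s * z * (h * k)
        eq₂ = solve-∀
        unit : Unit (P (1ℤ + - s) n * P (1ℤ + s) n)
        unit = unit-factorˡ (P (1ℤ + - s) n * P (1ℤ + s) n) (Π (sq y) 1ℤ n)
          (subst Unit (Π-quartic-factors s 1ℤ (1ℤ + - s) (1ℤ + s) n refl refl) (unit-deformed n n<p))
        summand : ℕ → ℕ → ℤ
        summand k i = σ k * (a + + k + + k) * P a k * P a k * P (a + s) k * Π (sq y) a k
          * P (+ suc k) i * P (1ℤ + - s + + k) i * P (1ℤ + s + + k) i * Π (sq y) (+ suc k) i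
        pointwise : ∀ k i → k ℕ.+ i ≡ n → D * (coefficient k i * W k) ≡ bin k i * summand k i [mod p ℕ.^ 5 ]
        pointwise k i k+i≡n = begin
          D * (coefficient k i * W k)
            ≈⟨ ≡⇒≈ (cong₂ (λ d x → d * (coefficient k i * (x * J k))) split numerator) ⟩
          f * P (+ suc k) i * (g * P (1ℤ + - s + + k) i * (h * P (1ℤ + s + + k) i) * (q * Π (sq y) (+ suc k) i))
            * (coefficient k i * (σ k * (bin k i * f) * P (a + s) k * Π (sq y) a k * J k))
            ≈⟨ ≡⇒≈ (eq₃ f (P (+ suc k) i) g (P (1ℤ + - s + + k) i) h (P (1ℤ + s + + k) i) q (Π (sq y) (+ suc k) i)
                 (a + + k + + k) (P a k) (V k) (σ k) (bin k i) (P (a + s) k) (Π (sq y) a k) (J k)) ⟩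
          bin k i * summand k i * ((f * V k) * (f * V k) * (g * h * q * J k))
            ≈⟨ *-≈ˡ (bin k i * summand k i) (*-≈ (*-≈ (V-inverse k k<p) (V-inverse k k<p))
                 (≈-trans (≡⇒≈ (cong (λ z → z * J k) (sym (Π-quartic-factors s 1ℤ (1ℤ + - s) (1ℤ + s) k refl refl)))) (J-inverse k k<p))) ⟩
          bin k i * summand k i * 1ℤ
            ≈⟨ ≡⇒≈ (ℤ.*-identityʳ (bin k i * summand k i)) ⟩
          bin k i * summand k i ∎
          where
          f g h q : ℤ
          f = P 1ℤ k
          g = P (1ℤ + - s) k
          h = P (1ℤ + s) k
          q = Π (sq y) 1ℤ k
          k<p : k ℕ.< p
          k<p = ℕ.≤-<-trans (ℕ.≤-trans (ℕ.m≤m+n k i) (ℕ.≤-reflexive k+i≡n)) n<p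
          split : D ≡ f * P (+ suc k) i * (g * P (1ℤ + - s + + k) i * (h * P (1ℤ + s + + k) i) * (q * Π (sq y) (+ suc k) i))
          split = cong₂ _*_ (at (λ z → z) 1ℤ) (cong₂ _*_ (cong₂ _*_ (at (λ z → z) (1ℤ + - s)) (at (λ z → z) (1ℤ + s))) (at (sq y) 1ℤ))
            where
            at : ∀ φ x → Π φ x n ≡ Π φ x k * Π φ (x + + k) i
            at φ x = trans (cong (Π φ x) (sym k+i≡n)) (Π-+ φ x k i)
          -- Since `a - s = - n`, one of the four deformed factors is `(- n)_k`; it supplies the
          -- binomial coefficient, together with a `k!` that cancels one `V k`.
          numerator : Π (quartic c) a k ≡ σ k * (bin k i * f) * P (a + s) k * Π (sq y) a k
          numerator = trans (Π-quartic-factors s a (- + n) (a + s) k (eq₄ a (+ n)) refl)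
            (cong (λ z → z * P (a + s) k * Π (sq y) a k) (falling-bin n k i k+i≡n))
            where
            eq₄ : ∀ a n → - n ≡ a + - (a + n)
            eq₄ = solve-∀
          eq₃ : ∀ f f′ g g′ h h′ q q′ w A v e b u z j →
            f * f′ * (g * g′ * (h * h′) * (q * q′)) * (w * (A * A) * (v * v) * (e * (b * f) * u * z * j))
            ≡ b * (e * w * A * A * u * z * f′ * g′ * h′ * q′) * ((f * v) * (f * v) * (g * h * q * j))
          eq₃ f f′ g g′ h h′ q q′ w A v e b u z j = trans
            (cong (λ x → f * f′ * x * (w * (A * A) * (v * v) * (e * (b * f) * u * z * j))) (interchange g g′ h h′ q q′))
            (trans (collect f f′ (g * h * q) (g′ * h′ * q′) w A v e b u z j)
              (cong (λ x → b * x * ((f * v) * (f * v) * (g * h * q * j))) (sym (associate (e * w * A * A * u * z * f′) g′ h′ q′))))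
            where
            interchange : ∀ g g′ h h′ q q′ → g * g′ * (h * h′) * (q * q′) ≡ g * h * q * (g′ * h′ * q′)
            interchange = solve-∀
            associate : ∀ x g h q → x * g * h * q ≡ x * (g * h * q)
            associate = solve-∀
            collect : ∀ f f′ x x′ w A v e b u z j →
              f * f′ * (x * x′) * (w * (A * A) * (v * v) * (e * (b * f) * u * z * j))
              ≡ b * (e * w * A * A * u * z * f′ * x′) * ((f * v) * (f * v) * (x * j))
            collect = solve-∀

  -- The truncated ₄F₃ and the removal of s²

  cube : ℤ → ℤ
  cube x = x * x * x

  cube-≈ : ∀ {M a b} → a ≡ b [mod M ] → cube a ≡ cube b [mod M ]
  cube-≈ e = *-≈ (*-≈ e e) e

  P-vanish-> : ∀ m k → m ℕ.< k → P (- + m) k ≡ 0ℤ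
  P-vanish-> m k m<k = trans (cong (P (- + m)) (sym (ℕ.m+[n∸m]≡n m<k))) (P-vanish m (k ℕ.∸ suc m))

  Πsq-reflect : ∀ y x z k → x + z + + k ≡ 1ℤ → Π (sq y) x k ≡ Π (sq y) z k
  Πsq-reflect y x z k e = Π-reverse k rev
    where
    rev : ∀ t u → suc (t ℕ.+ u) ≡ k → sq y (x + + t) ≡ sq y (z + + u)
    rev t u refl = sq-neg y (x + + t) (z + + u)
      (trans (eq x z (+ t) (+ u)) (trans (cong (λ w → w + - 1ℤ + - (z + + u)) e) (ℤ.+-identityˡ (- (z + + u)))))
      where
      eq : ∀ x z t u → x + t ≡ x + z + (1ℤ + (t + u)) + - 1ℤ + - (z + u)
      eq = solve-∀

  Πsq-difference : ∀ s x k → Π (sq (- (s * s))) x k ≡ P (x + - s) k * P (x + s) k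
  Πsq-difference s x k = begin
    Π (sq (- (s * s))) x k
      ≡⟨ Π-ext k (λ t → trans (sq-def (- (s * s)) (x + + t)) (eq s (x + + t))) ⟩
    Π (λ z → (z + - s) * (z + s)) x k
      ≡⟨ Π-* (λ z → z + - s) (λ z → z + s) x k ⟩
    Π (λ z → z + - s) x k * Π (λ z → z + s) x k
      ≡⟨ cong₂ _*_ (Π-ext k λ t → swap x (+ t) (- s)) (Π-ext k λ t → swap x (+ t) s) ⟩
    P (x + - s) k * P (x + s) k ∎
    where
    open ≡-Reasoning
    eq : ∀ s x → x * x + - (s * s) ≡ (x + - s) * (x + s)
    eq = solve-∀
    swap : ∀ x y z → x + y + z ≡ x + z + y
    swap = solve-∀

  -- The coefficient of `y` in `Π (sq y) x k` as a polynomial in `y`, by the product rule.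
  slope : ℤ → ℕ → ℤ
  slope x zero    = 0ℤ
  slope x (suc k) = slope x k * ((x + + k) * (x + + k)) + P x k * P x k

  Πsq-linearised : ∀ {M} y x k → y * y ≡ 0ℤ [mod M ] → Π (sq y) x k ≡ P x k * P x k + y * slope x k [mod M ]
  Πsq-linearised y x zero    e = ≡⇒≈ (eq y)
    where
    eq : ∀ y → 1ℤ ≡ 1ℤ * 1ℤ + y * 0ℤ
    eq = solve-∀
  Πsq-linearised y x (suc k) e = ≈-linear₂ (sq y (x + + k)) (slope x k) (Πsq-linearised y x k e) e
    (trans (cong (λ q → Π (sq y) x k * q + - (P x k * (x + + k) * (P x k * (x + + k)) + y * slope x (suc k))) (sq-def y (x + + k)))
      (trans (eq (Π (sq y) x k) (x + + k) y (P x k) (slope x k))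
        (cong (λ q → q * (Π (sq y) x k + - (P x k * P x k + y * slope x k)) + slope x k * (y * y + - 0ℤ)) (sym (sq-def y (x + + k))))))
    where
    eq : ∀ F z y p g → F * (z * z + y) + - (p * z * (p * z) + y * (g * (z * z) + p * p))
      ≡ (z * z + y) * (F + - (p * p + y * g)) + g * (y * y + - 0ℤ)
    eq = solve-∀

  -- The truncated ₄F₃ without its constant factor. The factors at `i` carry `- y` and those at `r`
  -- carry `y`, so exchanging `i` and `r` amounts to changing the sign of `y`.
  paired : ℕ → ℤ → ℤ → ℤ
  paired m a y = S (λ i r → bin i r * (P a i * Π (sq (- y)) a i * (P a r * Π (sq y) a r))) m

  -- The first-order term in y is antisymmetric under i ↔ r.
  paired-undeformed : ∀ {M} m a y → y * y ≡ 0ℤ [mod M ] →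
    paired m a y ≡ S (λ i r → bin i r * (cube (P a i) * cube (P a r))) m [mod M ]
  paired-undeformed {M} m a y e = ≈-trans (S-≈ m λ i r _ → pointwise i r) (≡⇒≈ (begin
    S (λ i r → f i r + y * g i r) m        ≡⟨ S-+ m f (λ i r → y * g i r) ⟩
    S f m + S (λ i r → y * g i r) m        ≡⟨ cong (λ z → S f m + z) (trans (S-* m y g) (cong (λ z → y * z) (S-antisymmetric m g odd))) ⟩
    S f m + y * 0ℤ                         ≡⟨ trans (cong (λ z → S f m + z) (ℤ.*-zeroʳ y)) (ℤ.+-identityʳ (S f m)) ⟩
    S f m                                  ∎))
    where
    open ≡-Reasoning
    f g : ℕ → ℕ → ℤ
    f i r = bin i r * (cube (P a i) * cube (P a r))
    g i r = bin i r * (P a i * P a r * (P a i * P a i * slope a r + - (slope a i * (P a r * P a r))))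
    odd : ∀ i r → g r i ≡ - g i r
    odd i r = trans (cong (λ z → z * (P a r * P a i * (P a r * P a r * slope a i + - (slope a r * (P a i * P a i))))) (bin-sym r i))
      (eq (bin i r) (P a i) (P a r) (slope a i) (slope a r))
      where
      eq : ∀ b p q u v → b * (q * p * (q * q * u + - (v * (p * p)))) ≡ - (b * (p * q * (p * p * v + - (u * (q * q)))))
      eq = solve-∀
    neg² : ∀ y → - y * - y ≡ y * y
    neg² = solve-∀
    pointwise : ∀ i r → bin i r * (P a i * Π (sq (- y)) a i * (P a r * Π (sq y) a r)) ≡ f i r + y * g i r [mod M ]
    pointwise i r = ≈-trans
      (*-≈ˡ (bin i r) (*-≈ (*-≈ˡ (P a i) (Πsq-linearised (- y) a i (≈-trans (≡⇒≈ (neg² y)) e))) (*-≈ˡ (P a r) (Πsq-linearised y a r e))))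
      (≈-linear (- (bin i r * (P a i * P a r * (slope a i * slope a r)))) e (eq (bin i r) (P a i) (P a r) (slope a i) (slope a r) y))
      where
      eq : ∀ b p q u v y → b * (p * (p * p + - y * u) * (q * (q * q + y * v)))
        + - (b * (p * p * p * (q * q * q)) + y * (b * (p * q * (p * p * v + - (u * (q * q))))))
        ≡ - (b * (p * q * (u * v))) * (y * y + - 0ℤ)
      eq = solve-∀

  module _ {M : ℕ} (m d : ℕ) (a : ℤ) (3a-1≈-m : a + a + a + - 1ℤ ≡ - + m [mod M ]) where

    private
      n : ℕ
      n = m ℕ.+ d
      s y e : ℤ
      s = a + + n
      y = s * s
      e = a + - + d

    -- After Sears' transformation the parameter `3a - 1` may be replaced by `- m`, which kills the
    -- terms with `i > m`. The same congruence reflects the factors based at `2a + i` into products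
    -- that start at `a - d`; their first `d` factors do not depend on `i` and come out of the sum.
    4F3-truncated : 4F3 n a y ≡ σ n * (P e d * Π (sq y) e d) * paired m a y [mod M ]
    4F3-truncated = begin
      4F3 n a y
        ≈⟨ ≡⇒≈ (trans (sears n a y) (B≡S n (term (a + a + a + - 1ℤ)))) ⟩
      S (λ i r → bin i r * term (a + a + a + - 1ℤ) i r) n
        ≈⟨ S-≈ n (λ i r _ → *-≈ˡ (bin i r) (replace i r)) ⟩
      S (λ i r → bin i r * term (- + m) i r) n
        ≈⟨ ≡⇒≈ (S-truncate m d (λ i r → bin i r * term (- + m) i r) vanish) ⟩
      S (λ i r → bin i (r ℕ.+ d) * term (- + m) i (r ℕ.+ d)) m
        ≈⟨ S-≈ m pointwise ⟩
      S (λ i r → σ n * (P e d * Π (sq y) e d) * (bin i r * (P a i * Π (sq (- y)) a i * (P a r * Π (sq y) a r)))) m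
        ≈⟨ ≡⇒≈ (S-* m (σ n * (P e d * Π (sq y) e d)) (λ i r → bin i r * (P a i * Π (sq (- y)) a i * (P a r * Π (sq y) a r)))) ⟩
      σ n * (P e d * Π (sq y) e d) * paired m a y ∎
      where
      open ≈-Reasoning M
      term : ℤ → ℕ → ℕ → ℤ
      term x i r = σ i * P x i * P a i * P (a + s) i * P (a + a + + i) r * Π (sq y) (a + a + + i) r
      replace : ∀ i r → term (a + a + a + - 1ℤ) i r ≡ term (- + m) i r [mod M ]
      replace i r = *-≈ʳ (Π (sq y) (a + a + + i) r) (*-≈ʳ (P (a + a + + i) r) (*-≈ʳ (P (a + s) i) (*-≈ʳ (P a i) (*-≈ˡ (σ i) (P-≈ i 3a-1≈-m)))))
      vanish : ∀ i r → m ℕ.< i → bin i r * term (- + m) i r ≡ 0ℤ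
      vanish i r m<i = trans
        (cong (λ z → bin i r * (σ i * z * P a i * P (a + s) i * P (a + a + + i) r * Π (sq y) (a + a + + i) r)) (P-vanish-> m i m<i))
        (eq (bin i r) (σ i) (P a i) (P (a + s) i) (P (a + a + + i) r) (Π (sq y) (a + a + + i) r))
        where
        eq : ∀ b t v w x z → b * (t * 0ℤ * v * w * x * z) ≡ 0ℤ
        eq = solve-∀
      pointwise : ∀ i r → i ℕ.+ r ≡ m → bin i (r ℕ.+ d) * term (- + m) i (r ℕ.+ d)
        ≡ σ n * (P e d * Π (sq y) e d) * (bin i r * (P a i * Π (sq (- y)) a i * (P a r * Π (sq y) a r))) [mod M ]
      pointwise i r i+r≡m = begin
        bin i r′ * term (- + m) i r′
          ≈⟨ ≡⇒≈ (cong (λ z → bin i r′ * (σ i * z * P a i * P (a + s) i * P (a + a + + i) r′ * Π (sq y) (a + a + + i) r′)) (falling-bin m i r i+r≡m)) ⟩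
        bin i r′ * (σ i * (σ i * (bin i r * P 1ℤ i)) * P a i * P (a + s) i * P (a + a + + i) r′ * Π (sq y) (a + a + + i) r′)
          ≈⟨ ≡⇒≈ (eq₁ (bin i r′) (σ i) (bin i r) (P 1ℤ i) (P a i) (P (a + s) i) (P (a + a + + i) r′) (Π (sq y) (a + a + + i) r′)) ⟩
        σ i * bin i r * P a i * (σ i * (bin i r′ * P 1ℤ i) * P (a + s) i) * (P (a + a + + i) r′ * Π (sq y) (a + a + + i) r′)
          ≈⟨ *-≈ (≡⇒≈ (cong (λ z → σ i * bin i r * P a i * z) difference))
               (*-≈ (≈-trans (P-≈ r′ 2a+i≈x) (≡⇒≈ (trans (P-reflect x e r′ x+e+r′≡1) (cong (λ z → σ r′ * z) (split (λ z → z))))))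
                    (≈-trans (Πsq-≈ y r′ 2a+i≈x) (≡⇒≈ (trans (Πsq-reflect y x e r′ x+e+r′≡1) (split (sq y)))))) ⟩
        σ i * bin i r * P a i * Π (sq (- y)) a i * (σ r′ * (P e d * P a r) * (Π (sq y) e d * Π (sq y) a r))
          ≈⟨ ≡⇒≈ (eq₂ (σ i) (bin i r) (P a i) (Π (sq (- y)) a i) (σ r′) (P e d) (P a r) (Π (sq y) e d) (Π (sq y) a r)) ⟩
        σ i * σ r′ * (P e d * Π (sq y) e d) * (bin i r * (P a i * Π (sq (- y)) a i * (P a r * Π (sq y) a r)))
          ≈⟨ ≡⇒≈ (cong (λ z → z * (P e d * Π (sq y) e d) * (bin i r * (P a i * Π (sq (- y)) a i * (P a r * Π (sq y) a r))))
               (trans (sym (σ-+ i r′)) (cong σ i+r′≡n))) ⟩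
        σ n * (P e d * Π (sq y) e d) * (bin i r * (P a i * Π (sq (- y)) a i * (P a r * Π (sq y) a r))) ∎
        where
        r′ : ℕ
        r′ = r ℕ.+ d
        -- The congruent form of `2a + i` for which `x + e + r′ = 1` holds exactly, as reflection
        -- demands.
        x : ℤ
        x = 1ℤ + - + m + - a + + i
        i+r′≡n : i ℕ.+ r′ ≡ n
        i+r′≡n = trans (sym (ℕ.+-assoc i r d)) (cong (ℕ._+ d) i+r≡m)
        2a+i≈x : a + a + + i ≡ x [mod M ]
        2a+i≈x = ≈-linear 1ℤ 3a-1≈-m (eq a (+ i) (+ m))
          where
          eq : ∀ a i m → a + a + i + - (1ℤ + - m + - a + i) ≡ 1ℤ * (a + a + a + - 1ℤ + - - m)
          eq = solve-∀
        x+e+r′≡1 : x + e + + r′ ≡ 1ℤ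
        x+e+r′≡1 = trans (cong (λ z → 1ℤ + - + z + - a + + i + e + + r′) (sym i+r≡m)) (eq a (+ i) (+ r) (+ d))
          where
          eq : ∀ a i r d → 1ℤ + - (i + r) + - a + i + (a + - d) + (r + d) ≡ 1ℤ
          eq = solve-∀
        split : ∀ φ → Π φ e r′ ≡ Π φ e d * Π φ a r
        split φ = trans (cong (Π φ e) (ℕ.+-comm r d)) (trans (Π-+ φ e d r) (cong (λ z → Π φ e d * Π φ z r) (eq a (+ d))))
          where
          eq : ∀ a d → a + - d + d ≡ a
          eq = solve-∀
        -- The binomial coefficient of `n` restores `(- n)_i = (a - s)_i`. Its product with
        -- `(a + s)_i` consists of factors `x² - s²`, the origin of the parameter `- y`.
        difference : σ i * (bin i r′ * P 1ℤ i) * P (a + s) i ≡ Π (sq (- y)) a i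
        difference = trans (cong (λ z → z * P (a + s) i) (trans (sym (falling-bin n i r′ i+r′≡n)) (cong (λ z → P z i) (eq a (+ n)))))
          (sym (Πsq-difference s a i))
          where
          eq : ∀ a n → - n ≡ a + - (a + n)
          eq = solve-∀
        eq₁ : ∀ b s c f p u v w → b * (s * (s * (c * f)) * p * u * v * w) ≡ s * c * p * (s * (b * f) * u) * (v * w)
        eq₁ = solve-∀
        eq₂ : ∀ s b p q t k v l w → s * b * p * q * (t * (k * v) * (l * w)) ≡ s * t * (k * l) * (b * (p * q * (v * w)))
        eq₂ = solve-∀

  -- The Gamma function on integers modulo p⁵

  module GammaModulo (p : ℕ) (p-prime : Prime p) (7≤p : 7 ℕ.≤ p) where
    open PAdic p p-prime using (residue; residue≈; module MoritaGamma)
    open MoritaGamma (≥7⇒≢2 7≤p) using (Γℕ; Γℕ-cong; p∤?)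
    open PrimePower p p-prime
    open Deformation p p-prime

    Γℕ-append : ∀ k → Γℕ (suc k) ≡ - (+ product (filter p∤? (k ∷ [])) * Γℕ k)
    Γℕ-append k = trans
      (cong (λ z → -1ℤ * (-1ℤ ℤ.^ k) * z) (trans
        (cong +_ (trans (cong (product ∘ filter p∤?) (sym (upTo-∷ʳ k)))
          (trans (cong product (filter-++ p∤? (upTo k) (k ∷ []))) (product-++ (filter p∤? (upTo k)) (filter p∤? (k ∷ []))))))
        (ℤ.pos-* (product (filter p∤? (upTo k))) (product (filter p∤? (k ∷ []))))))
      (eq (-1ℤ ℤ.^ k) (+ product (filter p∤? (upTo k))) (+ product (filter p∤? (k ∷ []))))
      where
      eq : ∀ x y z → - 1ℤ * x * (y * z) ≡ - (z * (x * y))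
      eq = solve-∀

    Γℕ-suc-unit : ∀ k → ¬ (p ℕ∣.∣ k) → Γℕ (suc k) ≡ - (+ k * Γℕ k)
    Γℕ-suc-unit k p∤k = trans (Γℕ-append k) (cong (λ z → - (+ z * Γℕ k))
      (trans (cong product (filter-accept p∤? p∤k)) (ℕ.*-identityʳ k)))

    Γℕ-suc-multiple : ∀ k → p ℕ∣.∣ k → Γℕ (suc k) ≡ - Γℕ k
    Γℕ-suc-multiple k p∣k = trans (Γℕ-append k) (cong -_
      (trans (cong (λ zs → + product zs * Γℕ k) (filter-reject p∤? (λ p∤k → p∤k p∣k))) (ℤ.*-identityˡ (Γℕ k))))

    abstract
      -- Morita's function modulo `p⁵` at an integer argument. Passing to the residue makes negative
      -- arguments natural numbers, where the defining product applies.
      G : ℤ → ℤ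
      G z = Γℕ (residue 5 z)

      G-def : ∀ z → G z ≡ Γℕ (residue 5 z)
      G-def z = refl

      G-≈ : ∀ {x y} → x ≡ y [mod p ℕ.^ 5 ] → G x ≡ G y [mod p ℕ.^ 5 ]
      G-≈ {x} {y} e = Γℕ-cong 5 (residue 5 x) (residue 5 y) (≈-trans (residue≈ 5 x) (≈-trans e (≈-sym (residue≈ 5 y))))

      G-ℕ : ∀ k → G (+ k) ≡ Γℕ k [mod p ℕ.^ 5 ]
      G-ℕ k = Γℕ-cong 5 (residue 5 (+ k)) k (residue≈ 5 (+ k))

    residue≈₁ : ∀ z → + residue 5 z ≡ z [mod p ℕ.^ 1 ]
    residue≈₁ z = weaken 4 {1} (residue≈ 5 z)

    G-suc : ∀ z → G (z + 1ℤ) ≡ Γℕ (suc (residue 5 z)) [mod p ℕ.^ 5 ]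
    G-suc z = ≈-trans (G-≈ (≈-trans (≡⇒≈ (ℤ.+-comm z 1ℤ)) (+-≈ (≈-refl {a = 1ℤ}) (≈-sym (residue≈ 5 z))))) (G-ℕ (suc (residue 5 z)))

    G-unit : ∀ z → Unit z → G (z + 1ℤ) ≡ - (z * G z) [mod p ℕ.^ 5 ]
    G-unit z u = ≈-trans (G-suc z) (≈-trans
      (≡⇒≈ (Γℕ-suc-unit (residue 5 z) (λ d → unit-∤ u (∣-resp (modp⁺ (≈-sym (residue≈₁ z))) (∣ᵤ⇒∣ d)))))
      (-‿≈ (*-≈ (residue≈ 5 z) (≡⇒≈ (sym (G-def z))))))

    G-multiple : ∀ z → + p ∣ z → G (z + 1ℤ) ≡ - G z [mod p ℕ.^ 5 ]
    G-multiple z d = ≈-trans (G-suc z) (≡⇒≈ (trans (Γℕ-suc-multiple (residue 5 z) (∣⇒∣ᵤ (∣-resp (modp⁺ (residue≈₁ z)) d))) (cong -_ (sym (G-def z)))))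

    G-0 : G 0ℤ ≡ 1ℤ [mod p ℕ.^ 5 ]
    G-0 = G-ℕ 0

    G-run : ∀ z k → (∀ t → t ℕ.< k → Unit (z + + t)) → G (z + + k) ≡ σ k * P z k * G z [mod p ℕ.^ 5 ]
    G-run z zero    u = ≈-trans (≡⇒≈ (cong G (ℤ.+-identityʳ z))) (≡⇒≈ (sym (trans (cong (λ x → x * G z) (ℤ.*-identityˡ 1ℤ)) (ℤ.*-identityˡ (G z)))))
    G-run z (suc k) u = ≈-trans (≡⇒≈ (cong G (swap z (+ k)))) (≈-trans (G-unit (z + + k) (u k ℕ.≤-refl))
      (≈-trans (-‿≈ (*-≈ˡ (z + + k) (G-run z k λ t t<k → u t (ℕ.m<n⇒m<1+n t<k)))) (≡⇒≈ (eq (z + + k) (σ k) (P z k) (G z)))))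
      where
      swap : ∀ z k → z + (1ℤ + k) ≡ z + k + 1ℤ
      swap = solve-∀
      eq : ∀ x s q g → - (x * (s * q * g)) ≡ - s * (q * x) * g
      eq = solve-∀

    reflection : ℤ → ℤ
    reflection z = G z * G (1ℤ + - z)

    reflection-≈ : ∀ {x y} → x ≡ y [mod p ℕ.^ 5 ] → reflection x ≡ reflection y [mod p ℕ.^ 5 ]
    reflection-≈ e = *-≈ (G-≈ e) (G-≈ (+-≈ (≈-refl {a = 1ℤ}) (-‿≈ e)))

    private
      lower : ∀ z → 1ℤ + - (z + 1ℤ) ≡ - z
      lower = solve-∀

    reflection-unit : ∀ z → Unit z → reflection (z + 1ℤ) ≡ - reflection z [mod p ℕ.^ 5 ]
    reflection-unit z u = ≈-trans (*-≈ (G-unit z u) (≡⇒≈ (cong G (lower z))))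
      (≈-trans (≡⇒≈ (eq z (G z) (G (- z)))) (-‿≈ (*-≈ˡ (G z) (≈-sym (≈-trans (≡⇒≈ (cong G (ℤ.+-comm 1ℤ (- z)))) (G-unit (- z) (unit-neg u)))))))
      where
      eq : ∀ z g h → - (z * g) * h ≡ - (g * - (- z * h))
      eq = solve-∀

    reflection-multiple : ∀ z → + p ∣ z → reflection (z + 1ℤ) ≡ reflection z [mod p ℕ.^ 5 ]
    reflection-multiple z d = ≈-trans (*-≈ (G-multiple z d) (≡⇒≈ (cong G (lower z))))
      (≈-trans (≡⇒≈ (eq (G z) (G (- z)))) (*-≈ˡ (G z) (≈-sym (≈-trans (≡⇒≈ (cong G (ℤ.+-comm 1ℤ (- z)))) (G-multiple (- z) (ℤ∣.∣m⇒∣-m d))))))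
      where
      eq : ∀ g h → - g * h ≡ g * - h
      eq = solve-∀

    reflection-run : ∀ z k → (∀ t → t ℕ.< k → Unit (z + + t)) → reflection (z + + k) ≡ σ k * reflection z [mod p ℕ.^ 5 ]
    reflection-run z zero    u = ≡⇒≈ (trans (cong reflection (ℤ.+-identityʳ z)) (sym (ℤ.*-identityˡ (reflection z))))
    reflection-run z (suc k) u = ≈-trans (≡⇒≈ (cong reflection (swap z (+ k)))) (≈-trans (reflection-unit (z + + k) (u k ℕ.≤-refl))
      (≈-trans (-‿≈ (reflection-run z k λ t t<k → u t (ℕ.m<n⇒m<1+n t<k))) (≡⇒≈ (ℤ.neg-distribˡ-* (σ k) (reflection z)))))
      where
      swap : ∀ z k → z + (1ℤ + k) ≡ z + k + 1ℤ
      swap = solve-∀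

    reflection-0 : reflection 0ℤ ≡ -1ℤ [mod p ℕ.^ 5 ]
    reflection-0 = *-≈ G-0 (≈-trans (G-multiple 0ℤ (divides 0ℤ refl)) (-‿≈ G-0))

    -- A step past a unit changes the sign of `reflection`, a step past a multiple of `p` keeps it;
    -- either way the square is unchanged.
    reflection²-ℕ : ∀ k → reflection (+ k) * reflection (+ k) ≡ 1ℤ [mod p ℕ.^ 5 ]
    reflection²-ℕ zero    = *-≈ reflection-0 reflection-0
    reflection²-ℕ (suc k) = ≈-trans (≡⇒≈ (cong (λ z → reflection z * reflection z) (ℤ.+-comm 1ℤ (+ k)))) (step (+ p ℤ∣.∣? + k))
      where
      neg² : ∀ x → - x * - x ≡ x * x
      neg² = solve-∀
      step : Dec (+ p ∣ + k) → reflection (+ k + 1ℤ) * reflection (+ k + 1ℤ) ≡ 1ℤ [mod p ℕ.^ 5 ]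
      step (yes d) = ≈-trans (*-≈ (reflection-multiple (+ k) d) (reflection-multiple (+ k) d)) (reflection²-ℕ k)
      step (no ∤k) = ≈-trans (*-≈ r r) (≈-trans (≡⇒≈ (neg² (reflection (+ k)))) (reflection²-ℕ k))
        where
        r : reflection (+ k + 1ℤ) ≡ - reflection (+ k) [mod p ℕ.^ 5 ]
        r = reflection-unit (+ k) (∤-unit ∤k)

    -- The product `G z * G (1 - z)` is its own inverse by the reflection formula, so each of its
    -- factors is a unit.
    unit-G : ∀ z → Unit (G z)
    unit-G z = unit-factorˡ (G z) (G (1ℤ + - z)) (unit-by (reflection z)
      (≈-trans (*-≈ (reflection-≈ (≈-sym (residue≈ 5 z))) (reflection-≈ (≈-sym (residue≈ 5 z)))) (reflection²-ℕ (residue 5 z))))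

    module _ {h : ℤ} (p∣h : + p ∣ h) where

      private
        N D : ℤ → ℤ
        N z = cube (G z) * cube (G z) * (G (z + - (h + h)) * G (z + (h + h)))
        D z = fourth (G (z + h) * G (z + - h))

        h≈0 : h ≡ 0ℤ [mod p ℕ.^ 1 ]
        h≈0 = ∣⇒≈0₁ p∣h

        N-≈ : ∀ {x y} → x ≡ y [mod p ℕ.^ 5 ] → N x ≡ N y [mod p ℕ.^ 5 ]
        N-≈ e = *-≈ (*-≈ (cube-≈ (G-≈ e)) (cube-≈ (G-≈ e))) (*-≈ (G-≈ (+-≈ e (≈-refl {a = - (h + h)}))) (G-≈ (+-≈ e (≈-refl {a = h + h}))))

        D-≈ : ∀ {x y} → x ≡ y [mod p ℕ.^ 5 ] → D x ≡ D y [mod p ℕ.^ 5 ]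
        D-≈ e = fourth-≈ (*-≈ (G-≈ (+-≈ e (≈-refl {a = h}))) (G-≈ (+-≈ e (≈-refl {a = - h}))))

        swap : ∀ z k → z + 1ℤ + k ≡ z + k + 1ℤ
        swap = solve-∀

        shift-unit : ∀ z k → k ≡ 0ℤ [mod p ℕ.^ 1 ] → Unit z → G (z + 1ℤ + k) ≡ - ((z + k) * G (z + k)) [mod p ℕ.^ 5 ]
        shift-unit z k k≈0 u = ≈-trans (≡⇒≈ (cong G (swap z k))) (G-unit (z + k)
          (unit-resp (≈-trans (≡⇒≈ (sym (ℤ.+-identityʳ z))) (+-≈ (≈-refl {a = z}) (≈-sym k≈0))) u))

        shift-multiple : ∀ z k → + p ∣ k → + p ∣ z → G (z + 1ℤ + k) ≡ - G (z + k) [mod p ℕ.^ 5 ]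
        shift-multiple z k dk dz = ≈-trans (≡⇒≈ (cong G (swap z k))) (G-multiple (z + k) (ℤ∣.∣m∣n⇒∣m+n dz dk))

        p∣2h : + p ∣ h + h
        p∣2h = ℤ∣.∣m∣n⇒∣m+n p∣h p∣h

        -- z⁶(z² - 4h²) ≡ (z² - h²)⁴ (mod h⁴), so N / D is invariant under z ↦ z + 1.
        step : ∀ z → Dec (+ p ∣ z) → N z ≡ D z [mod p ℕ.^ 4 ] → N (z + 1ℤ) ≡ D (z + 1ℤ) [mod p ℕ.^ 4 ]
        step z (yes d) e = begin
          N (z + 1ℤ)
            ≈⟨ weaken 1 {4} (*-≈ (*-≈ (cube-≈ (G-multiple z d)) (cube-≈ (G-multiple z d)))
                 (*-≈ (shift-multiple z (- (h + h)) (ℤ∣.∣m⇒∣-m p∣2h) d) (shift-multiple z (h + h) p∣2h d))) ⟩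
          cube (- G z) * cube (- G z) * (- G (z + - (h + h)) * - G (z + (h + h)))
            ≈⟨ ≡⇒≈ (eq₁ (G z) (G (z + - (h + h))) (G (z + (h + h)))) ⟩
          N z
            ≈⟨ e ⟩
          D z
            ≈⟨ ≡⇒≈ (eq₂ (G (z + h)) (G (z + - h))) ⟩
          fourth (- G (z + h) * - G (z + - h))
            ≈⟨ weaken 1 {4} (≈-sym (fourth-≈ (*-≈ (shift-multiple z h p∣h d) (shift-multiple z (- h) (ℤ∣.∣m⇒∣-m p∣h) d)))) ⟩
          D (z + 1ℤ) ∎
          where
          open ≈-Reasoning (p ℕ.^ 4)
          eq₁ : ∀ a b c → (- a * - a * - a) * (- a * - a * - a) * (- b * - c) ≡ (a * a * a) * (a * a * a) * (b * c)
          eq₁ = solve-∀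
          eq₂ : ∀ a b → (a * b) * (a * b) * (a * b) * (a * b) ≡ (- a * - b) * (- a * - b) * (- a * - b) * (- a * - b)
          eq₂ = solve-∀
        step z (no ∤z) e = begin
          N (z + 1ℤ)
            ≈⟨ weaken 1 {4} (*-≈ (*-≈ (cube-≈ (G-unit z u)) (cube-≈ (G-unit z u)))
                 (*-≈ (shift-unit z (- (h + h)) (-‿≈ 2h≈0) u) (shift-unit z (h + h) 2h≈0 u))) ⟩
          cube (- (z * G z)) * cube (- (z * G z)) * (- ((z + - (h + h)) * G (z + - (h + h))) * - ((z + (h + h)) * G (z + (h + h))))
            ≈⟨ ≡⇒≈ (eq₁ z h (G z) (G (z + - (h + h))) (G (z + (h + h)))) ⟩
          cube z * cube z * (z * z + - (+ 4 * (h * h))) * N z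
            ≈⟨ *-≈ key e ⟩
          fourth (z * z + - (h * h)) * D z
            ≈⟨ ≡⇒≈ (eq₃ z h (G (z + h)) (G (z + - h))) ⟩
          fourth (- ((z + h) * G (z + h)) * - ((z + - h) * G (z + - h)))
            ≈⟨ weaken 1 {4} (≈-sym (fourth-≈ (*-≈ (shift-unit z h h≈0 u) (shift-unit z (- h) (-‿≈ h≈0) u)))) ⟩
          D (z + 1ℤ) ∎
          where
          open ≈-Reasoning (p ℕ.^ 4)
          u : Unit z
          u = ∤-unit ∤z
          2h≈0 : h + h ≡ 0ℤ [mod p ℕ.^ 1 ]
          2h≈0 = +-≈ h≈0 h≈0
          eq₁ : ∀ z h a b c → let w = - (z * a) in
            (w * w * w) * (w * w * w) * (- ((z + - (h + h)) * b) * - ((z + (h + h)) * c))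
            ≡ (z * z * z) * (z * z * z) * (z * z + - (+ 4 * (h * h))) * ((a * a * a) * (a * a * a) * (b * c))
          eq₁ = solve-∀
          eq₂ : ∀ z h → (z * z * z) * (z * z * z) * (z * z + - (+ 4 * (h * h)))
              + - ((z * z + - (h * h)) * (z * z + - (h * h)) * (z * z + - (h * h)) * (z * z + - (h * h)))
            ≡ - (+ 6 * (z * z * z * z) + - (+ 4 * (z * z * (h * h))) + h * h * h * h) * (h * h * h * h + - 0ℤ)
          eq₂ = solve-∀
          eq₃ : ∀ z h a b → let w = z * z + - (h * h) ; x = a * b ; v = - ((z + h) * a) * - ((z + - h) * b) in
            (w * w * w * w) * (x * x * x * x) ≡ v * v * v * v
          eq₃ = solve-∀
          key : cube z * cube z * (z * z + - (+ 4 * (h * h))) ≡ fourth (z * z + - (h * h)) [mod p ℕ.^ 4 ]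
          key = ≈-linear (- (+ 6 * fourth z + - (+ 4 * (z * z * (h * h))) + fourth h)) (fourth-0 p∣h) (eq₂ z h)

      -- The two hypotheses are what the identity needs at `z = 0`. Both sides depend only on `z`
      -- modulo `p⁵`, so induction over natural representatives reaches every integer.
      multiplicative-difference : G h * G (- h) ≡ 1ℤ [mod p ℕ.^ 5 ] → G (h + h) * G (- (h + h)) ≡ 1ℤ [mod p ℕ.^ 5 ] →
        ∀ z → cube (G z) * cube (G z) * (G (z + - (h + h)) * G (z + (h + h))) ≡ fourth (G (z + h) * G (z + - h)) [mod p ℕ.^ 4 ]
      multiplicative-difference e₁ e₂ z = ≈-trans (weaken 1 {4} (N-≈ (≈-sym (residue≈ 5 z))))
        (≈-trans (natural (residue 5 z)) (weaken 1 {4} (D-≈ (residue≈ 5 z))))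
        where
        G0³ : cube (G 0ℤ) ≡ 1ℤ [mod p ℕ.^ 5 ]
        G0³ = *-≈ (*-≈ G-0 G-0) G-0
        natural : ∀ k → N (+ k) ≡ D (+ k) [mod p ℕ.^ 4 ]
        natural zero = weaken 1 {4} (≈-trans
          (*-≈ (*-≈ G0³ G0³) (≈-trans (≡⇒≈ (trans (cong₂ (λ x y → G x * G y) (ℤ.+-identityˡ (- (h + h))) (ℤ.+-identityˡ (h + h))) (ℤ.*-comm (G (- (h + h))) (G (h + h))))) e₂))
          (≈-sym (fourth-≈ (≈-trans (≡⇒≈ (cong₂ (λ x y → G x * G y) (ℤ.+-identityˡ h) (ℤ.+-identityˡ (- h)))) e₁))))
        natural (suc k) = ≈-trans (≡⇒≈ (cong N (ℤ.+-comm 1ℤ (+ k)))) (≈-trans (step (+ k) (+ p ℤ∣.∣? + k) (natural k)) (≡⇒≈ (cong D (ℤ.+-comm (+ k) 1ℤ))))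

  -- Evaluation of the constant factor by Gamma values

  module GammaQuotient
    (p : ℕ) (p-prime : Prime p) (7≤p : 7 ℕ.≤ p) (m d w : ℕ)
    (p≡ : p ≡ suc (m ℕ.+ m ℕ.+ (d ℕ.+ d ℕ.+ d))) (even : σ d ≡ 1ℤ)
    (a : ℤ) (s≡pw : a + + (m ℕ.+ d) ≡ + (p ℕ.* w))
    (3s≡p : a + + (m ℕ.+ d) + (a + + (m ℕ.+ d)) + (a + + (m ℕ.+ d)) ≡ + p [mod p ℕ.^ 5 ])
    where

    open PrimePower p p-prime
    open Deformation p p-prime
    open GammaModulo p p-prime 7≤p

    n : ℕ
    n = m ℕ.+ d

    s y e : ℤ
    s = a + + n
    y = s * s
    e = a + - + d

    p∣s : + p ∣ s
    p∣s = divides (+ w) (trans s≡pw (trans (cong +_ (ℕ.*-comm p w)) (ℤ.pos-* w p)))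

    p∣2s : + p ∣ s + s
    p∣2s = ℤ∣.∣m∣n⇒∣m+n p∣s p∣s

    +p≡ : + p ≡ 1ℤ + (+ m + + m + (+ d + + d + + d))
    +p≡ = cong +_ p≡

    n+n<p : n ℕ.+ n ℕ.< p
    n+n<p = ℕ.≤-trans (ℕ.s≤s (ℕ.m≤m+n (n ℕ.+ n) d)) (ℕ.≤-reflexive (sym (trans p≡ (eq m d))))
      where
      eq : ∀ m d → suc (m ℕ.+ m ℕ.+ (d ℕ.+ d ℕ.+ d)) ≡ suc (m ℕ.+ d ℕ.+ (m ℕ.+ d) ℕ.+ d)
      eq = ℕ-Solver.solve-∀

    n<p : n ℕ.< p
    n<p = ℕ.≤-<-trans (ℕ.m≤m+n n n) n+n<p

    n+d<p : n ℕ.+ d ℕ.< p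
    n+d<p = ℕ.≤-<-trans (ℕ.+-monoʳ-≤ n (ℕ.m≤n+m d m)) n+n<p

    unit-below : ∀ x N t → x ≡ - + N [mod p ℕ.^ 1 ] → t ℕ.< N → N ℕ.< p → Unit (x + + t)
    unit-below x N t x≈-N t<N N<p = unit-resp (≈-sym (≈-trans (+-≈ x≈-N (≈-refl {a = + t})) (≡⇒≈ (trans
        (cong (λ z → - + z + + t) (sym (ℕ.m+[n∸m]≡n (ℕ.<⇒≤ t<N)))) (eq (+ t) (+ (N ℕ.∸ t)))))))
      (unit-neg (unit-ℕ (ℕ.≤-<-trans (ℕ.m∸n≤m N t) N<p) (ℕ.m>n⇒m∸n≢0 t<N)))
      where
      eq : ∀ t k → - (t + k) + t ≡ - k
      eq = solve-∀

    below : ∀ x N → + p ∣ x + + N → x ≡ - + N [mod p ℕ.^ 1 ]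
    below x N d = ≈-linear 1ℤ (∣⇒≈0₁ d) (eq x (+ N))
      where
      eq : ∀ x n → x + - - n ≡ 1ℤ * (x + n + - 0ℤ)
      eq = solve-∀

    run-units : ∀ x N k → + p ∣ x + + N → N ℕ.< p → k ℕ.≤ N → ∀ t → t ℕ.< k → Unit (x + + t)
    run-units x N k d N<p k≤N t t<k = unit-below x N t (below x N d) (ℕ.<-≤-trans t<k k≤N) N<p

    3a-1≈-m : a + a + a + - 1ℤ ≡ - + m [mod p ℕ.^ 5 ]
    3a-1≈-m = ≈-linear 1ℤ 3s≡p (trans (eq a (+ m) (+ d)) (cong (λ z → 1ℤ * (s + s + s + - z)) (sym +p≡)))
      where
      eq : ∀ a m d → a + a + a + - 1ℤ + - - m
        ≡ 1ℤ * (a + (m + d) + (a + (m + d)) + (a + (m + d)) + - (1ℤ + (m + m + (d + d + d))))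
      eq = solve-∀

    -- Between consecutive multiples of `p` there is one step past a multiple of `p`, which keeps
    -- the sign, and `p - 1` steps past units. As `p - 1 = 2m + 3d` is even, the value at 0 is
    -- preserved.
    reflection-multiple-of-p : ∀ j → reflection (+ (p ℕ.* j)) ≡ -1ℤ [mod p ℕ.^ 5 ]
    reflection-multiple-of-p zero    = ≈-trans (≡⇒≈ (cong (λ z → reflection (+ z)) (ℕ.*-zeroʳ p))) reflection-0
    reflection-multiple-of-p (suc j) = begin
      reflection (+ (p ℕ.* suc j))
        ≈⟨ ≡⇒≈ (cong reflection (trans (cong +_ (trans (ℕ.*-suc p j) (cong (ℕ._+ p ℕ.* j) p≡))) (eq (+ (p ℕ.* j)) (+ q)))) ⟩
      reflection (+ (p ℕ.* j) + 1ℤ + + q)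
        ≈⟨ reflection-run (+ (p ℕ.* j) + 1ℤ) q units ⟩
      σ q * reflection (+ (p ℕ.* j) + 1ℤ)
        ≈⟨ *-≈ (≡⇒≈ σq) (reflection-multiple (+ (p ℕ.* j)) p∣pj) ⟩
      1ℤ * reflection (+ (p ℕ.* j))
        ≈⟨ ≡⇒≈ (ℤ.*-identityˡ (reflection (+ (p ℕ.* j)))) ⟩
      reflection (+ (p ℕ.* j))
        ≈⟨ reflection-multiple-of-p j ⟩
      -1ℤ ∎
      where
      open ≈-Reasoning (p ℕ.^ 5)
      q : ℕ
      q = m ℕ.+ m ℕ.+ (d ℕ.+ d ℕ.+ d)
      eq : ∀ x q → 1ℤ + q + x ≡ x + 1ℤ + q
      eq = solve-∀
      p∣pj : + p ∣ + (p ℕ.* j)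
      p∣pj = divides (+ j) (trans (cong +_ (ℕ.*-comm p j)) (ℤ.pos-* j p))
      units : ∀ t → t ℕ.< q → Unit (+ (p ℕ.* j) + 1ℤ + + t)
      units t t<q = unit-resp (≈-linear (- 1ℤ) (∣⇒≈0₁ p∣pj) (eq₁ (+ (p ℕ.* j)) (+ t)))
        (unit-ℕ {suc t} (ℕ.≤-trans (ℕ.s≤s t<q) (ℕ.≤-reflexive (sym p≡))) (λ ()))
        where
        eq₁ : ∀ x t → 1ℤ + t + - (x + 1ℤ + t) ≡ - 1ℤ * (x + - 0ℤ)
        eq₁ = solve-∀
      σq : σ q ≡ 1ℤ
      σq = trans (σ-+ (m ℕ.+ m) (d ℕ.+ d ℕ.+ d)) (cong₂ _*_ (trans (σ-+ m m) (σ² m))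
        (trans (σ-+ (d ℕ.+ d) d) (cong₂ _*_ (trans (σ-+ d d) (σ² d)) even)))

    -- For `p ∣ h` the functional equation reads `G (1 - h) = - G (- h)`, which converts the
    -- reflection formula at `h` into this form.
    opposite : ∀ {h} → + p ∣ h → reflection h ≡ -1ℤ [mod p ℕ.^ 5 ] → G h * G (- h) ≡ 1ℤ [mod p ℕ.^ 5 ]
    opposite {h} d e = ≈-trans (*-≈ˡ (G h) (≈-trans (≡⇒≈ (double-neg (G (- h)))) (-‿≈ (≈-sym
      (≈-trans (≡⇒≈ (cong G (ℤ.+-comm 1ℤ (- h)))) (G-multiple (- h) (ℤ∣.∣m⇒∣-m d)))))))
      (≈-trans (≡⇒≈ (sym (ℤ.neg-distribʳ-* (G h) (G (1ℤ + - h))))) (-‿≈ e))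
      where
      double-neg : ∀ x → x ≡ - - x
      double-neg = solve-∀

    reflection-s : reflection s ≡ -1ℤ [mod p ℕ.^ 5 ]
    reflection-s = ≈-trans (≡⇒≈ (cong reflection s≡pw)) (reflection-multiple-of-p w)

    reflection-2s : reflection (s + s) ≡ -1ℤ [mod p ℕ.^ 5 ]
    reflection-2s = ≈-trans (≡⇒≈ (cong reflection (trans (cong₂ _+_ s≡pw s≡pw) (cong +_ (sym (ℕ.*-distribˡ-+ p w w))))))
      (reflection-multiple-of-p (w ℕ.+ w))

    reflection-below : ∀ x N → N ℕ.< p → + p ∣ x + + N → reflection (x + + N) ≡ -1ℤ [mod p ℕ.^ 5 ] →
      reflection x ≡ - σ N [mod p ℕ.^ 5 ]
    reflection-below x N N<p d r = ≈-linear₂ (- σ N) (σ N) (reflection-run x N (run-units x N N d N<p ℕ.≤-refl)) r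
      (trans (cong (λ z → z + - - σ N) (trans (sym (ℤ.*-identityˡ (reflection x))) (cong (λ z → z * reflection x) (sym (σ² N))))) (eq (σ N) (reflection x) (reflection (x + + N))))
      where
      eq : ∀ s x z → s * s * x + - - s ≡ - s * (z + - (s * x)) + s * (z + - - 1ℤ)
      eq = solve-∀

    private
      -- All Gamma values needed for `K` and the denominators lie on the progression `a + js` with
      -- `j` from -2 to 2, the five points of the fourth central difference.
      ε g₀ g₊ g₋ h₊ h₋ F F₁ S₁ K A : ℤ
      ε = - σ n
      g₀ = G a
      g₊ = G (a + s)
      g₋ = G (a + - s)
      h₊ = G (a + (s + s))
      h₋ = G (a + - (s + s))
      F = P 1ℤ n
      F₁ = P (1ℤ + - s) n * P (1ℤ + s) n
      S₁ = Π (sq y) 1ℤ n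
      K = P e d * Π (sq y) e d
      A = P a m

    -- Here `a - s = - n`, and the run from `- n` up to 0 collects exactly `n!`.
    factorial : F * g₋ ≡ 1ℤ [mod p ℕ.^ 5 ]
    factorial = ≈-trans (≡⇒≈ (trans (cong (λ z → F * G z) (eq a (+ n))) (sym signs))) (≈-trans (≈-sym (G-run (- + n) n
      (run-units (- + n) n n (subst (+ p ∣_) (sym (ℤ.+-inverseˡ (+ n))) (divides 0ℤ refl)) n<p ℕ.≤-refl)))
      (≈-trans (≡⇒≈ (cong G (ℤ.+-inverseˡ (+ n)))) G-0))
      where
      eq : ∀ a n → a + - (a + n) ≡ - n
      eq = solve-∀
      refl-eq : ∀ n → - n + 1ℤ + n ≡ 1ℤ
      refl-eq = solve-∀
      signs : σ n * P (- + n) n * G (- + n) ≡ F * G (- + n)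
      signs = cong (λ z → z * G (- + n)) (trans (cong (λ z → σ n * z) (P-reflect (- + n) 1ℤ n (refl-eq (+ n))))
        (trans (sym (ℤ.*-assoc (σ n) (σ n) F)) (trans (cong (λ z → z * F) (σ² n)) (ℤ.*-identityˡ F))))

    run-down : ∀ x z → + p ∣ x + + n → x + z + + n ≡ 1ℤ → P z n * G x ≡ G (x + + n) [mod p ℕ.^ 5 ]
    run-down x z d x+z+n≡1 = ≈-trans (≡⇒≈ (sym (cong (λ v → v * G x) (trans (cong (λ v → σ n * v) (P-reflect x z n x+z+n≡1))
        (trans (sym (ℤ.*-assoc (σ n) (σ n) (P z n))) (trans (cong (λ v → v * P z n) (σ² n)) (ℤ.*-identityˡ (P z n))))))))
      (≈-sym (G-run x n (run-units x n n d n<p ℕ.≤-refl)))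

    -- The runs from `a` up to `s` and from `a - 2s` up to `- s` collect the two products; the end
    -- values `G s` and `G (- s)` cancel by `opposite`.
    factorial-s : F₁ * (g₀ * h₋) ≡ 1ℤ [mod p ℕ.^ 5 ]
    factorial-s = begin
      F₁ * (g₀ * h₋)
        ≈⟨ ≡⇒≈ (eq₁ (P (1ℤ + - s) n) (P (1ℤ + s) n) g₀ h₋) ⟩
      P (1ℤ + - s) n * g₀ * (P (1ℤ + s) n * h₋)
        ≈⟨ *-≈ (run-down a (1ℤ + - s) p∣s (eq₂ a (+ n)))
               (run-down (a + - (s + s)) (1ℤ + s) (subst (+ p ∣_) (sym (eq₃ a (+ n))) (ℤ∣.∣m⇒∣-m p∣s)) (eq₄ a (+ n))) ⟩
      G s * G (a + - (s + s) + + n)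
        ≈⟨ ≡⇒≈ (cong (λ z → G s * G z) (eq₃ a (+ n))) ⟩
      G s * G (- s)
        ≈⟨ opposite p∣s reflection-s ⟩
      1ℤ ∎
      where
      open ≈-Reasoning (p ℕ.^ 5)
      eq₁ : ∀ x z g h → x * z * (g * h) ≡ x * g * (z * h)
      eq₁ = solve-∀
      eq₂ : ∀ a n → a + (1ℤ + - (a + n)) + n ≡ 1ℤ
      eq₂ = solve-∀
      eq₃ : ∀ a n → a + - (a + n + (a + n)) + n ≡ - (a + n)
      eq₃ = solve-∀
      eq₄ : ∀ a n → a + - (a + n + (a + n)) + (1ℤ + (a + n)) + n ≡ 1ℤ
      eq₄ = solve-∀

    s⁴≈0 : fourth s ≡ 0ℤ [mod p ℕ.^ 4 ]
    s⁴≈0 = fourth-0 p∣s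

    quartic-product : ∀ x k → P (x + - s) k * P (x + s) k * Π (sq y) x k ≡ fourth (P x k) [mod p ℕ.^ 4 ]
    quartic-product x k = ≈-trans (≡⇒≈ (sym (Π-quartic-factors s x (x + - s) (x + s) k refl refl)))
      (≈-trans (Πquartic≈₄ s⁴≈0 x k) (≡⇒≈ (Π-quartic-0 x k)))

    -- P x d is ± Γ(x + d) / Γ(x), and Γ(x) is reflected to Γ(z).
    middle : ∀ x z v → z ≡ 1ℤ + - x [mod p ℕ.^ 5 ] → v ≡ x + + d → + p ∣ x + + (n ℕ.+ d) →
      reflection (x + + (n ℕ.+ d)) ≡ -1ℤ [mod p ℕ.^ 5 ] → P x d ≡ ε * (G v * G z) [mod p ℕ.^ 5 ]
    middle x z _ z≈1-x refl div r = ≈-sym (begin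
      ε * (G (x + + d) * G z)
        ≈⟨ *-≈ˡ ε (*-≈ (≈-trans (G-run x d (run-units x (n ℕ.+ d) d div n+d<p (ℕ.m≤n+m d n)))
             (≡⇒≈ (cong (λ t → t * P x d * G x) even))) (G-≈ z≈1-x)) ⟩
      ε * (1ℤ * P x d * G x * G (1ℤ + - x))
        ≈⟨ ≡⇒≈ (eq₁ ε (P x d) (G x) (G (1ℤ + - x))) ⟩
      ε * P x d * reflection x
        ≈⟨ *-≈ˡ (ε * P x d) (≈-trans (reflection-below x (n ℕ.+ d) n+d<p div r)
             (≡⇒≈ (cong -_ (trans (σ-+ n d) (trans (cong (λ t → σ n * t) even) (ℤ.*-identityʳ (σ n))))))) ⟩
      ε * P x d * ε
        ≈⟨ ≡⇒≈ (trans (eq₂ (σ n) (P x d)) (trans (cong (λ t → t * P x d) (σ² n)) (ℤ.*-identityˡ (P x d)))) ⟩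
      P x d ∎)
      where
      open ≈-Reasoning (p ℕ.^ 5)
      eq₁ : ∀ ε q g h → ε * (1ℤ * q * g * h) ≡ ε * q * (g * h)
      eq₁ = solve-∀
      eq₂ : ∀ t q → - t * q * - t ≡ t * t * q
      eq₂ = solve-∀

    private
      -- Because `3s = p = 1 + 2n + d`, the reflection of `e = a - d` is `1 - e ≡ a + s`. The
      -- companions `e + s` and `e - s` are likewise reflected to `a` and `a + 2s`.
      middle₀ : P e d ≡ ε * (g₀ * g₊) [mod p ℕ.^ 5 ]
      middle₀ = middle e (a + s) a
        (≈-linear 1ℤ 3s≡p (trans (eq a (+ m) (+ d)) (cong (λ z → 1ℤ * (s + s + s + - z)) (sym +p≡)))) (eq₁ a (+ d))
        (subst (+ p ∣_) (sym (eq₂ a (+ m) (+ d))) p∣s) (≈-trans (≡⇒≈ (cong reflection (eq₂ a (+ m) (+ d)))) reflection-s)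
        where
        eq : ∀ a m d → a + (a + (m + d)) + - (1ℤ + - (a + - d))
          ≡ 1ℤ * (a + (m + d) + (a + (m + d)) + (a + (m + d)) + - (1ℤ + (m + m + (d + d + d))))
        eq = solve-∀
        eq₁ : ∀ a d → a ≡ a + - d + d
        eq₁ = solve-∀
        eq₂ : ∀ a m d → a + - d + (m + d + d) ≡ a + (m + d)
        eq₂ = solve-∀

      middle₊ : P (e + s) d ≡ ε * (g₊ * g₀) [mod p ℕ.^ 5 ]
      middle₊ = middle (e + s) a (a + s)
        (≈-linear 1ℤ 3s≡p (trans (eq a (+ m) (+ d)) (cong (λ z → 1ℤ * (s + s + s + - z)) (sym +p≡)))) (eq₁ a s (+ d))
        (subst (+ p ∣_) (sym (eq₂ a (+ m) (+ d))) p∣2s) (≈-trans (≡⇒≈ (cong reflection (eq₂ a (+ m) (+ d)))) reflection-2s)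
        where
        eq : ∀ a m d → a + - (1ℤ + - (a + - d + (a + (m + d))))
          ≡ 1ℤ * (a + (m + d) + (a + (m + d)) + (a + (m + d)) + - (1ℤ + (m + m + (d + d + d))))
        eq = solve-∀
        eq₁ : ∀ a s d → a + s ≡ a + - d + s + d
        eq₁ = solve-∀
        eq₂ : ∀ a m d → a + - d + (a + (m + d)) + (m + d + d) ≡ a + (m + d) + (a + (m + d))
        eq₂ = solve-∀

      middle₋ : P (e + - s) d ≡ ε * (g₋ * h₊) [mod p ℕ.^ 5 ]
      middle₋ = middle (e + - s) (a + (s + s)) (a + - s)
        (≈-linear 1ℤ 3s≡p (trans (eq a (+ m) (+ d)) (cong (λ z → 1ℤ * (s + s + s + - z)) (sym +p≡)))) (eq₁ a s (+ d))
        (subst (+ p ∣_) (sym (eq₂ a (+ m) (+ d))) (divides 0ℤ refl)) (≈-trans (≡⇒≈ (cong reflection (eq₂ a (+ m) (+ d)))) reflection-0)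
        where
        eq : ∀ a m d → a + (a + (m + d) + (a + (m + d))) + - (1ℤ + - (a + - d + - (a + (m + d))))
          ≡ 1ℤ * (a + (m + d) + (a + (m + d)) + (a + (m + d)) + - (1ℤ + (m + m + (d + d + d))))
        eq = solve-∀
        eq₁ : ∀ a s d → a + - s ≡ a + - d + - s + d
        eq₁ = solve-∀
        eq₂ : ∀ a m d → a + - d + - (a + (m + d)) + (m + d + d) ≡ 0ℤ
        eq₂ = solve-∀

      ε² : ε * ε ≡ 1ℤ
      ε² = trans (eq (σ n)) (σ² n)
        where
        eq : ∀ x → - x * - x ≡ x * x
        eq = solve-∀

      differences : cube g₀ * cube g₀ * (h₋ * h₊) ≡ fourth (g₊ * g₋) [mod p ℕ.^ 4 ]
      differences = multiplicative-difference p∣s (opposite p∣s reflection-s) (opposite p∣2s reflection-2s) a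

      -- The factor `Π (sq y) e d` has no Gamma expression of its own. Multiplied by `P (e - s) d`
      -- and `P (e + s) d` it becomes `fourth (P e d)` modulo `p⁴`, and these three rising
      -- factorials are Gamma values by `middle`.
      K-product : K * (g₋ * h₊) ≡ ε * fourth (g₀ * g₊) [mod p ℕ.^ 4 ]
      K-product = cancel₄ (g₀ * g₊) (unit-* (unit-G a) (unit-G (a + s))) (begin
        K * (g₋ * h₊) * (g₀ * g₊)
          ≈⟨ ≡⇒≈ (trans (sym (ℤ.*-identityˡ (K * (g₋ * h₊) * (g₀ * g₊)))) (trans (cong (λ z → z * (K * (g₋ * h₊) * (g₀ * g₊))) (sym ε²)) (eq₁ ε K g₋ h₊ g₀ g₊))) ⟩
        K * (ε * (g₋ * h₊) * (ε * (g₊ * g₀)))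
          ≈⟨ *-≈ˡ K (weaken 1 {4} (≈-sym (*-≈ middle₋ middle₊))) ⟩
        K * (P (e + - s) d * P (e + s) d)
          ≈⟨ ≡⇒≈ (eq₂ (P e d) (Π (sq y) e d) (P (e + - s) d) (P (e + s) d)) ⟩
        P e d * (P (e + - s) d * P (e + s) d * Π (sq y) e d)
          ≈⟨ *-≈ˡ (P e d) (quartic-product e d) ⟩
        P e d * fourth (P e d)
          ≈⟨ weaken 1 {4} (*-≈ middle₀ (fourth-≈ middle₀)) ⟩
        ε * (g₀ * g₊) * fourth (ε * (g₀ * g₊))
          ≈⟨ ≡⇒≈ (trans (eq₃ ε (g₀ * g₊)) (trans (cong (λ z → z * z * (ε * fourth (g₀ * g₊) * (g₀ * g₊))) ε²)
               (ℤ.*-identityˡ (ε * fourth (g₀ * g₊) * (g₀ * g₊))))) ⟩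
        ε * fourth (g₀ * g₊) * (g₀ * g₊) ∎)
        where
        open ≈-Reasoning (p ℕ.^ 4)
        eq₁ : ∀ ε K gm hp g gp → ε * ε * (K * (gm * hp) * (g * gp)) ≡ K * (ε * (gm * hp) * (ε * (gp * g)))
        eq₁ = solve-∀
        eq₂ : ∀ q t u v → q * t * (u * v) ≡ q * (u * v * t)
        eq₂ = solve-∀
        eq₃ : ∀ ε x → ε * x * ((ε * x) * (ε * x) * (ε * x) * (ε * x)) ≡ (ε * ε) * (ε * ε) * (ε * (x * x * x * x) * x)
        eq₃ = solve-∀

      -- The same trade at base point 1: `F₁ * S₁` is `fourth F` modulo `p⁴`, and `F₁` and `F` are
      -- inverse to Gamma values.
      denominator : F * S₁ * (g₋ * fourth g₋) ≡ g₀ * h₋ [mod p ℕ.^ 4 ]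
      denominator = begin
        F * S₁ * (g₋ * fourth g₋)
          ≈⟨ ≈-linear (- (F * S₁ * (g₋ * fourth g₋))) (weaken 1 {4} factorial-s) (eq₁ (F * S₁ * (g₋ * fourth g₋)) F₁ (g₀ * h₋)) ⟩
        F * S₁ * (g₋ * fourth g₋) * (F₁ * (g₀ * h₋))
          ≈⟨ ≡⇒≈ (eq₂ F S₁ g₋ (fourth g₋) F₁ (g₀ * h₋)) ⟩
        F₁ * S₁ * (F * g₋ * fourth g₋ * (g₀ * h₋))
          ≈⟨ *-≈ʳ (F * g₋ * fourth g₋ * (g₀ * h₋)) (quartic-product 1ℤ n) ⟩
        fourth F * (F * g₋ * fourth g₋ * (g₀ * h₋))
          ≈⟨ ≡⇒≈ (eq₃ F g₋ (g₀ * h₋)) ⟩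
        fourth (F * g₋) * (F * g₋) * (g₀ * h₋)
          ≈⟨ *-≈ʳ (g₀ * h₋) (weaken 1 {4} (*-≈ (fourth-≈ factorial) factorial)) ⟩
        1ℤ * (g₀ * h₋)
          ≈⟨ ≡⇒≈ (ℤ.*-identityˡ (g₀ * h₋)) ⟩
        g₀ * h₋ ∎
        where
        open ≈-Reasoning (p ℕ.^ 4)
        eq₁ : ∀ x f g → x + - (x * (f * g)) ≡ - x * (f * g + - 1ℤ)
        eq₁ = solve-∀
        eq₂ : ∀ f t g h k v → f * t * (g * h) * (k * v) ≡ k * t * (f * g * h * v)
        eq₂ = solve-∀
        eq₃ : ∀ f g v → f * f * f * f * (f * g * (g * g * g * g) * v) ≡ (f * g) * (f * g) * (f * g) * (f * g) * (f * g) * v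
        eq₃ = solve-∀

      -- The quotient of the two preceding evaluations is `g₀³ (g₊ g₋)⁴ / (h₋ h₊)` up to sign. The
      -- fourth difference replaces the last fraction by `g₀⁶`, which gives the ninth power.
      K≈ : K ≡ ε * cube (cube g₀) * (F * S₁) [mod p ℕ.^ 4 ]
      K≈ = cancel₄ (g₋ * fourth g₋ * h₊) (unit-* (unit-* u (unit-* (unit-* (unit-* u u) u) u)) (unit-G (a + (s + s)))) (begin
        K * (g₋ * fourth g₋ * h₊)
          ≈⟨ ≡⇒≈ (eq₁ K g₋ (fourth g₋) h₊) ⟩
        K * (g₋ * h₊) * fourth g₋
          ≈⟨ *-≈ʳ (fourth g₋) K-product ⟩
        ε * fourth (g₀ * g₊) * fourth g₋
          ≈⟨ ≡⇒≈ (eq₂ ε g₀ g₊ g₋) ⟩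
        ε * fourth g₀ * fourth (g₊ * g₋)
          ≈⟨ *-≈ˡ (ε * fourth g₀) (≈-sym differences) ⟩
        ε * fourth g₀ * (cube g₀ * cube g₀ * (h₋ * h₊))
          ≈⟨ ≡⇒≈ (eq₃ ε g₀ h₋ h₊) ⟩
        ε * cube (cube g₀) * (g₀ * h₋) * h₊
          ≈⟨ *-≈ʳ h₊ (*-≈ˡ (ε * cube (cube g₀)) (≈-sym denominator)) ⟩
        ε * cube (cube g₀) * (F * S₁ * (g₋ * fourth g₋)) * h₊
          ≈⟨ ≡⇒≈ (eq₄ (ε * cube (cube g₀)) (F * S₁) (g₋ * fourth g₋) h₊) ⟩
        ε * cube (cube g₀) * (F * S₁) * (g₋ * fourth g₋ * h₊) ∎)
        where
        open ≈-Reasoning (p ℕ.^ 4)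
        u : Unit g₋
        u = unit-G (a + - s)
        eq₁ : ∀ K g f h → K * (g * f * h) ≡ K * (g * h) * f
        eq₁ = solve-∀
        eq₂ : ∀ ε a b c → ε * ((a * b) * (a * b) * (a * b) * (a * b)) * (c * c * c * c) ≡ ε * (a * a * a * a) * ((b * c) * (b * c) * (b * c) * (b * c))
        eq₂ = solve-∀
        eq₃ : ∀ ε g h k → let c = g * g * g in ε * (g * g * g * g) * (c * c * (h * k)) ≡ ε * (c * c * c) * (g * h) * k
        eq₃ = solve-∀
        eq₄ : ∀ x y z h → x * (y * z) * h ≡ x * y * (z * h)
        eq₄ = solve-∀

    -- As `1 - 2a ≡ a + m`, the run from `a` of length `m` ends at `1 - 2a`, and the reflection
    -- formula at `2a` applies.
    gamma-2a : G (a + a) * A * g₀ ≡ - σ m [mod p ℕ.^ 5 ]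
    gamma-2a = begin
      G (a + a) * A * g₀
        ≈⟨ ≡⇒≈ (trans (sym (ℤ.*-identityˡ (G (a + a) * A * g₀))) (trans (cong (λ z → z * (G (a + a) * A * g₀)) (sym (σ² m))) (eq₁ (σ m) (G (a + a)) A g₀))) ⟩
      σ m * (G (a + a) * (σ m * A * g₀))
        ≈⟨ *-≈ˡ (σ m) (*-≈ˡ (G (a + a)) (≈-sym (≈-trans (G-≈ 1-2a≈a+m) (G-run a m (run-units a n m p∣s n<p (ℕ.m≤m+n m d)))))) ⟩
      σ m * reflection (a + a)
        ≈⟨ *-≈ˡ (σ m) (reflection-below (a + a) (n ℕ.+ n) n+n<p (subst (+ p ∣_) (sym (eq₂ a (+ n))) p∣2s)
             (≈-trans (≡⇒≈ (cong reflection (eq₂ a (+ n)))) reflection-2s)) ⟩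
      σ m * - σ (n ℕ.+ n)
        ≈⟨ ≡⇒≈ (trans (cong (λ z → σ m * - z) (trans (σ-+ n n) (σ² n))) (eq₃ (σ m))) ⟩
      - σ m ∎
      where
      open ≈-Reasoning (p ℕ.^ 5)
      1-2a≈a+m : 1ℤ + - (a + a) ≡ a + + m [mod p ℕ.^ 5 ]
      1-2a≈a+m = ≈-linear (- 1ℤ) 3a-1≈-m (eq a (+ m))
        where
        eq : ∀ a m → 1ℤ + - (a + a) + - (a + m) ≡ - 1ℤ * (a + a + a + - 1ℤ + - - m)
        eq = solve-∀
      eq₁ : ∀ t g A h → t * t * (g * A * h) ≡ t * (g * (t * A * h))
      eq₁ = solve-∀
      eq₂ : ∀ a n → a + a + (n + n) ≡ a + n + (a + n)
      eq₂ = solve-∀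
      eq₃ : ∀ t → t * - 1ℤ ≡ - t
      eq₃ = solve-∀

    -- Three of the nine factors `G a` in `K` are absorbed by the cube of `gamma-2a`; the remaining
    -- six form the numerator of the Gamma quotient in the theorem.
    gamma-quotient : σ n * (P e d * Π (sq y) e d) * cube (G (a + a) * P a m)
      ≡ σ m * (cube (G a) * cube (G a)) * (P 1ℤ n * Π (sq y) 1ℤ n) [mod p ℕ.^ 4 ]
    gamma-quotient = cancel₄ (cube g₀) (unit-* (unit-* u u) u) (begin
      σ n * K * cube (G (a + a) * A) * cube g₀
        ≈⟨ ≡⇒≈ (eq₁ (σ n) K (G (a + a) * A) g₀) ⟩
      σ n * K * cube (G (a + a) * A * g₀)
        ≈⟨ *-≈ (*-≈ˡ (σ n) K≈) (weaken 1 {4} (*-≈ (*-≈ gamma-2a gamma-2a) gamma-2a)) ⟩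
      σ n * (ε * cube (cube g₀) * (F * S₁)) * cube (- σ m)
        ≈⟨ ≡⇒≈ (trans (eq₂ (σ n) (σ m) g₀ (F * S₁)) (cong₂ (λ t v → t * v * (σ m * (cube g₀ * cube g₀) * (F * S₁) * cube g₀)) (σ² n) (σ² m))) ⟩
      1ℤ * 1ℤ * (σ m * (cube g₀ * cube g₀) * (F * S₁) * cube g₀)
        ≈⟨ ≡⇒≈ (ℤ.*-identityˡ (σ m * (cube g₀ * cube g₀) * (F * S₁) * cube g₀)) ⟩
      σ m * (cube g₀ * cube g₀) * (F * S₁) * cube g₀ ∎)
      where
      open ≈-Reasoning (p ℕ.^ 4)
      u : Unit g₀
      u = unit-G a
      eq₁ : ∀ t K x g → t * K * (x * x * x) * (g * g * g) ≡ t * K * ((x * g) * (x * g) * (x * g))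
      eq₁ = solve-∀
      eq₂ : ∀ t v g f → let c = g * g * g in
        t * (- t * (c * c * c) * f) * (- v * - v * - v) ≡ t * t * (v * v) * (v * (c * c) * f * c)
      eq₂ = solve-∀

  -- The supercongruence for integers modulo p⁵

  module Assembly
    (p : ℕ) (p-prime : Prime p) (7≤p : 7 ℕ.≤ p) (m d w : ℕ)
    (p≡ : p ≡ suc (m ℕ.+ m ℕ.+ (d ℕ.+ d ℕ.+ d))) (even : σ d ≡ 1ℤ)
    (a : ℤ) (s≡pw : a + + (m ℕ.+ d) ≡ + (p ℕ.* w))
    (3s≡p : a + + (m ℕ.+ d) + (a + + (m ℕ.+ d)) + (a + + (m ℕ.+ d)) ≡ + p [mod p ℕ.^ 5 ])
    where

    open PrimePower p p-prime
    open GammaModulo p p-prime 7≤p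
    open GammaQuotient p p-prime 7≤p m d w p≡ even a s≡pw 3s≡p
    open Deformation p p-prime using (fourth-0; scale-0; fourth-≈)
    open Deformation.Sums p p-prime n n<p a p∣s using (coefficient; W; W₀; V; deformed-sum; deformed-whipple; V-inverse; unit-!; unit-deformed)

    q : ℕ
    q = m ℕ.+ m ℕ.+ (d ℕ.+ d ℕ.+ d)

    q≡ : q ≡ n ℕ.+ (n ℕ.+ d)
    q≡ = eq m d
      where
      eq : ∀ m d → m ℕ.+ m ℕ.+ (d ℕ.+ d ℕ.+ d) ≡ m ℕ.+ d ℕ.+ (m ℕ.+ d ℕ.+ d)
      eq = ℕ-Solver.solve-∀

    C D T : ℤ
    C = cube (G (a + a) * P a m)
    D = P 1ℤ n * Π (sq y) 1ℤ n
    T = S (λ i r → bin i r * (cube (P a i) * cube (P a r))) m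

    y²≈0 : y * y ≡ 0ℤ [mod p ℕ.^ 4 ]
    y²≈0 = ≈-trans (≡⇒≈ (eq s)) s⁴≈0
      where
      eq : ∀ s → s * s * (s * s) ≡ s * s * s * s
      eq = solve-∀

    scale-p : ∀ {x z} → x ≡ z [mod p ℕ.^ 4 ] → + p * x ≡ + p * z [mod p ℕ.^ 5 ]
    scale-p = scale 4 (+ p) ℤ∣.∣-refl

    3a≈1-m : + 3 * a ≡ 1ℤ + - + m [mod p ℕ.^ 5 ]
    3a≈1-m = ≈-linear 1ℤ 3a-1≈-m (eq a (+ m))
      where
      eq : ∀ a m → + 3 * a + - (1ℤ + - m) ≡ 1ℤ * (a + a + a + - 1ℤ + - - m)
      eq = solve-∀

    unit-D : Unit D
    unit-D = unit-* (unit-! n n<p) (unit-factorʳ (P (1ℤ + - s) n * P (1ℤ + s) n) (Π (sq y) 1ℤ n)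
      (subst Unit (Π-quartic-factors s 1ℤ (1ℤ + - s) (1ℤ + s) n refl refl) (unit-deformed n n<p)))

    unit-A : Unit (P a m)
    unit-A = unit-Π (λ z → z) a m (run-units a n m p∣s n<p (ℕ.m≤m+n m d))

    -- Modulo `p`, `2a` is `- 2n` with `2n < p`, so the first `2n` factors from `2a` on avoid the
    -- multiples of `p`, and `m` is at most `2n`.
    unit-2A : ∀ k → k ℕ.≤ m → Unit (P (a + a) k)
    unit-2A k k≤m = unit-Π (λ z → z) (a + a) k (run-units (a + a) (n ℕ.+ n) k
      (subst (+ p ∣_) (eq a (+ n)) p∣2s) n+n<p (ℕ.≤-trans k≤m (ℕ.≤-trans (ℕ.m≤m+n m d) (ℕ.m≤m+n n n))))
      where
      eq : ∀ a n → a + n + (a + n) ≡ a + a + (n + n)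
      eq = solve-∀

    unit-C : Unit C
    unit-C = unit-* (unit-* u u) u
      where
      u : Unit (G (a + a) * P a m)
      u = unit-* (unit-G (a + a)) unit-A

    -- The 3 comes from `6k + r = 3 (a + 2k)` and turns `s` into `p`. Only with this `p` in front
    -- may `y² = s⁴`, which is known to vanish modulo `p⁴` alone, be dropped.
    whipple-side : + 3 * S (λ k i → coefficient k i * W k) n * D ≡ + p * (σ n * (P e d * Π (sq y) e d) * T) [mod p ℕ.^ 5 ]
    whipple-side = begin
      + 3 * S (λ k i → coefficient k i * W k) n * D
        ≈⟨ ≡⇒≈ (ℤ.*-assoc (+ 3) (S (λ k i → coefficient k i * W k) n) D) ⟩
      + 3 * (S (λ k i → coefficient k i * W k) n * D)
        ≈⟨ *-≈ˡ (+ 3) deformed-whipple ⟩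
      + 3 * (s * 4F3 n a y)
        ≈⟨ 3s*Z≈p*Z (4F3 n a y) ⟩
      + p * 4F3 n a y
        ≈⟨ *-≈ˡ (+ p) (4F3-truncated m d a 3a-1≈-m) ⟩
      + p * (σ n * (P e d * Π (sq y) e d) * paired m a y)
        ≈⟨ scale-p (*-≈ˡ (σ n * (P e d * Π (sq y) e d)) (paired-undeformed m a y y²≈0)) ⟩
      + p * (σ n * (P e d * Π (sq y) e d) * T) ∎
      where
      open ≈-Reasoning (p ℕ.^ 5)
      eq : ∀ s z p → + 3 * (s * z) + - (p * z) ≡ z * (s + s + s + - p)
      eq = solve-∀
      3s*Z≈p*Z : ∀ z → + 3 * (s * z) ≡ + p * z [mod p ℕ.^ 5 ]
      3s*Z≈p*Z z = ≈-linear z 3s≡p (eq s z (+ p))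

    -- The quotient `X k` enters only through its cross-multiplied equation, which separates the
    -- integer computation from division in `ℤₚ`.
    module _ (X : ℕ → ℤ) (X-eq : ∀ k → k ℕ.< p → X k * P 1ℤ k ℤ.^ 6 ≡ P a k ℤ.^ 6 [mod p ℕ.^ 5 ]) where

      private
        τ : ℕ → ℤ
        τ k = (+ 6 * + k + (1ℤ + - + m)) * X k

        τ-small : ∀ k i → k ℕ.+ i ≡ n → τ k ≡ + 3 * (coefficient k i * W₀ k) [mod p ℕ.^ 5 ]
        τ-small k i k+i≡n = begin
          τ k
            ≈⟨ *-≈ linear X≈ ⟩
          + 3 * (a + + k + + k) * (P a k ℤ.^ 6 * V k ℤ.^ 6)
            ≈⟨ ≡⇒≈ (eq₂ (a + + k + + k) (P a k) (V k)) ⟩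
          + 3 * (coefficient k i * (fourth (P a k) * fourth (V k)))
            ≈⟨ ≡⇒≈ (cong (λ z → + 3 * (coefficient k i * (z * fourth (V k)))) (sym (Π-quartic-0 a k))) ⟩
          + 3 * (coefficient k i * W₀ k) ∎
          where
          open ≈-Reasoning (p ℕ.^ 5)
          k<p : k ℕ.< p
          k<p = ℕ.≤-<-trans (ℕ.≤-trans (ℕ.m≤m+n k i) (ℕ.≤-reflexive k+i≡n)) n<p
          eq₁ : ∀ k a m → + 6 * k + (1ℤ + - m) + - (+ 3 * (a + k + k)) ≡ - 1ℤ * (+ 3 * a + - (1ℤ + - m))
          eq₁ = solve-∀
          linear : + 6 * + k + (1ℤ + - + m) ≡ + 3 * (a + + k + + k) [mod p ℕ.^ 5 ]
          linear = ≈-linear (- 1ℤ) 3a≈1-m (eq₁ (+ k) a (+ m))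
          eq₂ : ∀ c x v → + 3 * c * (x * (x * (x * (x * (x * (x * 1ℤ))))) * (v * (v * (v * (v * (v * (v * 1ℤ)))))))
            ≡ + 3 * (c * (x * x) * (v * v) * (x * x * x * x * (v * v * v * v)))
          eq₂ = solve-∀
          eq₃ : ∀ x v → x * (x * (x * (x * (x * (x * 1ℤ))))) * (v * (v * (v * (v * (v * (v * 1ℤ))))))
            ≡ x * v * (x * v) * (x * v) * (x * v) * (x * v) * (x * v)
          eq₃ = solve-∀
          V⁶ : P 1ℤ k ℤ.^ 6 * V k ℤ.^ 6 ≡ 1ℤ [mod p ℕ.^ 5 ]
          V⁶ = ≈-trans (≡⇒≈ (eq₃ (P 1ℤ k) (V k))) (*-≈ (*-≈ (fourth-≈ v) v) v)
            where
            v : P 1ℤ k * V k ≡ 1ℤ [mod p ℕ.^ 5 ]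
            v = V-inverse k k<p
          X≈ : X k ≡ P a k ℤ.^ 6 * V k ℤ.^ 6 [mod p ℕ.^ 5 ]
          X≈ = ≈-linear₂ (- X k) (V k ℤ.^ 6) V⁶ (X-eq k k<p) (eq₄ (X k) (P 1ℤ k ℤ.^ 6) (V k ℤ.^ 6) (P a k ℤ.^ 6))
            where
            eq₄ : ∀ x u v b → x + - (b * v) ≡ - x * (u * v + - 1ℤ) + v * (x * u + - b)
            eq₄ = solve-∀

        -- For `k > n` the product `(a)_k` contains `a + n = s`, hence a factor `p`, and it occurs
        -- to the sixth power, while `k!` is a unit for `k < p`.
        τ-large : ∀ k → n ℕ.< k → k ℕ.< p → τ k ≡ 0ℤ [mod p ℕ.^ 5 ]
        τ-large k n<k k<p = ≈-trans (*-≈ˡ (+ 6 * + k + (1ℤ + - + m)) X≈0) (≡⇒≈ (ℤ.*-zeroʳ (+ 6 * + k + (1ℤ + - + m))))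
          where
          p∣A : + p ∣ P a k
          p∣A = subst (λ l → + p ∣ P a l) (ℕ.m+[n∸m]≡n n<k) (subst (+ p ∣_) (sym (P-+ a (suc n) (k ℕ.∸ suc n)))
            (ℤ∣.∣m⇒∣m*n (P (a + + suc n) (k ℕ.∸ suc n)) (ℤ∣.∣n⇒∣m*n (P a n) p∣s)))
          A⁶≈0 : P a k ℤ.^ 6 ≡ 0ℤ [mod p ℕ.^ 5 ]
          A⁶≈0 = ≈-trans (≡⇒≈ (eq (P a k))) (≈-trans (*-≈ˡ (P a k) (scale-0 4 (P a k) p∣A (fourth-0 p∣A))) (≡⇒≈ (ℤ.*-zeroʳ (P a k))))
            where
            eq : ∀ x → x * (x * (x * (x * (x * (x * 1ℤ))))) ≡ x * (x * (x * x * x * x))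
            eq = solve-∀
          unit⁶ : Unit (P 1ℤ k ℤ.^ 6)
          unit⁶ = unit-^ 6 (unit-! k k<p)
          X≈0 : X k ≡ 0ℤ [mod p ℕ.^ 5 ]
          X≈0 = cancel₅ (P 1ℤ k ℤ.^ 6) unit⁶ (≈-trans (X-eq k k<p) (≈-trans A⁶≈0 (≡⇒≈ (sym (ℤ.*-zeroˡ (P 1ℤ k ℤ.^ 6))))))

        -- Truncation of a sum needs terms that are equal to zero, whereas the terms beyond `n` are
        -- only congruent to zero; they are replaced before truncating.
        cutoff : ℕ → ℤ
        cutoff k with k ℕ.≤? n
        ... | yes _ = τ k
        ... | no  _ = 0ℤ

        cutoff-≤ : ∀ k → k ℕ.≤ n → cutoff k ≡ τ k
        cutoff-≤ k k≤n with k ℕ.≤? n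
        ... | yes _  = refl
        ... | no k≰n = contradiction k≤n k≰n

        cutoff-> : ∀ k → n ℕ.< k → cutoff k ≡ 0ℤ
        cutoff-> k n<k with k ℕ.≤? n
        ... | yes k≤n = contradiction n<k (ℕ.≤⇒≯ k≤n)
        ... | no _    = refl

        τ≈cutoff : ∀ k → k ℕ.< p → τ k ≡ cutoff k [mod p ℕ.^ 5 ]
        τ≈cutoff k k<p with k ℕ.≤? n
        ... | yes _  = ≈-refl
        ... | no k≰n = τ-large k (ℕ.≰⇒> k≰n) k<p

      left-side : S (λ k _ → (+ 6 * + k + (1ℤ + - + m)) * X k) q * D ≡ + p * (σ n * (P e d * Π (sq y) e d) * T) [mod p ℕ.^ 5 ]
      left-side = begin
        S (λ k _ → τ k) q * D
          ≈⟨ *-≈ʳ D (begin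
            S (λ k _ → τ k) q
              ≈⟨ S-≈ q (λ k i k+i≡q → τ≈cutoff k (ℕ.≤-trans (ℕ.s≤s (ℕ.≤-trans (ℕ.m≤m+n k i) (ℕ.≤-reflexive k+i≡q))) (ℕ.≤-reflexive (sym p≡)))) ⟩
            S (λ k _ → cutoff k) q
              ≈⟨ ≡⇒≈ (trans (cong (S (λ k _ → cutoff k)) q≡) (S-truncate n (n ℕ.+ d) (λ k _ → cutoff k) (λ k _ → cutoff-> k))) ⟩
            S (λ k _ → cutoff k) n
              ≈⟨ S-≈ n (λ k i k+i≡n → ≈-trans (≡⇒≈ (cutoff-≤ k (ℕ.≤-trans (ℕ.m≤m+n k i) (ℕ.≤-reflexive k+i≡n)))) (τ-small k i k+i≡n)) ⟩
            S (λ k i → + 3 * (coefficient k i * W₀ k)) n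
              ≈⟨ ≡⇒≈ (S-* n (+ 3) (λ k i → coefficient k i * W₀ k)) ⟩
            + 3 * S (λ k i → coefficient k i * W₀ k) n
              ≈⟨ *-≈ˡ (+ 3) (≈-sym deformed-sum) ⟩
            + 3 * S (λ k i → coefficient k i * W k) n ∎) ⟩
        + 3 * S (λ k i → coefficient k i * W k) n * D
          ≈⟨ whipple-side ⟩
        + p * (σ n * (P e d * Π (sq y) e d) * T) ∎
        where open ≈-Reasoning (p ℕ.^ 5)

    module _ (Y : ℕ → ℤ)
      (Y-eq : ∀ k → k ℕ.≤ m → Y k * (P 1ℤ k * P (a + a) k ℤ.^ 3) ≡ P (- + m) k * P a k ℤ.^ 3 [mod p ℕ.^ 5 ]) where

      -- From `2a ≡ 1 - m - a` follows `(a)_m ≡ (-1)^k (2a)_k (a)_(m-k)`. So the cube of `(a)_m`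
      -- clears the denominators `(2a)_k³`, and `(- m)_k / k!` leaves the binomial coefficient; the
      -- four signs cancel.
      right-sum : S (λ k _ → Y k) m * cube (P a m) ≡ T [mod p ℕ.^ 5 ]
      right-sum = ≈-trans (≡⇒≈ (trans (ℤ.*-comm (S (λ k _ → Y k) m) (cube (P a m))) (sym (S-* m (cube (P a m)) (λ k _ → Y k)))))
        (S-≈ m pointwise)
        where
        pointwise : ∀ k i → k ℕ.+ i ≡ m → cube (P a m) * Y k ≡ bin k i * (cube (P a k) * cube (P a i)) [mod p ℕ.^ 5 ]
        pointwise k i k+i≡m = cancel₅ (P 1ℤ k * P (a + a) k ℤ.^ 3) (unit-* (unit-! k k<p) (unit-^ 3 (unit-2A k k≤m))) (begin
          cube (P a m) * Y k * (P 1ℤ k * P (a + a) k ℤ.^ 3)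
            ≈⟨ ≡⇒≈ (ℤ.*-assoc (cube (P a m)) (Y k) (P 1ℤ k * P (a + a) k ℤ.^ 3)) ⟩
          cube (P a m) * (Y k * (P 1ℤ k * P (a + a) k ℤ.^ 3))
            ≈⟨ *-≈ (≈-sym (*-≈ (*-≈ A≈ A≈) A≈)) (≈-trans (Y-eq k k≤m) (≡⇒≈ (cong (λ z → z * P a k ℤ.^ 3) (falling-bin m k i k+i≡m)))) ⟩
          cube (σ k * P (a + a) k * P a i) * (σ k * (bin k i * P 1ℤ k) * P a k ℤ.^ 3)
            ≈⟨ ≡⇒≈ (trans (eq (σ k) (P (a + a) k) (P a i) (bin k i) (P 1ℤ k) (P a k)) (cong (λ z → z * z * rhs) (σ² k))) ⟩
          1ℤ * 1ℤ * rhs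
            ≈⟨ ≡⇒≈ (ℤ.*-identityˡ rhs) ⟩
          rhs ∎)
          where
          open ≈-Reasoning (p ℕ.^ 5)
          rhs : ℤ
          rhs = bin k i * (cube (P a k) * cube (P a i)) * (P 1ℤ k * P (a + a) k ℤ.^ 3)
          k≤m : k ℕ.≤ m
          k≤m = ℕ.≤-trans (ℕ.m≤m+n k i) (ℕ.≤-reflexive k+i≡m)
          k<p : k ℕ.< p
          k<p = ℕ.≤-<-trans (ℕ.≤-trans k≤m (ℕ.m≤m+n m d)) n<p
          eq : ∀ t b c v f x → let z = t * b * c in
            z * z * z * (t * (v * f) * (x * (x * (x * 1ℤ)))) ≡ t * t * (t * t) * (v * (x * x * x * (c * c * c)) * (f * (b * (b * (b * 1ℤ)))))
          eq = solve-∀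
          2a≈ : a + a ≡ 1ℤ + - + m + - a [mod p ℕ.^ 5 ]
          2a≈ = ≈-linear 1ℤ 3a-1≈-m (eq₁ a (+ m))
            where
            eq₁ : ∀ a m → a + a + - (1ℤ + - m + - a) ≡ 1ℤ * (a + a + a + - 1ℤ + - - m)
            eq₁ = solve-∀
          A≈ : σ k * P (a + a) k * P a i ≡ P a m [mod p ℕ.^ 5 ]
          A≈ = ≈-trans (*-≈ʳ (P a i) (*-≈ˡ (σ k) (≈-trans (P-≈ k 2a≈)
              (≡⇒≈ (P-reflect (1ℤ + - + m + - a) (a + + i) k (trans (cong (λ z → 1ℤ + - + z + - a + (a + + i) + + k) (sym k+i≡m)) (eq₂ a (+ k) (+ i))))))))
            (≡⇒≈ (trans (eq₃ (σ k) (P (a + + i) k) (P a i)) (trans (cong (λ z → z * (P a i * P (a + + i) k)) (σ² k))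
              (trans (ℤ.*-identityˡ (P a i * P (a + + i) k)) (trans (sym (P-+ a i k)) (cong (P a) (trans (ℕ.+-comm i k) k+i≡m)))))))
            where
            eq₂ : ∀ a k i → 1ℤ + - (k + i) + - a + (a + i) + k ≡ 1ℤ
            eq₂ = solve-∀
            eq₃ : ∀ s x z → s * (s * x) * z ≡ s * s * (z * x)
            eq₃ = solve-∀

    supercongruence : ∀ X Y γ →
      (∀ k → k ℕ.< p → X k * P 1ℤ k ℤ.^ 6 ≡ P a k ℤ.^ 6 [mod p ℕ.^ 5 ]) →
      (∀ k → k ℕ.≤ m → Y k * (P 1ℤ k * P (a + a) k ℤ.^ 3) ≡ P (- + m) k * P a k ℤ.^ 3 [mod p ℕ.^ 5 ]) →
      γ * G (a + a) ℤ.^ 3 ≡ G a ℤ.^ 6 [mod p ℕ.^ 5 ] →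
      S (λ k _ → (+ 6 * + k + (1ℤ + - + m)) * X k) q ≡ σ m * + p * γ * S (λ k _ → Y k) m [mod p ℕ.^ 5 ]
    supercongruence X Y γ X-eq Y-eq γ-eq = cancel₅ (D * C) (unit-* unit-D unit-C) (begin
      L * (D * C)
        ≈⟨ ≡⇒≈ (sym (ℤ.*-assoc L D C)) ⟩
      L * D * C
        ≈⟨ *-≈ʳ C (left-side X X-eq) ⟩
      + p * (σ n * K * T) * C
        ≈⟨ ≡⇒≈ (eq₁ (+ p) (σ n * K) T C) ⟩
      + p * (σ n * K * C * T)
        -- The evaluation of the constant holds only modulo `p⁴`; the factor `p` in front restores
        -- `p⁵`.
        ≈⟨ scale-p (*-≈ʳ T gamma-quotient) ⟩
      + p * (σ m * (cube (G a) * cube (G a)) * D * T)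
        ≈⟨ ≡⇒≈ (eq₂ (+ p) (σ m) (G a) D T) ⟩
      σ m * + p * (G a ℤ.^ 6) * T * D
        ≈⟨ *-≈ʳ D (*-≈ (*-≈ˡ (σ m * + p) (≈-sym γ-eq)) (≈-sym (right-sum Y Y-eq))) ⟩
      σ m * + p * (γ * G (a + a) ℤ.^ 3) * (S (λ k _ → Y k) m * cube (P a m)) * D
        ≈⟨ ≡⇒≈ (eq₃ (σ m * + p) γ (G (a + a)) (S (λ k _ → Y k) m) (P a m) D) ⟩
      σ m * + p * γ * S (λ k _ → Y k) m * (D * C) ∎)
      where
      open ≈-Reasoning (p ℕ.^ 5)
      L K : ℤ
      L = S (λ k _ → (+ 6 * + k + (1ℤ + - + m)) * X k) q
      K = P e d * Π (sq y) e d
      eq₁ : ∀ p k t c → p * (k * t) * c ≡ p * (k * c * t)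
      eq₁ = solve-∀
      eq₂ : ∀ p t g d x → p * (t * (g * g * g * (g * g * g)) * d * x) ≡ t * p * (g * (g * (g * (g * (g * (g * 1ℤ)))))) * x * d
      eq₂ = solve-∀
      eq₃ : ∀ t γ g z b d → t * (γ * (g * (g * (g * 1ℤ)))) * (z * (b * b * b)) * d ≡ t * γ * z * (d * ((g * b) * (g * b) * (g * b)))
      eq₃ = solve-∀

open ModularArithmetic

-- Passage from p-adic integers to integers modulo p⁵

module Approximation (p : ℕ) (p-prime : Prime p) where
  open PAdic p p-prime
  open PrimePower p p-prime

  infix 4 _↦_
  record _↦_ (x : ℤₚ) (u : ℤ) : Set where
    constructor represented
    field
      represents : approx x 5 ≡ u [mod p ℕ.^ 5 ]

  open _↦_ public

  ↦-ι : ∀ {u v} → u ≡ v [mod p ℕ.^ 5 ] → ι u ↦ v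
  ↦-ι = represented

  ↦-* : ∀ {x y u v} → x ↦ u → y ↦ v → x * y ↦ u ℤ.* v
  ↦-* (represented e) (represented f) = represented (*-≈ e f)

  ↦-^ : ∀ {x u} k → x ↦ u → x ^ k ↦ u ℤ.^ k
  ↦-^ zero    e = represented ≈-refl
  ↦-^ (suc k) e = ↦-* e (↦-^ k e)

  ↦-pochhammer : ∀ {x u} k → x ↦ u → pochhammer x k ↦ P u k
  ↦-pochhammer zero    e               = represented ≈-refl
  ↦-pochhammer (suc k) (represented e) = ↦-* (↦-pochhammer k (represented e)) (represented (+-≈ e (≈-refl {a = + k})))

  -- Division by a unit as a cross-multiplied congruence, the form in which the integer part of the
  -- proof accepts its data.
  record Quotient (z : ℤₚ) (u v : ℤ) : Set where
    constructor quotient-by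
    field
      z*v≈u : approx z 5 ℤ.* v ≡ u [mod p ℕ.^ 5 ]

  quotient : ∀ {x y u v} → x ↦ u → y ↦ v → Unit v → Quotient (x / y) u v
  quotient {x} {y} {u} {v} (represented x↦u) (represented y↦v) unit-v = quotient-by (begin
    approx x 5 ℤ.* approx (y ⁻¹) 5 ℤ.* v
      ≈⟨ *-≈ˡ (approx x 5 ℤ.* approx (y ⁻¹) 5) (≈-sym y↦v) ⟩
    approx x 5 ℤ.* approx (y ⁻¹) 5 ℤ.* approx y 5
      ≈⟨ ≡⇒≈ (eq (approx x 5) (approx (y ⁻¹) 5) (approx y 5)) ⟩
    approx x 5 ℤ.* (approx y 5 ℤ.* approx (y ⁻¹) 5)
      ≈⟨ *-≈ x↦u (at (⁻¹-inverseʳ y p∤y) 5) ⟩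
    u ℤ.* 1ℤ
      ≈⟨ ≡⇒≈ (ℤ.*-identityʳ u) ⟩
    u ∎)
    where
    open ≈-Reasoning (p ℕ.^ 5)
    eq : ∀ a b c → a ℤ.* b ℤ.* c ≡ a ℤ.* (c ℤ.* b)
    eq = solve-∀
    p∤y : ¬ (+ p ∣ approx y 1)
    p∤y d = unit-∤ unit-v (∣-resp (modp⁺ (≈-sym (≈-trans (≈-sym (coherent⁺ y 4 1)) (weaken 4 {1} y↦v)))) d)

  ↦-cancel : ∀ {z u v} → Quotient z u v → Unit v → ∀ x → u ≡ x ℤ.* v [mod p ℕ.^ 5 ] → z ↦ x
  ↦-cancel {v = v} (quotient-by e) unit-v x u≈xv = represented (cancel₅ v unit-v (≈-trans e u≈xv))

  ↦-sum : ∀ n (f : Fin (suc n) → ℤₚ) (g : ℕ → ℤ) → (∀ k → f k ↦ g (toℕ k)) →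
    (∑[ k < suc n ] f k) ↦ S (λ k _ → g k) n
  ↦-sum zero    f g e = represented (≈-trans (≡⇒≈ (ℤ.+-identityʳ (approx (f Fin.zero) 5))) (represents (e Fin.zero)))
  ↦-sum (suc n) f g e = represented (+-≈ (represents (e Fin.zero))
    (represents (↦-sum n (λ k → f (Fin.suc k)) (λ k → g (suc k)) (λ k → e (Fin.suc k)))))

  ↦-sum-< : ∀ n n′ → n′ ≡ suc n → (f : Fin n′ → ℤₚ) (g : ℕ → ℤ) → (∀ k → f k ↦ g (toℕ k)) →
    (∑[ k < n′ ] f k) ↦ S (λ k _ → g k) n
  ↦-sum-< n _ refl = ↦-sum n

  ↦⇒mod-p^ : ∀ {x y u v} → x ↦ u → y ↦ v → u ≡ v [mod p ℕ.^ 5 ] → x ≡ y [mod-p^ 5 ]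
  ↦⇒mod-p^ {x} {y} (represented e) (represented f) u≈v = approx⇒mod-p^ {x} {y} 5 (≈-trans e (≈-trans u≈v (≈-sym f)))

-- Signs, parity and the relation between p and r

σ-power : ∀ k → -1ℤ ℤ.^ k ≡ σ k
σ-power zero    = refl
σ-power (suc k) = trans (cong (-1ℤ ℤ.*_) (σ-power k)) (ℤ.-1*i≡-i (σ k))

parity : ∀ k → ∃ λ h → k ≡ h ℕ.+ h ⊎ k ≡ suc (h ℕ.+ h)
parity zero    = 0 , inj₁ refl
parity (suc k) with parity k
... | h , inj₁ refl = h , inj₂ refl
... | h , inj₂ refl = suc h , inj₁ (cong suc (sym (ℕ.+-suc h h)))

-- p = 2m + 3d + 1 is odd, so d is even.
even-gap : ∀ p m d → Prime p → 7 ℕ.≤ p → p ≡ suc (m ℕ.+ m ℕ.+ (d ℕ.+ d ℕ.+ d)) → σ d ≡ 1ℤ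
even-gap p m d p-prime 7≤p p≡ with parity d
... | h , inj₁ refl = trans (σ-+ h h) (σ² h)
... | h , inj₂ refl with prime⇒irreducible p-prime (ℕ∣.divides (m ℕ.+ (h ℕ.+ h ℕ.+ h ℕ.+ 2)) (trans p≡ (eq m h)))
  where
  eq : ∀ m h → suc (m ℕ.+ m ℕ.+ (suc (h ℕ.+ h) ℕ.+ suc (h ℕ.+ h) ℕ.+ suc (h ℕ.+ h))) ≡ (m ℕ.+ (h ℕ.+ h ℕ.+ h ℕ.+ 2)) ℕ.* 2
  eq = ℕ-Solver.solve-∀
... | inj₂ refl = contradiction refl (≥7⇒≢2 7≤p)

-- The exponent is `2 - m`, whose absolute value is `m - 2` only from `m = 2` on; hence the two
-- separate cases.
sign-exponent : ∀ m → [-1]^ (1ℤ ℤ.+ ℤ.- + m ℤ.+ 1ℤ) ≡ σ m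
sign-exponent zero          = refl
sign-exponent (suc zero)    = refl
sign-exponent (suc (suc m)) = trans
  (cong (-1ℤ ℤ.^_) (trans (cong ∣_∣ (eq (+ m))) (ℤ.∣-i∣≡∣i∣ (+ m))))
  (trans (σ-power m) (sym (ℤ.neg-involutive (σ m))))
  where
  eq : ∀ m → 1ℤ ℤ.+ ℤ.- (1ℤ ℤ.+ (1ℤ ℤ.+ m)) ℤ.+ 1ℤ ≡ ℤ.- m
  eq = solve-∀

module _ (r : ℤ) (r≤1 : r ℤ.≤ 1ℤ) where

  private
    m : ℕ
    m = ∣ 1ℤ ℤ.- r ∣

  r≡1-m : r ≡ 1ℤ ℤ.+ ℤ.- + m
  r≡1-m = trans (eq r) (cong (λ z → 1ℤ ℤ.+ ℤ.- z) (sym (ℤ.0≤i⇒+∣i∣≡i (ℤ.i≤j⇒0≤j-i r≤1))))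
    where
    eq : ∀ r → r ≡ 1ℤ ℤ.+ ℤ.- (1ℤ ℤ.+ ℤ.- r)
    eq = solve-∀

  -- With `3 - 2r = 2m + 1`, the excess `p - (3 - 2r) = (p - r) + 3 (r - 1)` is divisible by 3 and
  -- nonnegative by the bound on `p`; `d` is a third of it.
  gap : ∀ p → + p ≡ r [mod 3 ] → + 3 ℤ.- + 2 ℤ.* r ℤ.≤ + p → ∃ λ d → p ≡ suc (m ℕ.+ m ℕ.+ (d ℕ.+ d ℕ.+ d))
  gap p (mk (divides q p-r≡3q)) bound = d , ℤ.+-injective p≡
    where
    open ≡-Reasoning
    d : ℕ
    d = ∣ q ℤ.+ r ℤ.- 1ℤ ∣
    eq₁ : ∀ p r → p ℤ.+ ℤ.- (+ 3 ℤ.+ ℤ.- (+ 2 ℤ.* r)) ≡ p ℤ.+ ℤ.- r ℤ.+ (r ℤ.+ ℤ.- 1ℤ) ℤ.* + 3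
    eq₁ = solve-∀
    eq₂ : ∀ q r → q ℤ.* + 3 ℤ.+ (r ℤ.+ ℤ.- 1ℤ) ℤ.* + 3 ≡ (q ℤ.+ r ℤ.+ ℤ.- 1ℤ) ℤ.* + 3
    eq₂ = solve-∀
    excess : + p ℤ.+ ℤ.- (+ 3 ℤ.+ ℤ.- (+ 2 ℤ.* r)) ≡ (q ℤ.+ r ℤ.- 1ℤ) ℤ.* + 3
    excess = trans (eq₁ (+ p) r) (trans (cong (λ z → z ℤ.+ (r ℤ.+ ℤ.- 1ℤ) ℤ.* + 3) p-r≡3q) (eq₂ q r))
    +d≡ : + d ≡ q ℤ.+ r ℤ.- 1ℤ
    +d≡ = ℤ.0≤i⇒+∣i∣≡i (ℤ.*-cancelʳ-≤-pos 0ℤ (q ℤ.+ r ℤ.- 1ℤ) (+ 3) (subst (0ℤ ℤ.≤_) excess (ℤ.i≤j⇒0≤j-i bound)))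
    p≡ : + p ≡ + suc (m ℕ.+ m ℕ.+ (d ℕ.+ d ℕ.+ d))
    p≡ = begin
      + p
        ≡⟨ eq₃ (+ p) (+ 3 ℤ.+ ℤ.- (+ 2 ℤ.* r)) ⟩
      + 3 ℤ.+ ℤ.- (+ 2 ℤ.* r) ℤ.+ (+ p ℤ.+ ℤ.- (+ 3 ℤ.+ ℤ.- (+ 2 ℤ.* r)))
        ≡⟨ cong (λ z → + 3 ℤ.+ ℤ.- (+ 2 ℤ.* r) ℤ.+ z) (trans excess (cong (ℤ._* + 3) (sym +d≡))) ⟩
      + 3 ℤ.+ ℤ.- (+ 2 ℤ.* r) ℤ.+ + d ℤ.* + 3
        ≡⟨ cong (λ z → + 3 ℤ.+ ℤ.- (+ 2 ℤ.* z) ℤ.+ + d ℤ.* + 3) r≡1-m ⟩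
      + 3 ℤ.+ ℤ.- (+ 2 ℤ.* (1ℤ ℤ.+ ℤ.- + m)) ℤ.+ + d ℤ.* + 3
        ≡⟨ eq₄ (+ m) (+ d) ⟩
      1ℤ ℤ.+ (+ m ℤ.+ + m ℤ.+ (+ d ℤ.+ + d ℤ.+ + d)) ∎
      where
      eq₃ : ∀ p z → p ≡ z ℤ.+ (p ℤ.+ ℤ.- z)
      eq₃ = solve-∀
      eq₄ : ∀ m d → + 3 ℤ.+ ℤ.- (+ 2 ℤ.* (1ℤ ℤ.+ ℤ.- m)) ℤ.+ d ℤ.* + 3 ≡ 1ℤ ℤ.+ (m ℤ.+ m ℤ.+ (d ℤ.+ d ℤ.+ d))
      eq₄ = solve-∀

-- Specialisation to r/3 and p/3

module Setting
  (r : ℤ) (r≤1 : r ℤ.≤ 1ℤ) (p : ℕ) (p-prime : Prime p) (7≤p : 7 ℕ.≤ p)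
  (p≡r : + p ≡ r [mod 3 ]) (bound : + 3 ℤ.- + 2 ℤ.* r ℤ.≤ + p)
  where

  open PAdic p p-prime
  open MoritaGamma (≥7⇒≢2 7≤p)
  open PrimePower p p-prime
  open GammaModulo p p-prime 7≤p
  open Approximation p p-prime

  unit-3 : Unit (+ 3)
  unit-3 = unit-ℕ (ℕ.≤-trans (ℕ.s≤s (ℕ.s≤s (ℕ.s≤s (ℕ.s≤s ℕ.z≤n)))) 7≤p) (λ ())

  m d w n : ℕ
  m = ∣ 1ℤ ℤ.- r ∣
  d = proj₁ (gap r r≤1 p p≡r bound)
  -- A natural number inverting 3 modulo `p⁵`: the reflection formula at `s` and `2s` is obtained by
  -- induction on a natural multiple of `p`.
  w = residue 5 (Unit.inverse unit-3)
  n = m ℕ.+ d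

  p≡ : p ≡ suc (m ℕ.+ m ℕ.+ (d ℕ.+ d ℕ.+ d))
  p≡ = proj₂ (gap r r≤1 p p≡r bound)

  -- The integer a represents r/3 modulo p⁵, and a + n = p w represents p/3.
  a : ℤ
  a = + (p ℕ.* w) ℤ.+ ℤ.- + n

  s≡pw : a ℤ.+ + n ≡ + (p ℕ.* w)
  s≡pw = eq (+ (p ℕ.* w)) (+ n)
    where
    eq : ∀ x n → x ℤ.+ ℤ.- n ℤ.+ n ≡ x
    eq = solve-∀

  3s≡p : a ℤ.+ + n ℤ.+ (a ℤ.+ + n) ℤ.+ (a ℤ.+ + n) ≡ + p [mod p ℕ.^ 5 ]
  3s≡p = ≈-trans (≡⇒≈ (trans (cong (λ z → z ℤ.+ z ℤ.+ z) (trans s≡pw (ℤ.pos-* p w))) (eq (+ p) (+ w))))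
    (≈-trans (*-≈ˡ (+ p) (≈-trans (*-≈ˡ (+ 3) (residue≈ 5 (Unit.inverse unit-3))) (Unit.x*inverse unit-3))) (≡⇒≈ (ℤ.*-identityʳ (+ p))))
    where
    eq : ∀ p w → p ℤ.* w ℤ.+ p ℤ.* w ℤ.+ p ℤ.* w ≡ p ℤ.* (+ 3 ℤ.* w)
    eq = solve-∀

  even : σ d ≡ 1ℤ
  even = even-gap p m d p-prime 7≤p p≡

  open GammaQuotient p p-prime 7≤p m d w p≡ even a s≡pw 3s≡p using (n<p; p∣s)
  open Deformation.Sums p p-prime n n<p a p∣s using (unit-!)
  open Assembly p p-prime 7≤p m d w p≡ even a s≡pw 3s≡p using (q; 3a≈1-m; unit-2A; supercongruence)

  3a≈r : + 3 ℤ.* a ≡ r [mod p ℕ.^ 5 ]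
  3a≈r = ≈-trans 3a≈1-m (≡⇒≈ (sym (r≡1-m r r≤1)))

  r-1↦-m : ι (r ℤ.- 1ℤ) ↦ ℤ.- + m
  r-1↦-m = ↦-ι (≡⇒≈ (trans (cong (λ z → z ℤ.+ ℤ.- 1ℤ) (r≡1-m r r≤1)) (eq (+ m))))
    where
    eq : ∀ m → 1ℤ ℤ.+ ℤ.- m ℤ.+ ℤ.- 1ℤ ≡ ℤ.- m
    eq = solve-∀

  1↦1 : 1# ↦ 1ℤ
  1↦1 = represented ≈-refl

  r/3↦a : ι r / ι (+ 3) ↦ a
  r/3↦a = ↦-cancel (quotient {ι r} {ι (+ 3)} (↦-ι ≈-refl) (↦-ι ≈-refl) unit-3) unit-3 a
    (≈-trans (≈-sym 3a≈r) (≡⇒≈ (ℤ.*-comm (+ 3) a)))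

  2r/3↦2a : ∀ {v} → v ↦ + 3 → ι (+ 2 ℤ.* r) / v ↦ a ℤ.+ a
  2r/3↦2a {v} v↦3 = ↦-cancel (quotient {ι (+ 2 ℤ.* r)} {v} (↦-ι ≈-refl) v↦3 unit-3) unit-3 (a ℤ.+ a)
    (≈-trans (*-≈ˡ (+ 2) (≈-sym 3a≈r)) (≡⇒≈ (eq a)))
    where
    eq : ∀ a → + 2 ℤ.* (+ 3 ℤ.* a) ≡ (a ℤ.+ a) ℤ.* + 3
    eq = solve-∀

  Γ↦G : ∀ {x u} → x ↦ u → Γₚ x ↦ G u
  Γ↦G {x} (represented e) = represented (≈-trans (≡⇒≈ (sym (G-def (approx x 5)))) (G-≈ e))

  sign : [-1]^ (r ℤ.+ 1ℤ) ≡ σ m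
  sign = trans (cong (λ z → [-1]^ (z ℤ.+ 1ℤ)) (r≡1-m r r≤1)) (sign-exponent m)

  record Atoms (x y c one v : ℤₚ) : Set where
    constructor atoms
    field
      x↦a   : x ↦ a
      y↦2a  : y ↦ a ℤ.+ a
      c↦-m  : c ↦ ℤ.- + m
      one↦1 : one ↦ 1ℤ
      v↦3   : v ↦ + 3

  -- The atoms are variables, and the hypothesis on them is an instance, so that they are read off the goal before
  -- it is consulted; otherwise closed p-adic expressions would be compared by unfolding them.
  congruence : ∀ {x y c one v} {{_ : Atoms x y c one v}} →
    (∑[ k < p ] (ι (+ 6 ℤ.* + toℕ k ℤ.+ r) * (pochhammer x (toℕ k) ^ 6 / pochhammer one (toℕ k) ^ 6)))
      ≡ ι ([-1]^ (r ℤ.+ 1ℤ)) * ι (+ p) * (Γₚ x ^ 6 / Γₚ (ι (+ 2 ℤ.* r) / v) ^ 3)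
          * (∑[ k ≤ ∣ 1ℤ ℤ.- r ∣ ]
              ((pochhammer c (toℕ k) * pochhammer x (toℕ k) ^ 3)
                / (pochhammer one (toℕ k) * pochhammer y (toℕ k) ^ 3)))
      [mod-p^ 5 ]
  congruence {x} {y} {c} {one} {v} {{atoms x↦a y↦2a c↦-m one↦1 v↦3}} = ↦⇒mod-p^
    (↦-sum-< q p p≡ (λ k → ι (+ 6 ℤ.* + toℕ k ℤ.+ r) * (pochhammer x (toℕ k) ^ 6 / pochhammer one (toℕ k) ^ 6))
      (λ k → (+ 6 ℤ.* + k ℤ.+ (1ℤ ℤ.+ ℤ.- + m)) ℤ.* approx (pochhammer x k ^ 6 / pochhammer one k ^ 6) 5)
      (λ k → ↦-* (↦-ι (≡⇒≈ (cong (λ z → + 6 ℤ.* + toℕ k ℤ.+ z) (r≡1-m r r≤1)))) (represented ≈-refl)))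
    (↦-* (↦-* (↦-* (↦-ι (≡⇒≈ sign)) (↦-ι ≈-refl)) (represented ≈-refl))
      (↦-sum m (λ k → (pochhammer c (toℕ k) * pochhammer x (toℕ k) ^ 3) / (pochhammer one (toℕ k) * pochhammer y (toℕ k) ^ 3))
        (λ k → approx ((pochhammer c k * pochhammer x k ^ 3) / (pochhammer one k * pochhammer y k ^ 3)) 5)
        (λ _ → represented ≈-refl)))
    (supercongruence _ _ _ (λ k k<p → Quotient.z*v≈u (left k k<p)) (λ k k≤m → Quotient.z*v≈u (right k k≤m)) (Quotient.z*v≈u gamma))
    where
    left : ∀ k → k ℕ.< p → Quotient (pochhammer x k ^ 6 / pochhammer one k ^ 6) (P a k ℤ.^ 6) (P 1ℤ k ℤ.^ 6)
    left k k<p = quotient (↦-^ 6 (↦-pochhammer k x↦a)) (↦-^ 6 (↦-pochhammer k one↦1)) (unit-^ 6 (unit-! k k<p))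
    right : ∀ k → k ℕ.≤ m → Quotient ((pochhammer c k * pochhammer x k ^ 3) / (pochhammer one k * pochhammer y k ^ 3))
      (P (ℤ.- + m) k ℤ.* P a k ℤ.^ 3) (P 1ℤ k ℤ.* P (a ℤ.+ a) k ℤ.^ 3)
    right k k≤m = quotient
      (↦-* (↦-pochhammer k c↦-m) (↦-^ 3 (↦-pochhammer k x↦a)))
      (↦-* (↦-pochhammer k one↦1) (↦-^ 3 (↦-pochhammer k y↦2a)))
      (unit-* (unit-! k (ℕ.≤-<-trans (ℕ.≤-trans k≤m (ℕ.m≤m+n m d)) n<p)) (unit-^ 3 (unit-2A k k≤m)))
    gamma : Quotient (Γₚ x ^ 6 / Γₚ (ι (+ 2 ℤ.* r) / v) ^ 3) (G a ℤ.^ 6) (G (a ℤ.+ a) ℤ.^ 3)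
    gamma = quotient (↦-^ 6 (Γ↦G x↦a)) (↦-^ 3 (Γ↦G (2r/3↦2a v↦3))) (unit-^ 3 (unit-G (a ℤ.+ a)))

theorem1p2 :
  (r : ℤ) → r ℤ.≤ 1ℤ → Coprime r (+ 3) →
  (p : ℕ) (p-prime : Prime p) (7≤p : 7 ℕ.≤ p) →
  + p ≡ r [mod 3 ] → + 3 ℤ.- + 2 ℤ.* r ℤ.≤ + p →
  let open PAdic p p-prime
      open MoritaGamma (≥7⇒≢2 7≤p)
      r/3  = ι r / ι (+ 3)
      2r/3 = ι (+ 2 ℤ.* r) / ι (+ 3)
  in
  (∑[ k < p ] (ι (+ 6 ℤ.* + toℕ k ℤ.+ r) * (pochhammer r/3 (toℕ k) ^ 6 / pochhammer 1# (toℕ k) ^ 6)))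
    ≡ ι ([-1]^ (r ℤ.+ 1ℤ)) * ι (+ p) * (Γₚ r/3 ^ 6 / Γₚ 2r/3 ^ 3)
        * (∑[ k ≤ ∣ 1ℤ ℤ.- r ∣ ]
            ((pochhammer (ι (r ℤ.- 1ℤ)) (toℕ k) * pochhammer r/3 (toℕ k) ^ 3)
              / (pochhammer 1# (toℕ k) * pochhammer 2r/3 (toℕ k) ^ 3)))
    [mod-p^ 5 ]
theorem1p2 r r≤1 _ p p-prime 7≤p p≡r bound = congruence
  where
  open PAdic p p-prime
  open Approximation p p-prime
  open Setting r r≤1 p p-prime 7≤p p≡r bound
  instance
    r-atoms : Atoms (ι r / ι (+ 3)) (ι (+ 2 ℤ.* r) / ι (+ 3)) (ι (r ℤ.- 1ℤ)) 1# (ι (+ 3))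
    r-atoms = atoms r/3↦a (2r/3↦2a (↦-ι ≈-refl)) r-1↦-m 1↦1 (↦-ι ≈-refl)
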